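{- Let $q$ be a prime with $2 \leq q < 10^5$. Every integer $n > 4$ can be written as $n = p_1 + p_2 + \eta$, where $p_1, p_2$ are primes (not necessarily distinct) and $\eta$ is a square-free number co-prime to $q$.
   Context: A square-free number is a positive integer not divisible by the square of any prime; in particular $1$ is square-free. -}

module Defs where

open import Data.Nat.Base using (ℕ; _^_; _>_)
open import Data.Nat.Divisibility using (_∤_)
open import Data.Nat.Primality using (Prime)
open import Data.Product.Base using (_×_)

SquareFree : ℕ → Set
SquareFree n = n > 0 × (∀ {p} → Prime p → p ^ 2 ∤ n)

{-# OPTIONS --safe #-}
-- Subtracting the prime 2 or 3 leaves an even N, to be written as p + η.
--
-- For N < 2¹⁸ it suffices to find primes p and p′ which differ by a power of two such that the odd
-- numbers N − p and N − p′ are square-free, because q divides at most one of them.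
--
-- For N ≥ 2¹⁸ compare products of primes. Chebyshev's quotient (30m)! m! / ((15m)! (10m)! (6m)!)
-- shows that the product of the primes up to N is at least 2 ^ (1.329 N), up to lower order terms.
-- If no p worked, every odd prime p < N would satisfy q ∣ N − p or a² ∣ N − p for an odd prime
-- a ≤ √N, and so lie in a given progression modulo 2q or 2a². The product of the M terms r + k i ≤ N
-- of a progression is at most kᴹ M!, and is divisible by the part of M! prime to k. Hence its prime
-- terms above M have product at most kᴹ h, where Legendre's formula bounds the remaining part h
-- of M!. These bounds, summed over q and all a, stay below 2 ^ (1.329 N). The sum converges because
-- the exponents are of order N log a / a², and only for q = 3 ∤ N must one use that the primes
-- outside the class modulo 3 lie in a single class modulo 6a².
module Submission where

open import Defs
open import Data.Bool.Base using (Bool; true; false; T; _∧_; _∨_)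
open import Data.Bool.Properties using (T-∧; T-∨)
open import Data.Empty using (⊥; ⊥-elim)
open import Data.List.Base using (List; []; _∷_; map)
open import Data.List.Membership.Propositional using (_∈_)
open import Data.List.Membership.Propositional.Properties using (∈-map⁺)
open import Data.List.Relation.Unary.All as All using (All; []; _∷_)
open import Data.List.Relation.Unary.Any using (Any; here; there; any?)
open import Data.Nat.Base
open import Data.Nat.Coprimality using (Coprime; coprime-divisor; coprime-Bézout)
  renaming (sym to coprime-sym)
open import Data.Nat.Divisibility
open import Data.Nat.DivMod
open import Data.Nat.GCD using (module Bézout)
open import Data.Nat.Induction using (<-rec)
open import Data.Nat.ListAction using (product)
open import Data.Nat.Primality
open import Data.Nat.Primality.Factorisation using (factorise; module PrimeFactorisation)
open import Data.Nat.Properties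
open import Data.Nat.Tactic.RingSolver using (solve-∀)
open import Data.List.Membership.DecPropositional _≟_ using (_∈?_)
open import Data.Product.Base using (∃-syntax; _×_; _,_; proj₁; proj₂)
open import Data.Sum.Base using (_⊎_; inj₁; inj₂)
open import Data.Unit.Base using (tt)
open import Function.Base using (_∘_; id; case_of_)
open import Function.Bundles using (module Equivalence)
open import Relation.Binary.PropositionalEquality
open import Relation.Nullary.Decidable
  using (Dec; yes; no; _×-dec_; _⊎-dec_; _→-dec_; ¬?; toWitness)
open import Relation.Nullary.Negation using (¬_; contradiction)

-- Finite products and sums

-- The margin dictates the constants. Per unit of N, the class of q and the classes of a < 256 cost
-- at most 37600 / 32768 ≈ 1.147 bits, the larger a at most 23 / 512 ≈ 0.045, and the primes up to N
-- / 128 at most 3 / 128 ≈ 0.023. The total 1.216 exceeds the 1 bit per unit that central binomial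
-- coefficients would give, hence Chebyshev's quotient with its 1.328. The remaining 0.112 has to
-- absorb terms of order √N log N, which it does from 2¹⁸ on. The primes up to N / 128 are set apart
-- because the progression argument only sees primes above the number M of terms. It is therefore
-- repeated on the primes up to M, and for the smallest modulus, 6, three rounds descend below N /
-- 128. No real logarithm occurs: bounds compare a fixed power of a natural number with a power of
-- 2, and the exponents 1 / (l - 1) from Legendre's formula are cleared by a common multiple of the
-- numbers l - 1.

∏ ∑ : ℕ → (ℕ → ℕ) → ℕ
∏ zero    f = 1
∏ (suc n) f = ∏ n f * f n
∑ zero    f = 0
∑ (suc n) f = ∑ n f + f n

only : ∀ {P : Set} → Dec P → ℕ → ℕ
only (yes _) x = x
only (no _)  x = 1

χ : ∀ {P : Set} → Dec P → ℕ
χ (yes _) = 1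
χ (no _)  = 0

χ-cong : ∀ {P Q : Set} {p : Dec P} {q : Dec Q} → (P → Q) → (Q → P) → χ p ≡ χ q
χ-cong {p = yes _} {yes _} f g = refl
χ-cong {p = yes p} {no ¬q} f g = contradiction (f p) ¬q
χ-cong {p = no ¬p} {yes q} f g = contradiction (g q) ¬p
χ-cong {p = no _}  {no _}  f g = refl

χ-yes : ∀ {P : Set} {d : Dec P} → P → χ d ≡ 1
χ-yes {d = yes _} p = refl
χ-yes {d = no ¬p} p = contradiction p ¬p

χ-no : ∀ {P : Set} {d : Dec P} → ¬ P → χ d ≡ 0
χ-no {d = yes p} ¬p = contradiction p ¬p
χ-no {d = no _}  ¬p = refl

only-yes : ∀ {P : Set} {d : Dec P} {x} → P → only d x ≡ x
only-yes {d = yes _} p = refl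
only-yes {d = no ¬p} p = contradiction p ¬p

only-no : ∀ {P : Set} {d : Dec P} {x} → ¬ P → only d x ≡ 1
only-no {d = yes p} ¬p = contradiction p ¬p
only-no {d = no _}  ¬p = refl

only-≥1 : ∀ {P : Set} (d : Dec P) {x} → 1 ≤ x → 1 ≤ only d x
only-≥1 (yes _) x≥1 = x≥1
only-≥1 (no _)  x≥1 = ≤-refl

∏-cong : ∀ n {f g} → (∀ i → i < n → f i ≡ g i) → ∏ n f ≡ ∏ n g
∏-cong zero    f≡g = refl
∏-cong (suc n) f≡g =
  cong₂ _*_ (∏-cong n (λ i i<n → f≡g i (m<n⇒m<1+n i<n))) (f≡g n ≤-refl)

∑-cong : ∀ n {f g} → (∀ i → i < n → f i ≡ g i) → ∑ n f ≡ ∑ n g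
∑-cong zero    f≡g = refl
∑-cong (suc n) f≡g =
  cong₂ _+_ (∑-cong n (λ i i<n → f≡g i (m<n⇒m<1+n i<n))) (f≡g n ≤-refl)

∏-mono : ∀ n {f g} → (∀ i → i < n → f i ≤ g i) → ∏ n f ≤ ∏ n g
∏-mono zero    f≤g = ≤-refl
∏-mono (suc n) f≤g =
  *-mono-≤ (∏-mono n (λ i i<n → f≤g i (m<n⇒m<1+n i<n))) (f≤g n ≤-refl)

∑-mono : ∀ n {f g} → (∀ i → i < n → f i ≤ g i) → ∑ n f ≤ ∑ n g
∑-mono zero    f≤g = ≤-refl
∑-mono (suc n) f≤g =
  +-mono-≤ (∑-mono n (λ i i<n → f≤g i (m<n⇒m<1+n i<n))) (f≤g n ≤-refl)

∏-one : ∀ n {f} → (∀ i → i < n → f i ≡ 1) → ∏ n f ≡ 1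
∏-one zero    f≡1 = refl
∏-one (suc n) f≡1 =
  cong₂ _*_ (∏-one n (λ i i<n → f≡1 i (m<n⇒m<1+n i<n))) (f≡1 n ≤-refl)

∑-zero : ∀ n {f} → (∀ i → i < n → f i ≡ 0) → ∑ n f ≡ 0
∑-zero zero    f≡0 = refl
∑-zero (suc n) f≡0 =
  cong₂ _+_ (∑-zero n (λ i i<n → f≡0 i (m<n⇒m<1+n i<n))) (f≡0 n ≤-refl)

∏-≥1 : ∀ n {f} → (∀ i → i < n → 1 ≤ f i) → 1 ≤ ∏ n f
∏-≥1 n {f} f≥1 = subst (_≤ ∏ n f) (∏-one n {λ _ → 1} (λ _ _ → refl)) (∏-mono n f≥1)

∏-* : ∀ n f g → ∏ n (λ i → f i * g i) ≡ ∏ n f * ∏ n g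
∏-* zero    f g = refl
∏-* (suc n) f g = trans (cong (_* (f n * g n)) (∏-* n f g)) (interchange (∏ n f) _ _ _)
  where
  interchange : ∀ a b c d → (a * b) * (c * d) ≡ (a * c) * (b * d)
  interchange = solve-∀

∑-+ : ∀ n f g → ∑ n (λ i → f i + g i) ≡ ∑ n f + ∑ n g
∑-+ zero    f g = refl
∑-+ (suc n) f g = trans (cong (_+ (f n + g n)) (∑-+ n f g)) (interchange (∑ n f) _ _ _)
  where
  interchange : ∀ a b c d → (a + b) + (c + d) ≡ (a + c) + (b + d)
  interchange = solve-∀

∑-*ˡ : ∀ n c f → ∑ n (λ i → c * f i) ≡ c * ∑ n f
∑-*ˡ zero    c f = sym (*-zeroʳ c)
∑-*ˡ (suc n) c f = trans (cong (_+ c * f n) (∑-*ˡ n c f)) (sym (*-distribˡ-+ c (∑ n f) (f n)))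

∏-swap : ∀ m n (f : ℕ → ℕ → ℕ) →
         ∏ m (λ i → ∏ n (λ j → f i j)) ≡ ∏ n (λ j → ∏ m (λ i → f i j))
∏-swap zero    n f = sym (∏-one n (λ _ _ → refl))
∏-swap (suc m) n f = trans (cong (_* ∏ n (f m)) (∏-swap m n f)) (sym (∏-* n _ (f m)))

∑-swap : ∀ m n (f : ℕ → ℕ → ℕ) →
         ∑ m (λ i → ∑ n (λ j → f i j)) ≡ ∑ n (λ j → ∑ m (λ i → f i j))
∑-swap zero    n f = sym (∑-zero n (λ _ _ → refl))
∑-swap (suc m) n f = trans (cong (_+ ∑ n (f m)) (∑-swap m n f)) (sym (∑-+ n _ (f m)))

∏-^ : ∀ n b f → ∏ n (λ i → b ^ f i) ≡ b ^ ∑ n f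
∏-^ zero    b f = refl
∏-^ (suc n) b f = trans (cong (_* b ^ f n) (∏-^ n b f)) (sym (^-distribˡ-+-* b (∑ n f) (f n)))

∏-const : ∀ n c → ∏ n (λ _ → c) ≡ c ^ n
∏-const zero    c = refl
∏-const (suc n) c = trans (cong (_* c) (∏-const n c)) (*-comm (c ^ n) c)

∑-const : ∀ n c → ∑ n (λ _ → c) ≡ n * c
∑-const zero    c = refl
∑-const (suc n) c = trans (cong (_+ c) (∑-const n c)) (+-comm (n * c) c)

∏-split : ∀ m n f → ∏ (m + n) f ≡ ∏ m f * ∏ n (λ i → f (m + i))
∏-split m zero    f = trans (cong (λ k → ∏ k f) (+-identityʳ m)) (sym (*-identityʳ _))
∏-split m (suc n) f = begin
  ∏ (m + suc n) f                                ≡⟨ cong (λ k → ∏ k f) (+-suc m n) ⟩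
  ∏ (m + n) f * f (m + n)                        ≡⟨ cong (_* f (m + n)) (∏-split m n f) ⟩
  ∏ m f * ∏ n (λ i → f (m + i)) * f (m + n)      ≡⟨ *-assoc (∏ m f) _ _ ⟩
  ∏ m f * (∏ n (λ i → f (m + i)) * f (m + n))    ∎
  where open ≡-Reasoning

∑-head : ∀ n f → ∑ (suc n) f ≡ f 0 + ∑ n (f ∘ suc)
∑-head zero    f = +-comm 0 (f 0)
∑-head (suc n) f = trans (cong (_+ f (suc n)) (∑-head n f)) (+-assoc (f 0) _ _)

∏-only-≟ : ∀ n l (f : ℕ → ℕ) → l < n → ∏ n (λ i → only (i ≟ l) (f i)) ≡ f l
∏-only-≟ (suc n) l f l<1+n with n ≟ l
... | yes refl = trans (cong (_* f l) (∏-one l (λ i i<l → only-no {d = i ≟ l} (<⇒≢ i<l)))) (*-identityˡ _)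
... | no  n≢l  = trans (*-identityʳ _)
  (∏-only-≟ n l f (≤∧≢⇒< (s≤s⁻¹ l<1+n) (n≢l ∘ sym)))

-- Prime factorisation as a product over all small primes, and Legendre's formula

prime≥2 : ∀ {p} → Prime p → 2 ≤ p
prime≥2 pr = nonTrivial⇒n>1 _ {{prime⇒nonTrivial pr}}

prime∣prime : ∀ {p l} → Prime p → Prime l → p ∣ l → p ≡ l
prime∣prime {p} {l} pr lr p∣l with prime⇒irreducible lr p∣l
... | inj₁ refl = contradiction (prime≥2 pr) λ { (s≤s ()) }
... | inj₂ p≡l  = p≡l

prime∣^ : ∀ {p} a j → Prime p → p ∣ a ^ j → p ∣ a
prime∣^ a zero pr p∣1 with ∣1⇒≡1 p∣1
... | refl = contradiction (prime≥2 pr) λ { (s≤s ()) }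
prime∣^ a (suc j) pr p∣ with euclidsLemma a (a ^ j) pr p∣
... | inj₁ p∣a = p∣a
... | inj₂ p∣r = prime∣^ a j pr p∣r

coprime-* : ∀ {a b c} → Coprime a c → Coprime b c → Coprime (a * b) c
coprime-* {a} {b} {c} a⊥c b⊥c {d} (d∣ab , d∣c) = b⊥c (coprime-divisor d⊥a d∣ab , d∣c)
  where
  d⊥a : Coprime d a
  d⊥a (e∣d , e∣a) = a⊥c (e∣a , ∣-trans e∣d d∣c)

coprime-^ : ∀ {a c} j → Coprime a c → Coprime (a ^ j) c
coprime-^ zero    a⊥c (d∣1 , _) = ∣1⇒≡1 d∣1
coprime-^ (suc j) a⊥c = coprime-* a⊥c (coprime-^ j a⊥c)

coprime-∏ : ∀ n {f c} → (∀ i → i < n → Coprime (f i) c) → Coprime (∏ n f) c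
coprime-∏ zero    f⊥c (d∣1 , _) = ∣1⇒≡1 d∣1
coprime-∏ (suc n) f⊥c =
  coprime-* (coprime-∏ n (λ i i<n → f⊥c i (m<n⇒m<1+n i<n))) (f⊥c n ≤-refl)

prime∤⇒coprime : ∀ {p n} → Prime p → ¬ p ∣ n → Coprime p n
prime∤⇒coprime pr p∤n (d∣p , d∣n) with prime⇒irreducible pr d∣p
... | inj₁ d≡1  = d≡1
... | inj₂ refl = contradiction d∣n p∤n

n<b^n : ∀ {b} n → 2 ≤ b → n < b ^ n
n<b^n zero    2≤b = s≤s z≤n
n<b^n {b} (suc n) 2≤b = begin
  2 + n             ≤⟨ s≤s (n<b^n n 2≤b) ⟩
  1 + b ^ n         ≤⟨ +-monoˡ-≤ (b ^ n) (≤-trans (s≤s z≤n) (n<b^n n 2≤b)) ⟩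
  b ^ n + b ^ n     ≡⟨ cong (b ^ n +_) (sym (+-identityʳ _)) ⟩
  2 * b ^ n         ≤⟨ *-monoˡ-≤ (b ^ n) 2≤b ⟩
  b * b ^ n         ∎
  where open ≤-Reasoning

-- The `p`-adic valuation of `x`, truncated at `J`. Counting the powers that divide `x` allows the
-- sums over `x` and `j` to be exchanged in Legendre's formula.
mult : ℕ → ℕ → ℕ → ℕ
mult J p x = ∑ J (λ j → χ (p ^ suc j ∣? x))

mult-other : ∀ J {p l} y → Prime p → Prime l → p ≢ l → mult J p (l * y) ≡ mult J p y
mult-other J {p} {l} y pr lr p≢l = ∑-cong J λ j _ → χ-cong
  (coprime-divisor (coprime-^ (suc j) p⊥l)) (∣n⇒∣m*n l)
  where
  p⊥l : Coprime p l
  p⊥l = prime∤⇒coprime pr (p≢l ∘ prime∣prime pr lr)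

-- Shifting the index by one turns the powers dividing `l * y` into those dividing `y`. The top
-- index, which the shift loses, counts nothing because `y < l ^ J` when `l * y ≤ J`.
mult-self : ∀ J {l} y → Prime l → 1 ≤ y → l * y ≤ J → mult J l (l * y) ≡ suc (mult J l y)
mult-self zero {l} y lr y≥1 ly≤J = contradiction
  (≤-trans (*-mono-≤ (≤-trans (s≤s z≤n) (prime≥2 lr)) y≥1) ly≤J) λ ()
mult-self (suc J) {l} y lr y≥1 ly≤J = begin
  mult (suc J) l (l * y)
    ≡⟨ ∑-head J _ ⟩
  χ (l ^ 1 ∣? l * y) + ∑ J (λ j → χ (l ^ suc (suc j) ∣? l * y))
    ≡⟨ cong₂ _+_ (χ-yes (subst (_∣ l * y) (sym (*-identityʳ l)) (m∣m*n y)))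
        (∑-cong J (λ j _ → χ-cong (*-cancelˡ-∣ l) (*-monoʳ-∣ l))) ⟩
  suc (∑ J (λ j → χ (l ^ suc j ∣? y)))
    ≡⟨ cong suc (sym (trans (cong (mult J l y +_) (χ-no (>⇒∤ y<l^J))) (+-identityʳ _))) ⟩
  suc (mult (suc J) l y) ∎
  where
  open ≡-Reasoning
  instance
    l≢0 : NonZero l
    l≢0 = prime⇒nonZero lr
    y≢0 : NonZero y
    y≢0 = >-nonZero y≥1
  y<l^J : y < l ^ suc J
  y<l^J = <-≤-trans (s≤s (≤-trans (m≤n*m y l) ly≤J)) (n<b^n (suc J) (prime≥2 lr))

primePowers : ℕ → ℕ → ℕ → ℕ
primePowers B J x = ∏ B (λ p → only (prime? p) (p ^ mult J p x))

-- Induction on the prime factors: prepending `l` changes only the slot `p = l`, which is multiplied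
-- by `l`.
primePowers-product : ∀ B J as → All Prime as → product as < B → product as ≤ J →
                      primePowers B J (product as) ≡ product as
primePowers-product B J [] [] _ _ = ∏-one B factor≡1
  where
  factor≡1 : ∀ p → p < B → only (prime? p) (p ^ mult J p 1) ≡ 1
  factor≡1 p _ with prime? p
  ... | no _   = refl
  ... | yes pr = cong (p ^_) (∑-zero J λ j _ → χ-no (p^∤1 j))
    where
    p^∤1 : ∀ j → ¬ p ^ suc j ∣ 1
    p^∤1 j p^∣1 = contradiction (subst (2 ≤_) (m*n≡1⇒m≡1 p (p ^ j) (∣1⇒≡1 p^∣1)) (prime≥2 pr))
      λ { (s≤s ()) }
primePowers-product B J (l ∷ as) (lr ∷ asr) <B ≤J = begin
  primePowers B J (l * y)                                       ≡⟨ ∏-cong B step ⟩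
  ∏ B (λ p → only (prime? p) (p ^ mult J p y) * only (p ≟ l) p) ≡⟨ ∏-* B _ _ ⟩
  primePowers B J y * ∏ B (λ p → only (p ≟ l) p)
    ≡⟨ cong₂ _*_ (primePowers-product B J as asr (≤-<-trans y≤ly <B) (≤-trans y≤ly ≤J))
        (∏-only-≟ B l id (≤-<-trans l≤ly <B)) ⟩
  y * l                                                         ≡⟨ *-comm y l ⟩
  l * y                                                         ∎
  where
  open ≡-Reasoning
  y : ℕ
  y = product as
  instance
    l≢0 : NonZero l
    l≢0 = prime⇒nonZero lr
    y≢0 : NonZero y
    y≢0 = productOfPrimes≢0 asr
  y≤ly : y ≤ l * y
  y≤ly = m≤n*m y l
  l≤ly : l ≤ l * y
  l≤ly = m≤m*n l y
  step : ∀ p → p < B → only (prime? p) (p ^ mult J p (l * y)) ≡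
                       only (prime? p) (p ^ mult J p y) * only (p ≟ l) p
  step p _ with prime? p | p ≟ l
  ... | yes pr | yes refl = trans (cong (p ^_) (mult-self J y lr (>-nonZero⁻¹ y) ≤J)) (*-comm p _)
  ... | yes pr | no p≢l   = trans (cong (p ^_) (mult-other J y pr lr p≢l)) (sym (*-identityʳ _))
  ... | no ¬pr | yes refl = contradiction lr ¬pr
  ... | no ¬pr | no _     = refl

primePowers≡ : ∀ {B J} x → 1 ≤ x → x < B → x ≤ J → primePowers B J x ≡ x
primePowers≡ {B} {J} x x≥1 x<B x≤J = subst (λ z → z < B → z ≤ J → primePowers B J z ≡ z)
  (sym isFactorisation) (primePowers-product B J factors factorsPrime) x<B x≤J
  where
  open PrimeFactorisation (factorise x {{>-nonZero x≥1}})

multiples : ℕ → ℕ → ℕ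
multiples d n = ∑ n (λ x → χ (d ∣? suc x))

legendre : ℕ → ℕ → ℕ → ℕ
legendre J p n = ∑ J (λ j → multiples (p ^ suc j) n)

!≡∏ : ∀ n → n ! ≡ ∏ n suc
!≡∏ zero    = refl
!≡∏ (suc n) = trans (*-comm (suc n) (n !)) (cong (_* suc n) (!≡∏ n))

!≡∏legendre : ∀ {B J} n → n < B → n ≤ J →
              n ! ≡ ∏ B (λ p → only (prime? p) (p ^ legendre J p n))
!≡∏legendre {B} {J} n n<B n≤J = begin
  n !                          ≡⟨ !≡∏ n ⟩
  ∏ n suc                      ≡⟨ ∏-cong n (λ i i<n → sym (primePowers≡ (suc i) (s≤s z≤n)
                                    (≤-<-trans i<n n<B) (≤-trans i<n n≤J))) ⟩
  ∏ n (λ i → primePowers B J (suc i))                             ≡⟨ ∏-swap n B _ ⟩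
  ∏ B (λ p → ∏ n (λ i → only (prime? p) (p ^ mult J p (suc i))))  ≡⟨ ∏-cong B column ⟩
  ∏ B (λ p → only (prime? p) (p ^ legendre J p n))                ∎
  where
  open ≡-Reasoning
  column : ∀ p → p < B → ∏ n (λ i → only (prime? p) (p ^ mult J p (suc i))) ≡
                         only (prime? p) (p ^ legendre J p n)
  column p _ with prime? p
  ... | yes _ = trans (∏-^ n p _) (cong (p ^_) (∑-swap n J _))
  ... | no _  = ∏-one n (λ _ _ → refl)

multiples-rem : ∀ d n → 1 ≤ d → ∃[ r ] (r < d × n ≡ r + multiples d n * d)
multiples-rem d zero    d≥1 = 0 , d≥1 , refl
multiples-rem d (suc n) d≥1 with multiples-rem d n d≥1 | d ∣? suc n
... | r , r<d , n≡ | yes d∣ = 0 , d≥1 , (begin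
  suc n                        ≡⟨ cong suc n≡ ⟩
  suc r + multiples d n * d    ≡⟨ cong (_+ multiples d n * d) (≤-antisym r<d (∣⇒≤ d∣1+r)) ⟩
  d + multiples d n * d        ≡⟨ cong (_* d) (+-comm 1 (multiples d n)) ⟩
  (multiples d n + 1) * d      ∎)
  where
  open ≡-Reasoning
  d∣1+r : d ∣ suc r
  d∣1+r = ∣m+n∣m⇒∣n (subst (d ∣_) (trans (cong suc n≡) (+-comm (suc r) _)) d∣) (n∣m*n (multiples d n))
... | r , r<d , n≡ | no d∤ = suc r , ≤∧≢⇒< r<d 1+r≢d ,
  trans (cong suc n≡) (cong (λ c → suc r + c * d) (sym (+-identityʳ (multiples d n))))
  where
  1+r≢d : suc r ≢ d
  1+r≢d refl = d∤ (divides (suc (multiples d n)) (cong suc n≡))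

multiples≡/ : ∀ d n → .{{_ : NonZero d}} → multiples d n ≡ n / d
multiples≡/ d n with multiples-rem d n (>-nonZero⁻¹ d)
... | r , r<d , n≡ = sym (begin
  n / d                              ≡⟨ /-congˡ n≡ ⟩
  (r + multiples d n * d) / d        ≡⟨ +-distrib-/-∣ʳ r (n∣m*n (multiples d n)) ⟩
  r / d + multiples d n * d / d      ≡⟨ cong₂ _+_ (m<n⇒m/n≡0 r<d) (m*n/n≡m _ d) ⟩
  multiples d n                      ∎)
  where open ≡-Reasoning

-- With `y = n / p` the sum satisfies `L n = y + L y`. By induction on `J`, `L y * (p − 1) ≤ y`, so
-- the total is at most `y * (p − 1) + y = y * p ≤ n`.
legendre-bound : ∀ J z n → legendre J (suc z) n * z ≤ n
legendre-bound zero    z n = z≤n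
legendre-bound (suc J) z n = begin
  legendre (suc J) p n * z                  ≡⟨ cong (_* z) recursion ⟩
  (y + legendre J p y) * z                  ≡⟨ *-distribʳ-+ z y _ ⟩
  y * z + legendre J p y * z                ≤⟨ +-monoʳ-≤ (y * z) (legendre-bound J z y) ⟩
  y * z + y                                 ≡⟨ trans (+-comm _ y) (sym (*-suc y z)) ⟩
  y * p                                     ≤⟨ m/n*n≤m n p ⟩
  n                                         ∎
  where
  open ≤-Reasoning
  p y : ℕ
  p = suc z
  y = n / p
  recursion : legendre (suc J) p n ≡ y + legendre J p y
  recursion = trans (∑-head J _) (cong₂ _+_
    (trans (multiples≡/ (p ^ 1) n {{m^n≢0 p 1}})
           (/-congʳ {m = n} {{m^n≢0 p 1}} (*-identityʳ p)))
    (∑-cong J λ j _ → let instance _ = m^n≢0 p (suc j); _ = m^n≢0 p (suc (suc j)) in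
      trans (multiples≡/ (p ^ suc (suc j)) n)
      (trans (sym (m/n/o≡m/[n*o] n p (p ^ suc j)))
             (sym (multiples≡/ (p ^ suc j) y)))))

-- Primes in an arithmetic progression

∏-head : ∀ n f → ∏ (suc n) f ≡ f 0 * ∏ n (f ∘ suc)
∏-head zero    f = *-comm 1 (f 0)
∏-head (suc n) f = trans (cong (_* f (suc n)) (∏-head n f)) (*-assoc (f 0) _ _)

rising : ℕ → ℕ → ℕ
rising t M = ∏ M (λ i → t + i)

-- Pascal's rule for the binomial coefficients `rising t M / M !`, cleared of denominators.
rising-suc : ∀ t M → rising (suc t) (suc M) ≡ rising t (suc M) + suc M * rising (suc t) M
rising-suc t M = begin
  ∏ M (λ i → suc t + i) * (suc t + M)          ≡⟨ expand (∏ M (λ i → suc t + i)) t M ⟩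
  t * ∏ M (λ i → suc t + i) + suc M * rising (suc t) M
    ≡⟨ cong (_+ suc M * rising (suc t) M) (sym head) ⟩
  rising t (suc M) + suc M * rising (suc t) M  ∎
  where
  open ≡-Reasoning
  expand : ∀ R t M → R * (suc t + M) ≡ t * R + suc M * R
  expand = solve-∀
  head : rising t (suc M) ≡ t * ∏ M (λ i → suc t + i)
  head = trans (∏-head M (t +_)) (cong₂ _*_ (+-identityʳ t) (∏-cong M (λ i _ → +-suc t i)))

!∣rising : ∀ t M → M ! ∣ rising t M
!∣rising t       zero    = ∣-refl
!∣rising zero    (suc M) = subst ((suc M) ! ∣_) (sym (∏-head M (0 +_))) (_ ∣0)
!∣rising (suc t) (suc M) = subst ((suc M) ! ∣_) (sym (rising-suc t M))
  (∣m∣n⇒∣m+n (!∣rising t (suc M)) (*-monoʳ-∣ (suc M) (!∣rising (suc t) M)))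

infix 4 _≡_[mod_]

-- Multiples of `G` are added on both sides, which avoids subtraction.
_≡_[mod_] : ℕ → ℕ → ℕ → Set
a ≡ b [mod G ] = ∃[ u ] ∃[ v ] a + G * u ≡ b + G * v

∏-mod : ∀ n {G f g} → (∀ i → i < n → f i ≡ g i [mod G ]) → ∏ n f ≡ ∏ n g [mod G ]
∏-mod zero    f≡g = 0 , 0 , refl
∏-mod (suc n) {G} {f} {g} f≡g
  with ∏-mod n {G} {f} {g} (λ i i<n → f≡g i (m<n⇒m<1+n i<n)) | f≡g n ≤-refl
... | u , v , e | u′ , v′ , e′ =
  ∏ n f * u′ + u * f n + G * (u * u′) , ∏ n g * v′ + v * g n + G * (v * v′) ,
  trans (expand (∏ n f) (f n) G u u′) (trans (cong₂ _*_ e e′) (sym (expand (∏ n g) (g n) G v v′)))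
  where
  expand : ∀ a b G u w → a * b + G * (a * w + u * b + G * (u * w)) ≡ (a + G * u) * (b + G * w)
  expand = solve-∀

∣-mod : ∀ {a b G} → a ≡ b [mod G ] → G ∣ a → G ∣ b
∣-mod {a} {b} {G} (u , v , e) G∣a = ∣m+n∣m⇒∣n
  (subst (G ∣_) (trans e (+-comm b _)) (∣m∣n⇒∣m+n G∣a (m∣m*n u))) (m∣m*n v)

solve-mod : ∀ {k G} r → Coprime k G → ∃[ t ] k * t ≡ r [mod G ]
solve-mod {k} {G} r k⊥G with coprime-Bézout k⊥G
... | Bézout.+- x y e = x * r , 0 , y * r , (begin
  k * (x * r) + G * 0      ≡⟨ swap k x r G ⟩
  x * k * r                ≡⟨ cong (_* r) (sym e) ⟩
  (1 + y * G) * r          ≡⟨ fin y G r ⟩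
  r + G * (y * r)          ∎)
  where
  open ≡-Reasoning
  swap : ∀ k x r G → k * (x * r) + G * 0 ≡ x * k * r
  swap = solve-∀
  fin : ∀ y G r → (1 + y * G) * r ≡ r + G * (y * r)
  fin = solve-∀
-- Here `x * k ≡ − 1`, so the inverse of `k` is taken to be `x * (x * k)`: its product with `k` is
-- the square of `x * k`.
... | Bézout.-+ x y e = x * r * (x * k) , 2 * y * r , y * (y * G) * r , (begin
  k * (x * r * (x * k)) + G * (2 * y * r)    ≡⟨ left k x r G y ⟩
  ((x * k) * (x * k) + 2 * (y * G)) * r      ≡⟨ cong (λ e → ((x * k) * (x * k) + 2 * e) * r) (sym e) ⟩
  ((x * k) * (x * k) + 2 * (1 + x * k)) * r  ≡⟨ mid (x * k) r ⟩
  r + (1 + x * k) * (1 + x * k) * r          ≡⟨ cong (λ e → r + e * e * r) e ⟩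
  r + y * G * (y * G) * r                    ≡⟨ right y G r ⟩
  r + G * (y * (y * G) * r)                  ∎)
  where
  open ≡-Reasoning
  left : ∀ k x r G y → k * (x * r * (x * k)) + G * (2 * y * r) ≡ ((x * k) * (x * k) + 2 * (y * G)) * r
  left = solve-∀
  mid : ∀ w r → (w * w + 2 * (1 + w)) * r ≡ r + (1 + w) * (1 + w) * r
  mid = solve-∀
  right : ∀ y G r → r + y * G * (y * G) * r ≡ r + G * (y * (y * G) * r)
  right = solve-∀

-- As `k` is invertible modulo `G`, some `t` has `k * t ≡ r`. The product is then congruent to
-- `k ^ M` times the product of the `M` consecutive numbers from `t` on, which `M !` divides.
∣∏progression : ∀ {k G} r M → Coprime k G → G ∣ M ! → G ∣ ∏ M (λ i → r + k * i)
∣∏progression {k} {G} r M k⊥G G∣M! with solve-mod r k⊥G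
... | t , u , v , e = ∣-mod {G = G} (∏-mod M {G} λ i _ → u , v , shift i) G∣
  where
  shift : ∀ i → k * (t + i) + G * u ≡ r + k * i + G * v
  shift i = trans (split k t i (G * u)) (trans (cong (_+ k * i) e) (move r (G * v) (k * i)))
    where
    split : ∀ k t i x → k * (t + i) + x ≡ k * t + x + k * i
    split = solve-∀
    move : ∀ r x y → r + x + y ≡ r + y + x
    move = solve-∀
  G∣ : G ∣ ∏ M (λ i → k * (t + i))
  G∣ = subst (G ∣_) (sym (∏-* M (λ _ → k) (t +_)))
    (∣n⇒∣m*n (∏ M (λ _ → k)) (∣-trans G∣M! (!∣rising t M)))

∏progression≤ : ∀ {k r} M → r ≤ k → ∏ M (λ i → r + k * i) ≤ k ^ M * M !
∏progression≤ {k} {r} M r≤k = begin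
  ∏ M (λ i → r + k * i)    ≤⟨ ∏-mono M (λ i _ → ≤-trans (+-monoˡ-≤ (k * i) r≤k) (≤-reflexive (sym (*-suc k i)))) ⟩
  ∏ M (λ i → k * suc i)    ≡⟨ ∏-* M (λ _ → k) suc ⟩
  ∏ M (λ _ → k) * ∏ M suc  ≡⟨ cong₂ _*_ (∏-const M k) (sym (!≡∏ M)) ⟩
  k ^ M * M !              ∎
  where open ≤-Reasoning

∣-coprime-* : ∀ {m n E} → Coprime m n → m ∣ E → n ∣ E → m * n ∣ E
∣-coprime-* {m} {n} m⊥n (divides c refl) n∣E =
  subst (_∣ c * m) (*-comm n m) (*-monoˡ-∣ m (coprime-divisor (coprime-sym m⊥n) (subst (n ∣_) (*-comm c m) n∣E)))

∏primes∣ : ∀ n {P : ℕ → Set} (P? : ∀ i → Dec (P i)) {E} →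
           (∀ i → i < n → P i → Prime i × i ∣ E) → ∏ n (λ i → only (P? i) i) ∣ E
∏primes∣ zero    P? h = 1∣ _
∏primes∣ (suc n) P? {E} h with P? n
... | no _  = subst (_∣ E) (sym (*-identityʳ _)) (∏primes∣ n P? (λ i i<n → h i (m<n⇒m<1+n i<n)))
... | yes p = ∣-coprime-* (coprime-∏ n cop) (∏primes∣ n P? (λ i i<n → h i (m<n⇒m<1+n i<n)))
    (proj₂ (h n ≤-refl p))
  where
  cop : ∀ i → i < n → Coprime (only (P? i) i) n
  cop i i<n with P? i
  ... | no _  = λ (d∣1 , _) → ∣1⇒≡1 d∣1
  ... | yes q = prime∤⇒coprime pr (λ i∣n → <⇒≢ i<n (prime∣prime pr (proj₁ (h n ≤-refl p)) i∣n))
    where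
    pr : Prime i
    pr = proj₁ (h i (m<n⇒m<1+n i<n) q)

prime∣!⇒≤ : ∀ {p} M → Prime p → p ∣ M ! → p ≤ M
prime∣!⇒≤ zero    pr p∣1 = contradiction (subst (2 ≤_) (∣1⇒≡1 p∣1) (prime≥2 pr)) λ { (s≤s ()) }
prime∣!⇒≤ (suc M) pr p∣ with euclidsLemma (suc M) (M !) pr p∣
... | inj₁ p∣1+M = ∣⇒≤ p∣1+M
... | inj₂ p∣M!  = m≤n⇒m≤1+n (prime∣!⇒≤ M pr p∣M!)

-- The progression product is divisible by the part G of M! prime to k and by the primes
-- above M among its terms, while it is at most kᴹ M! = kᴹ G h.
progression-primes : ∀ B {P : ℕ → Set} (P? : ∀ i → Dec (P i)) {k r M G h} →
  1 ≤ r → r ≤ k → M ! ≡ G * h → Coprime k G →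
  (∀ i → i < B → P i → Prime i × M < i × ∃[ t ] (t < M × i ≡ r + k * t)) →
  ∏ B (λ i → only (P? i) i) ≤ k ^ M * h
progression-primes B P? {k} {r} {M} {G} {h} r≥1 r≤k M!≡ k⊥G good = *-cancelˡ-≤ G (begin
  G * Q             ≡⟨ *-comm G Q ⟩
  Q * G             ≤⟨ ∣⇒≤ QG∣E ⟩
  E                 ≤⟨ ∏progression≤ M r≤k ⟩
  k ^ M * M !       ≡⟨ cong (k ^ M *_) M!≡ ⟩
  k ^ M * (G * h)   ≡⟨ swap (k ^ M) G h ⟩
  G * (k ^ M * h)   ∎)
  where
  open ≤-Reasoning
  Q E : ℕ
  Q = ∏ B (λ i → only (P? i) i)
  E = ∏ M (λ i → r + k * i)
  swap : ∀ a b c → a * (b * c) ≡ b * (a * c)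
  swap = solve-∀
  instance
    E≢0 : NonZero E
    E≢0 = >-nonZero (∏-≥1 M (λ i _ → ≤-trans r≥1 (m≤m+n r (k * i))))
    G≢0 : NonZero G
    G≢0 = m*n≢0⇒m≢0 G {h} {{subst NonZero M!≡ (M !≢0)}}
  G∣M! : G ∣ M !
  G∣M! = subst (G ∣_) (sym M!≡) (m∣m*n h)
  term∣ : ∀ n {t} → t < n → (f : ℕ → ℕ) → f t ∣ ∏ n f
  term∣ (suc n) {t} t<1+n f with n ≟ t
  ... | yes refl = n∣m*n (∏ n f)
  ... | no n≢t   = ∣m⇒∣m*n (f n) (term∣ n (≤∧≢⇒< (s≤s⁻¹ t<1+n) (n≢t ∘ sym)) f)
  Q∣E : Q ∣ E
  Q∣E = ∏primes∣ B P? λ i i<B p → let pr , _ , t , t<M , i≡ = good i i<B p in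
    pr , subst (_∣ E) (sym i≡) (term∣ M t<M (λ i → r + k * i))
  Q⊥G : Coprime Q G
  Q⊥G = coprime-∏ B cop
    where
    cop : ∀ i → i < B → Coprime (only (P? i) i) G
    cop i i<B with P? i
    ... | no _  = λ (d∣1 , _) → ∣1⇒≡1 d∣1
    ... | yes p = let pr , M<i , _ = good i i<B p in
      prime∤⇒coprime pr (λ i∣G → <⇒≱ M<i (prime∣!⇒≤ M pr (∣-trans i∣G G∣M!)))
  QG∣E : Q * G ∣ E
  QG∣E = ∣-coprime-* Q⊥G Q∣E (∣∏progression r M k⊥G G∣M!)

-- The sieve bound for the primes of a residue class

^-cancelˡ-≤ : ∀ z {x y} .{{_ : NonZero z}} → x ^ z ≤ y ^ z → x ≤ y
^-cancelˡ-≤ z x^≤y^ = ≮⇒≥ λ y<x → <⇒≱ (^-monoˡ-< z y<x) x^≤y^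

^-distribʳ-* : ∀ n a b → (a * b) ^ n ≡ a ^ n * b ^ n
^-distribʳ-* zero    a b = refl
^-distribʳ-* (suc n) a b = trans (cong (a * b *_) (^-distribʳ-* n a b)) (interchange a b (a ^ n) (b ^ n))
  where
  interchange : ∀ a b c d → a * b * (c * d) ≡ a * c * (b * d)
  interchange = solve-∀

^-swap : ∀ a m n → (a ^ m) ^ n ≡ (a ^ n) ^ m
^-swap a m n = trans (^-*-assoc a m n) (trans (cong (a ^_) (*-comm m n)) (sym (^-*-assoc a n m)))

-- D is abstract because powers with a literal exponent are unfolded during conversion checking.
abstract
  D : ℕ
  D = 32

  D≡32 : D ≡ 32
  D≡32 = refl

-- Logarithms to base 2 are measured in units of 1 / D: a weight w stands for the factor 2 ^ (w / D)
-- contributed by each term of the progression.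
record Sieve (k w : ℕ) : Set where
  field
    G h     : ℕ → ℕ
    factor  : ∀ M → M ! ≡ G M * h M
    coprime : ∀ M → Coprime k (G M)
    cost    : ∀ M → (k ^ M * h M) ^ D ≤ 2 ^ (w * M)

primesIn : {P : ℕ → Set} → (∀ i → Dec (P i)) → ℕ → ℕ
primesIn P? X = ∏ (suc X) (λ i → only (P? i) i)

-- No order between `m` and `n` is assumed: factors beyond `n` are 1, and missing ones can only
-- increase the right side.
∏-≤ : ∀ m n f → (∀ i → 1 ≤ f i) → (∀ i → n ≤ i → i < m → f i ≡ 1) → ∏ m f ≤ ∏ n f
∏-≤ zero    n f f≥1 f≡1 = ∏-≥1 n (λ i _ → f≥1 i)
∏-≤ (suc m) n f f≥1 f≡1 with n ≤? m
... | yes n≤m = begin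
  ∏ m f * f m   ≡⟨ cong (∏ m f *_) (f≡1 m n≤m ≤-refl) ⟩
  ∏ m f * 1     ≡⟨ *-identityʳ _ ⟩
  ∏ m f         ≤⟨ ∏-≤ m n f f≥1 (λ i n≤i i<m → f≡1 i n≤i (m<n⇒m<1+n i<m)) ⟩
  ∏ n f         ∎
  where open ≤-Reasoning
... | no n≰m = begin
  ∏ (suc m) f                                    ≡⟨ sym (*-identityʳ _) ⟩
  ∏ (suc m) f * 1                                ≤⟨ *-monoʳ-≤ (∏ (suc m) f) (∏-≥1 (n ∸ suc m) (λ i _ → f≥1 _)) ⟩
  ∏ (suc m) f * ∏ (n ∸ suc m) (λ i → f (suc m + i))  ≡⟨ sym (∏-split (suc m) (n ∸ suc m) f) ⟩
  ∏ (suc m + (n ∸ suc m)) f                      ≡⟨ cong (λ l → ∏ l f) (m+[n∸m]≡n (≰⇒> n≰m)) ⟩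
  ∏ n f                                          ∎
  where open ≤-Reasoning

only-prime≥1 : ∀ {P : ℕ → Set} (P? : ∀ i → Dec (P i)) → (∀ i → P i → Prime i) →
               ∀ i → 1 ≤ only (P? i) i
only-prime≥1 P? P⇒prime i with P? i
... | yes p = ≤-trans (s≤s z≤n) (prime≥2 (P⇒prime i p))
... | no _  = ≤-refl

-- `R` represents the residue class. Since it also bounds `i`, the subtraction is not truncated and
-- the divisibility is a true congruence.
InClass : ℕ → ℕ → (ℕ → Set) → Set
InClass k R P = ∀ i → P i → Prime i × i ≤ R × k ∣ R ∸ i

-- Residues are normalised to the range from 1 to `k` instead of from 0 to `k − 1`: the product of
-- the progression is then nonzero, and its terms are at most `k * suc t`.
class-term : ∀ {k i R} .{{_ : NonZero k}} .{{_ : NonZero i}} → i ≤ R → k ∣ R ∸ i →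
             i ≡ suc (pred R % k) + k * (pred i / k)
class-term {k} {i} {R} i≤R (divides c R∸i≡) = begin
  i                                             ≡⟨ sym (suc-pred i) ⟩
  suc (pred i)                                  ≡⟨ cong suc (m≡m%n+[m/n]*n (pred i) k) ⟩
  suc (pred i % k) + pred i / k * k             ≡⟨ cong₂ (λ a b → suc a + b) rem (*-comm (pred i / k) k) ⟩
  suc (pred R % k) + k * (pred i / k)           ∎
  where
  open ≡-Reasoning
  R≡ : pred R ≡ pred i + c * k
  R≡ = cong pred (trans (sym (m+[n∸m]≡n i≤R)) (trans (cong (i +_) R∸i≡) (cong (_+ c * k) (sym (suc-pred i)))))
  rem : pred i % k ≡ pred R % k
  rem = sym (trans (%-congˡ R≡) ([m+kn]%n≡m%n (pred i) c k))

-- Up to `X` the class has at most `M = suc (X / k)` terms. Its primes above `M` are paid for by the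
-- progression of length `M`; those up to `M` remain as the same problem with `M` for `X`.
sieve-step : ∀ {k w R} {P : ℕ → Set} (P? : ∀ i → Dec (P i)) .{{_ : NonZero k}} →
  Sieve k w → InClass k R P → ∀ X →
  primesIn P? X ^ D ≤ 2 ^ (w * suc (X / k)) * primesIn P? (suc (X / k)) ^ D
sieve-step {k} {w} {R} {P} P? S class X = begin
  primesIn P? X ^ D                                      ≡⟨ cong (_^ D) split ⟩
  (∏ (suc X) high * ∏ (suc X) low) ^ D                   ≡⟨ ^-distribʳ-* D (∏ (suc X) high) _ ⟩
  ∏ (suc X) high ^ D * ∏ (suc X) low ^ D
    ≤⟨ *-mono-≤ (≤-trans (^-monoˡ-≤ D high≤) (cost M)) (^-monoˡ-≤ D low≤) ⟩
  2 ^ (w * M) * primesIn P? M ^ D                        ∎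
  where
  open ≤-Reasoning
  open Sieve S
  M : ℕ
  M = suc (X / k)
  high low : ℕ → ℕ
  high i = only (P? i ×-dec M <? i) i
  low  i = only (P? i ×-dec i ≤? M) i
  split : primesIn P? X ≡ ∏ (suc X) high * ∏ (suc X) low
  split = trans (∏-cong (suc X) pointwise) (∏-* (suc X) high low)
    where
    pointwise : ∀ i → i < suc X → only (P? i) i ≡ high i * low i
    pointwise i _ with P? i
    ... | no ¬p = refl
    ... | yes p with M <? i | i ≤? M
    ...   | yes _   | no _    = sym (*-identityʳ i)
    ...   | no _    | yes _   = sym (+-identityʳ i)
    ...   | yes M<i | yes i≤M = contradiction i≤M (<⇒≱ M<i)
    ...   | no M≮i  | no i≰M  = contradiction (≮⇒≥ M≮i) i≰M
  low≤ : ∏ (suc X) low ≤ primesIn P? M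
  low≤ = ≤-trans
    (∏-≤ (suc X) (suc M) low (only-prime≥1 _ λ i (p , _) → proj₁ (class i p))
      λ i M<i _ → only-no {d = P? i ×-dec i ≤? M} λ (_ , i≤M) → <⇒≱ M<i i≤M)
    (∏-mono (suc M) λ i _ → pointwise i)
    where
    pointwise : ∀ i → low i ≤ only (P? i) i
    pointwise i with P? i
    ... | no _  = ≤-refl
    ... | yes p with i ≤? M
    ...   | yes _ = ≤-refl
    ...   | no _  = ≤-trans (s≤s z≤n) (prime≥2 (proj₁ (class i p)))
  high≤ : ∏ (suc X) high ≤ k ^ M * h M
  high≤ = progression-primes (suc X) (λ i → P? i ×-dec M <? i) {r = suc (pred R % k)}
    (s≤s z≤n) (m%n<n (pred R) k) (factor M) (coprime M)
    λ i i<1+X (p , M<i) → let pr , i≤R , k∣ = class i p ; instance _ = prime⇒nonZero pr in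
      pr , M<i , pred i / k ,
      s≤s (/-monoˡ-≤ k (≤-trans (pred[n]≤n {i}) (s≤s⁻¹ i<1+X))) , class-term i≤R k∣

primesIn-≤Y : ∀ {P : ℕ → Set} (P? : ∀ i → Dec (P i)) {Y} X → (∀ i → P i → Y < i) →
              X ≤ Y → primesIn P? X ≡ 1
primesIn-≤Y P? X P⇒>Y X≤Y = ∏-one (suc X) λ i i≤X →
  only-no {d = P? i} λ p → <⇒≱ (P⇒>Y i p) (≤-trans (s≤s⁻¹ i≤X) X≤Y)

sieve-bound₁ : ∀ {k w R Y} {P : ℕ → Set} (P? : ∀ i → Dec (P i)) .{{_ : NonZero k}} →
  Sieve k w → InClass k R P → (∀ i → P i → Y < i) → ∀ X → suc (X / k) ≤ Y →
  primesIn P? X ^ D ≤ 2 ^ (w * suc (X / k))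
sieve-bound₁ {k} {w} P? S class P⇒>Y X M≤Y = begin
  primesIn P? X ^ D                       ≤⟨ sieve-step P? S class X ⟩
  2 ^ (w * M) * primesIn P? M ^ D         ≡⟨ cong (2 ^ (w * M) *_) (trans (cong (_^ D) (primesIn-≤Y P? M P⇒>Y M≤Y)) (^-zeroˡ D)) ⟩
  2 ^ (w * M) * 1                          ≡⟨ *-identityʳ _ ⟩
  2 ^ (w * M)                              ∎
  where
  open ≤-Reasoning
  M : ℕ
  M = suc (X / k)

-- Three steps, after which the remaining range lies below `Y`, where the class has no primes.
sieve-bound₃ : ∀ {k w R Y} {P : ℕ → Set} (P? : ∀ i → Dec (P i)) .{{_ : NonZero k}} →
  Sieve k w → InClass k R P → (∀ i → P i → Y < i) → ∀ X →
  let M₁ = suc (X / k) ; M₂ = suc (M₁ / k) ; M₃ = suc (M₂ / k) in M₃ ≤ Y →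
  primesIn P? X ^ D ≤ 2 ^ (w * (M₁ + M₂ + M₃))
sieve-bound₃ {k} {w} P? S class P⇒>Y X M₃≤Y = begin
  primesIn P? X ^ D                                     ≤⟨ sieve-step P? S class X ⟩
  2 ^ (w * M₁) * primesIn P? M₁ ^ D
    ≤⟨ *-monoʳ-≤ (2 ^ (w * M₁)) (sieve-step P? S class M₁) ⟩
  2 ^ (w * M₁) * (2 ^ (w * M₂) * primesIn P? M₂ ^ D)
    ≤⟨ *-monoʳ-≤ (2 ^ (w * M₁)) (*-monoʳ-≤ (2 ^ (w * M₂)) (sieve-bound₁ P? S class P⇒>Y M₂ M₃≤Y)) ⟩
  2 ^ (w * M₁) * (2 ^ (w * M₂) * 2 ^ (w * M₃))
    ≡⟨ cong (2 ^ (w * M₁) *_) (sym (^-distribˡ-+-* 2 (w * M₂) (w * M₃))) ⟩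
  2 ^ (w * M₁) * 2 ^ (w * M₂ + w * M₃)
    ≡⟨ sym (^-distribˡ-+-* 2 (w * M₁) _) ⟩
  2 ^ (w * M₁ + (w * M₂ + w * M₃))                       ≡⟨ cong (2 ^_) (collect w M₁ M₂ M₃) ⟩
  2 ^ (w * (M₁ + M₂ + M₃))                               ∎
  where
  open ≤-Reasoning
  M₁ M₂ M₃ : ℕ
  M₁ = suc (X / k)
  M₂ = suc (M₁ / k)
  M₃ = suc (M₂ / k)
  collect : ∀ w a b c → w * a + (w * b + w * c) ≡ w * (a + b + c)
  collect = solve-∀

-- Each pair (l , e) is a prime l of the modulus with its exponent e = z / (l − 1), so that
-- Legendre's bound gives (l ^ legendre l M) ^ z ≤ (l ^ e) ^ M.
powers : (ℕ → ℕ) → List (ℕ × ℕ) → ℕ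
powers f []             = 1
powers f ((l , e) ∷ ls) = f l * powers f ls

weights : List (ℕ × ℕ) → ℕ
weights []             = 1
weights ((l , e) ∷ ls) = l ^ e * weights ls

∏only≤powers : ∀ B {K : ℕ → Set} (K? : ∀ i → Dec (K i)) f ls → (∀ l → 1 ≤ l → 1 ≤ f l) →
  All (λ (l , _) → 1 ≤ l) ls → (∀ p → K p → p ∈ map proj₁ ls) →
  ∏ B (λ p → only (K? p) (f p)) ≤ powers f ls
∏only≤powers B {K} K? f ls f≥1 ls≥1 K⇒∈ = ≤-trans (∏-mono B (λ p _ → pointwise p)) (columns ls ls≥1)
  where
  slots : List (ℕ × ℕ) → ℕ → ℕ
  slots []             p = 1
  slots ((l , e) ∷ ls) p = only (p ≟ l) (f p) * slots ls p
  only≥1 : ∀ p {l} → 1 ≤ l → 1 ≤ only (p ≟ l) (f p)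
  only≥1 p {l} l≥1 with p ≟ l
  ... | yes refl = f≥1 p l≥1
  ... | no _     = ≤-refl
  slots≥1 : ∀ ls p → All (λ (l , _) → 1 ≤ l) ls → 1 ≤ slots ls p
  slots≥1 []             p []            = ≤-refl
  slots≥1 ((l , e) ∷ ls) p (l≥1 ∷ ls≥1) = *-mono-≤ (only≥1 p l≥1) (slots≥1 ls p ls≥1)
  slots-∈ : ∀ ls p → All (λ (l , _) → 1 ≤ l) ls → p ∈ map proj₁ ls → f p ≤ slots ls p
  slots-∈ ((l , e) ∷ ls) p (l≥1 ∷ ls≥1) (here refl) = begin
    f p                              ≡⟨ sym (only-yes {d = p ≟ p} refl) ⟩
    only (p ≟ p) (f p)               ≡⟨ sym (*-identityʳ _) ⟩
    only (p ≟ p) (f p) * 1           ≤⟨ *-monoʳ-≤ (only (p ≟ p) (f p)) (slots≥1 ls p ls≥1) ⟩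
    only (p ≟ p) (f p) * slots ls p  ∎
    where open ≤-Reasoning
  slots-∈ ((l , e) ∷ ls) p (l≥1 ∷ ls≥1) (there p∈) = begin
    f p                              ≡⟨ sym (*-identityˡ _) ⟩
    1 * f p                          ≤⟨ *-mono-≤ (only≥1 p l≥1) (slots-∈ ls p ls≥1 p∈) ⟩
    only (p ≟ l) (f p) * slots ls p  ∎
    where open ≤-Reasoning
  pointwise : ∀ p → only (K? p) (f p) ≤ slots ls p
  pointwise p with K? p
  ... | yes κ = slots-∈ ls p ls≥1 (K⇒∈ p κ)
  ... | no _  = slots≥1 ls p ls≥1
  column : ∀ l → 1 ≤ l → ∏ B (λ p → only (p ≟ l) (f p)) ≤ f l
  column l l≥1 with l <? B
  ... | yes l<B = ≤-reflexive (∏-only-≟ B l f l<B)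
  ... | no l≮B  = ≤-trans (≤-reflexive (∏-one B λ p p<B →
    only-no {d = p ≟ l} λ { refl → l≮B p<B })) (f≥1 l l≥1)
  columns : ∀ ls → All (λ (l , _) → 1 ≤ l) ls → ∏ B (slots ls) ≤ powers f ls
  columns []             []            = ≤-reflexive (∏-one B λ _ _ → refl)
  columns ((l , e) ∷ ls) (l≥1 ∷ ls≥1) =
    ≤-trans (≤-reflexive (∏-* B (λ p → only (p ≟ l) (f p)) (slots ls)))
            (*-mono-≤ (column l l≥1) (columns ls ls≥1))

-- `M !` is split by whether its primes divide `k`. After raising to the power `z`, Legendre's bound
-- makes the cost an `M`-th power, so a single numerical inequality, `small`, settles all `M`.
mkSieve : ∀ k w z (ls : List (ℕ × ℕ)) .{{_ : NonZero z}} →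
  All (λ (l , e) → 1 ≤ l × z ≡ pred l * e) ls → (∀ p → Prime p → p ∣ k → p ∈ map proj₁ ls) →
  (k ^ z * weights ls) ^ D ≤ 2 ^ (w * z) → Sieve k w
mkSieve k w z ls ls-ok k-primes small = record
  { G = G ; h = h ; factor = factor ; coprime = coprime ; cost = cost }
  where
  in? : ∀ p → Dec (Prime p × p ∣ k)
  in? p = prime? p ×-dec p ∣? k
  out? : ∀ p → Dec (Prime p × ¬ p ∣ k)
  out? p = prime? p ×-dec ¬? (p ∣? k)
  G h : ℕ → ℕ
  G M = ∏ (suc M) (λ p → only (out? p) (p ^ legendre M p M))
  h M = ∏ (suc M) (λ p → only (in? p) (p ^ legendre M p M))
  factor : ∀ M → M ! ≡ G M * h M
  factor M = trans (!≡∏legendre M ≤-refl ≤-refl) (trans (∏-cong (suc M) pointwise) (∏-* (suc M) _ _))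
    where
    pointwise : ∀ p → p < suc M → only (prime? p) (p ^ legendre M p M) ≡
      only (out? p) (p ^ legendre M p M) * only (in? p) (p ^ legendre M p M)
    pointwise p _ with prime? p
    ... | no _  = refl
    ... | yes _ with p ∣? k
    ...   | yes _ = sym (*-identityˡ _)
    ...   | no _  = sym (*-identityʳ _)
  coprime : ∀ M → Coprime k (G M)
  coprime M = coprime-sym (coprime-∏ (suc M) pointwise)
    where
    pointwise : ∀ p → p < suc M → Coprime (only (out? p) (p ^ legendre M p M)) k
    pointwise p _ with out? p
    ... | yes (pr , p∤k) = coprime-^ (legendre M p M) (prime∤⇒coprime pr p∤k)
    ... | no _           = λ (d∣1 , _) → ∣1⇒≡1 d∣1
  h≤ : ∀ M → h M ≤ powers (λ l → l ^ legendre M l M) ls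
  h≤ M = ∏only≤powers (suc M) in? (λ l → l ^ legendre M l M) ls
    (λ l l≥1 → m^n>0 l {{>-nonZero l≥1}} (legendre M l M))
    (All.map proj₁ ls-ok) (λ p (pr , p∣k) → k-primes p pr p∣k)
  powers^z≤ : ∀ M ls → All (λ (l , e) → 1 ≤ l × z ≡ pred l * e) ls →
    powers (λ l → l ^ legendre M l M) ls ^ z ≤ weights ls ^ M
  powers^z≤ M []             []                     = ≤-reflexive (trans (^-zeroˡ z) (sym (^-zeroˡ M)))
  powers^z≤ M ((l@(suc l-1) , e) ∷ ls) ((_ , z≡) ∷ ls-ok) = begin
    (l ^ L * powers _ ls) ^ z           ≡⟨ ^-distribʳ-* z (l ^ L) _ ⟩
    (l ^ L) ^ z * powers _ ls ^ z       ≤⟨ *-mono-≤ step (powers^z≤ M ls ls-ok) ⟩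
    (l ^ e) ^ M * weights ls ^ M        ≡⟨ sym (^-distribʳ-* M (l ^ e) _) ⟩
    (l ^ e * weights ls) ^ M            ∎
    where
    open ≤-Reasoning
    L : ℕ
    L = legendre M l M
    step : (l ^ L) ^ z ≤ (l ^ e) ^ M
    step = begin
      (l ^ L) ^ z           ≡⟨ ^-*-assoc l L z ⟩
      l ^ (L * z)           ≡⟨ cong (λ z → l ^ (L * z)) z≡ ⟩
      l ^ (L * (l-1 * e))   ≡⟨ cong (l ^_) (sym (*-assoc L l-1 e)) ⟩
      l ^ (L * l-1 * e)     ≤⟨ ^-monoʳ-≤ l (*-monoˡ-≤ e (legendre-bound M l-1 M)) ⟩
      l ^ (M * e)           ≡⟨ cong (l ^_) (*-comm M e) ⟩
      l ^ (e * M)           ≡⟨ sym (^-*-assoc l e M) ⟩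
      (l ^ e) ^ M           ∎
  cost : ∀ M → (k ^ M * h M) ^ D ≤ 2 ^ (w * M)
  cost M = ^-cancelˡ-≤ z (begin
    ((k ^ M * h M) ^ D) ^ z                ≡⟨ ^-swap (k ^ M * h M) D z ⟩
    ((k ^ M * h M) ^ z) ^ D                ≡⟨ cong (_^ D) (^-distribʳ-* z (k ^ M) (h M)) ⟩
    ((k ^ M) ^ z * h M ^ z) ^ D
      ≤⟨ ^-monoˡ-≤ D (*-monoʳ-≤ ((k ^ M) ^ z) (≤-trans (^-monoˡ-≤ z (h≤ M)) (powers^z≤ M ls ls-ok))) ⟩
    ((k ^ M) ^ z * weights ls ^ M) ^ D     ≡⟨ cong (λ x → (x * weights ls ^ M) ^ D) (^-swap k M z) ⟩
    ((k ^ z) ^ M * weights ls ^ M) ^ D     ≡⟨ cong (_^ D) (sym (^-distribʳ-* M (k ^ z) (weights ls))) ⟩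
    ((k ^ z * weights ls) ^ M) ^ D         ≡⟨ ^-swap (k ^ z * weights ls) M D ⟩
    ((k ^ z * weights ls) ^ D) ^ M         ≤⟨ ^-monoˡ-≤ M small ⟩
    (2 ^ (w * z)) ^ M                       ≡⟨ cong (_^ M) (sym (^-*-assoc 2 w z)) ⟩
    ((2 ^ w) ^ z) ^ M                       ≡⟨ ^-swap (2 ^ w) z M ⟩
    ((2 ^ w) ^ M) ^ z                       ≡⟨ cong (_^ z) (^-*-assoc 2 w M) ⟩
    (2 ^ (w * M)) ^ z                       ∎)
    where open ≤-Reasoning

-- Chebyshev's lower bound

floor-table : ∀ {t} → t < 30 → t + t / 30 ≤ t / 2 + t / 3 + t / 5 + 1
floor-table = toWitness {a? = allUpTo? (λ t → t + t / 30 ≤? t / 2 + t / 3 + t / 5 + 1) 30} tt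

-- Increasing `u` by 30 adds 31 to both sides, as 30 + 1 = 15 + 10 + 6. Only the residues modulo 30
-- need checking.
floor-inequality : ∀ u → u + u / 30 ≤ u / 2 + u / 3 + u / 5 + 1
floor-inequality u = subst (λ u → u + u / 30 ≤ u / 2 + u / 3 + u / 5 + 1) (sym (m≡m%n+[m/n]*n u 30)) (begin
  (t + w * 30) + (t + w * 30) / 30      ≡⟨ cong (t + w * 30 +_) (shift 1 30 refl) ⟩
  (t + w * 30) + (t / 30 + w * 1)       ≡⟨ regroup₁ t w (t / 30) ⟩
  (t + t / 30) + w * 31                 ≤⟨ +-monoˡ-≤ (w * 31) (floor-table (m%n<n u 30)) ⟩
  t / 2 + t / 3 + t / 5 + 1 + w * 31    ≡⟨ regroup₂ (t / 2) (t / 3) (t / 5) w ⟩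
  (t / 2 + w * 15) + (t / 3 + w * 10) + (t / 5 + w * 6) + 1
    ≡⟨ cong (_+ 1) (sym (cong₂ _+_ (cong₂ _+_ (shift 15 2 refl) (shift 10 3 refl)) (shift 6 5 refl))) ⟩
  (t + w * 30) / 2 + (t + w * 30) / 3 + (t + w * 30) / 5 + 1 ∎)
  where
  open ≤-Reasoning
  t w : ℕ
  t = u % 30
  w = u / 30
  shift : ∀ c d .{{_ : NonZero d}} → c * d ≡ 30 → (t + w * 30) / d ≡ t / d + w * c
  shift c d cd≡30 = trans (+-distrib-/-∣ʳ t (divides (w * c) wcd))
    (cong (t / d +_) (trans (/-congˡ wcd) (m*n/n≡m (w * c) d)))
    where
    wcd : w * 30 ≡ w * c * d
    wcd = trans (cong (w *_) (sym cd≡30)) (sym (*-assoc w c d))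
  regroup₁ : ∀ t w x → (t + w * 30) + (x + w * 1) ≡ (t + x) + w * 31
  regroup₁ = solve-∀
  regroup₂ : ∀ a b c w → a + b + c + 1 + w * 31 ≡ (a + w * 15) + (b + w * 10) + (c + w * 6) + 1
  regroup₂ = solve-∀

-- All counts are quotients of `u = 30 * m / d`. For `d` beyond `30 * m` the left side is 0, so the
-- error 1 is charged only to the prime powers up to `30 * m`.
multiples-inequality : ∀ d m .{{_ : NonZero d}} →
  multiples d (30 * m) + multiples d m ≤
  multiples d (15 * m) + multiples d (10 * m) + multiples d (6 * m) + χ (d ≤? 30 * m)
multiples-inequality d m with d ≤? 30 * m
... | no d≰ = subst (_≤ rhs) (sym zero-lhs) z≤n
  where
  rhs : ℕ
  rhs = multiples d (15 * m) + multiples d (10 * m) + multiples d (6 * m) + 0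
  zero-lhs : multiples d (30 * m) + multiples d m ≡ 0
  zero-lhs = cong₂ _+_ (trans (multiples≡/ d (30 * m)) (m<n⇒m/n≡0 (≰⇒> d≰)))
    (trans (multiples≡/ d m) (m<n⇒m/n≡0 (≤-<-trans (m≤n*m m 30) (≰⇒> d≰))))
... | yes _ = begin
  multiples d (30 * m) + multiples d m   ≡⟨ cong₂ _+_ (multiples≡/ d (30 * m)) (trans (cong (multiples d) (sym (*-identityˡ m))) (floor≡ 1 30 refl)) ⟩
  u + u / 30                             ≤⟨ floor-inequality u ⟩
  u / 2 + u / 3 + u / 5 + 1
    ≡⟨ cong (_+ 1) (sym (cong₂ _+_ (cong₂ _+_ (floor≡ 15 2 refl) (floor≡ 10 3 refl)) (floor≡ 6 5 refl))) ⟩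
  multiples d (15 * m) + multiples d (10 * m) + multiples d (6 * m) + 1 ∎
  where
  open ≤-Reasoning
  u : ℕ
  u = 30 * m / d
  floor≡ : ∀ c e .{{_ : NonZero e}} → c * e ≡ 30 → multiples d (c * m) ≡ u / e
  floor≡ c e ce≡30 = let instance _ = m*n≢0 d e in sym (begin-equality
    30 * m / d / e             ≡⟨ m/n/o≡m/[n*o] (30 * m) d e ⟩
    30 * m / (d * e)           ≡⟨ /-congˡ {o = d * e} (trans (cong (_* m) (sym ce≡30)) (swap c e m)) ⟩
    (c * m) * e / (d * e)      ≡⟨ m*n/o*n≡m/o (c * m) e d ⟩
    c * m / d                  ≡⟨ sym (multiples≡/ d (c * m)) ⟩
    multiples d (c * m)        ∎)
    where
    swap : ∀ c e m → c * e * m ≡ c * m * e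
    swap = solve-∀

-- For a prime `p` and large `J` this is the integer part of the logarithm of `x` to base `p`.
exponent : ℕ → ℕ → ℕ → ℕ
exponent J p x = ∑ J (λ j → χ (p ^ suc j ≤? x))

legendre-inequality : ∀ J p m .{{_ : NonZero p}} →
  legendre J p (30 * m) + legendre J p m ≤
  legendre J p (15 * m) + legendre J p (10 * m) + legendre J p (6 * m) + exponent J p (30 * m)
legendre-inequality J p m = begin
  legendre J p (30 * m) + legendre J p m  ≡⟨ sym (∑-+ J (f (30 * m)) (f m)) ⟩
  ∑ J (λ j → f (30 * m) j + f m j)
    ≤⟨ ∑-mono J (λ j _ → multiples-inequality (p ^ suc j) m {{m^n≢0 p (suc j)}}) ⟩
  ∑ J (λ j → f (15 * m) j + f (10 * m) j + f (6 * m) j + χ (p ^ suc j ≤? 30 * m))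
    ≡⟨ ∑-+ J (λ j → f (15 * m) j + f (10 * m) j + f (6 * m) j) _ ⟩
  ∑ J (λ j → f (15 * m) j + f (10 * m) j + f (6 * m) j) + exponent J p (30 * m)
    ≡⟨ cong (_+ exponent J p (30 * m)) (trans (∑-+ J (λ j → f (15 * m) j + f (10 * m) j) (f (6 * m)))
         (cong (_+ legendre J p (6 * m)) (∑-+ J (f (15 * m)) (f (10 * m))))) ⟩
  legendre J p (15 * m) + legendre J p (10 * m) + legendre J p (6 * m) + exponent J p (30 * m) ∎
  where
  open ≤-Reasoning
  f : ℕ → ℕ → ℕ
  f n j = multiples (p ^ suc j) n

-- The last product is the least common multiple of the numbers up to `x`, the exponential of
-- Chebyshev's ψ.
factorial-inequality : ∀ m → let x = 30 * m in
  x ! * m ! ≤ (15 * m) ! * (10 * m) ! * (6 * m) ! * ∏ (suc x) (λ p → only (prime? p) (p ^ exponent x p x))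
factorial-inequality m = begin
  x ! * m !                       ≡⟨ cong₂ _*_ (legendre! x ≤-refl) (legendre! m (m≤n*m m 30)) ⟩
  ∏ (suc x) (F x) * ∏ (suc x) (F m)  ≡⟨ sym (∏-* (suc x) (F x) (F m)) ⟩
  ∏ (suc x) (λ p → F x p * F m p)    ≤⟨ ∏-mono (suc x) (λ p _ → pointwise p) ⟩
  ∏ (suc x) (λ p → F (15 * m) p * F (10 * m) p * F (6 * m) p * E p)
    ≡⟨ trans (∏-* (suc x) (λ p → F (15 * m) p * F (10 * m) p * F (6 * m) p) E)
       (cong (_* ∏ (suc x) E) (trans (∏-* (suc x) (λ p → F (15 * m) p * F (10 * m) p) (F (6 * m)))
       (cong (_* ∏ (suc x) (F (6 * m))) (∏-* (suc x) (F (15 * m)) (F (10 * m)))))) ⟩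
  ∏ (suc x) (F (15 * m)) * ∏ (suc x) (F (10 * m)) * ∏ (suc x) (F (6 * m)) * ∏ (suc x) E
    ≡⟨ cong (_* ∏ (suc x) E) (sym (cong₂ _*_ (cong₂ _*_ (legendre! (15 * m) (*-monoˡ-≤ m (lit 15)))
       (legendre! (10 * m) (*-monoˡ-≤ m (lit 10)))) (legendre! (6 * m) (*-monoˡ-≤ m (lit 6))))) ⟩
  (15 * m) ! * (10 * m) ! * (6 * m) ! * ∏ (suc x) E ∎
  where
  open ≤-Reasoning
  x : ℕ
  x = 30 * m
  lit : ∀ c {_ : T (c ≤ᵇ 30)} → c ≤ 30
  lit c {c≤30} = ≤ᵇ⇒≤ c 30 c≤30
  F : ℕ → ℕ → ℕ
  F n p = only (prime? p) (p ^ legendre x p n)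
  E : ℕ → ℕ
  E p = only (prime? p) (p ^ exponent x p x)
  legendre! : ∀ n → n ≤ x → n ! ≡ ∏ (suc x) (F n)
  legendre! n n≤x = !≡∏legendre n (s≤s n≤x) n≤x
  pointwise : ∀ p → F x p * F m p ≤ F (15 * m) p * F (10 * m) p * F (6 * m) p * E p
  pointwise p with prime? p
  ... | no _   = ≤-refl
  ... | yes pr = begin
    p ^ L x * p ^ L m                ≡⟨ sym (^-distribˡ-+-* p (L x) (L m)) ⟩
    p ^ (L x + L m)                  ≤⟨ ^-monoʳ-≤ p (legendre-inequality x p m) ⟩
    p ^ (L (15 * m) + L (10 * m) + L (6 * m) + exponent x p x)
      ≡⟨ trans (^-distribˡ-+-* p (L (15 * m) + L (10 * m) + L (6 * m)) _)
         (cong (_* p ^ exponent x p x) (trans (^-distribˡ-+-* p (L (15 * m) + L (10 * m)) _)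
         (cong (_* p ^ L (6 * m)) (^-distribˡ-+-* p (L (15 * m)) _)))) ⟩
    p ^ L (15 * m) * p ^ L (10 * m) * p ^ L (6 * m) * p ^ exponent x p x ∎
    where
    instance
      p≢0 : NonZero p
      p≢0 = prime⇒nonZero pr
    L : ℕ → ℕ
    L n = legendre x p n

χ≤1 : ∀ {P : Set} (d : Dec P) → χ d ≤ 1
χ≤1 (yes _) = ≤-refl
χ≤1 (no _)  = z≤n

^exponent≤ : ∀ J p x → 1 ≤ p → 1 ≤ x → p ^ exponent J p x ≤ x
^exponent≤ zero    p x p≥1 x≥1 = x≥1
^exponent≤ (suc J) p x p≥1 x≥1 with p ^ suc J ≤? x
... | yes p^≤x = ≤-trans (^-monoʳ-≤ p {{>-nonZero p≥1}} (begin
  exponent J p x + 1    ≤⟨ +-monoˡ-≤ 1 (∑-mono J (λ j _ → χ≤1 (p ^ suc j ≤? x))) ⟩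
  ∑ J (λ _ → 1) + 1     ≡⟨ cong (_+ 1) (trans (∑-const J 1) (*-identityʳ J)) ⟩
  J + 1                 ≡⟨ +-comm J 1 ⟩
  suc J                 ∎)) p^≤x
  where open ≤-Reasoning
... | no _ = subst (λ e → p ^ e ≤ x) (sym (+-identityʳ (exponent J p x))) (^exponent≤ J p x p≥1 x≥1)

exponent≤1 : ∀ J p x → 1 ≤ p → x < p * p → exponent J p x ≤ 1
exponent≤1 zero    p x p≥1 x<p² = z≤n
exponent≤1 (suc J) p x p≥1 x<p² = begin
  exponent (suc J) p x                                           ≡⟨ ∑-head J _ ⟩
  χ (p ^ 1 ≤? x) + ∑ J (λ j → χ (p ^ suc (suc j) ≤? x))
    ≡⟨ cong (χ (p ^ 1 ≤? x) +_) (∑-zero J λ j _ → χ-no {d = p ^ suc (suc j) ≤? x} (<⇒≱ (x<p^ j))) ⟩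
  χ (p ^ 1 ≤? x) + 0                                             ≡⟨ +-identityʳ _ ⟩
  χ (p ^ 1 ≤? x)                                                 ≤⟨ χ≤1 (p ^ 1 ≤? x) ⟩
  1                                                              ∎
  where
  open ≤-Reasoning
  x<p^ : ∀ j → x < p ^ suc (suc j)
  x<p^ j = <-≤-trans x<p² (*-monoʳ-≤ p (m≤m*n p (p ^ j) {{m^n≢0 p j {{>-nonZero p≥1}}}}))

-- The passage from Chebyshev's ψ to θ: each prime up to `s` costs at most an extra factor `x`, and
-- a prime above `s` has its square above `x`, hence exponent at most 1.
primePowers≤ : ∀ J x s → 1 ≤ x → x < suc s * suc s →
  ∏ (suc x) (λ p → only (prime? p) (p ^ exponent J p x)) ≤ x ^ suc s * primesIn prime? x
primePowers≤ J x s x≥1 x<s² = begin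
  ∏ (suc x) (λ p → only (prime? p) (p ^ exponent J p x))      ≤⟨ ∏-mono (suc x) (λ p _ → pointwise p) ⟩
  ∏ (suc x) (λ p → only (p ≤? s) x * only (prime? p) p)       ≡⟨ ∏-* (suc x) (λ p → only (p ≤? s) x) _ ⟩
  ∏ (suc x) (λ p → only (p ≤? s) x) * primesIn prime? x       ≤⟨ *-monoˡ-≤ (primesIn prime? x) small ⟩
  x ^ suc s * primesIn prime? x                               ∎
  where
  open ≤-Reasoning
  small : ∏ (suc x) (λ p → only (p ≤? s) x) ≤ x ^ suc s
  small = begin
    ∏ (suc x) (λ p → only (p ≤? s) x)
      ≤⟨ ∏-≤ (suc x) (suc s) _ (λ p → only-≥1 (p ≤? s) x≥1) (λ p s<p _ → only-no {d = p ≤? s} (<⇒≱ s<p)) ⟩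
    ∏ (suc s) (λ p → only (p ≤? s) x)
      ≡⟨ ∏-cong (suc s) (λ p p≤s → only-yes {d = p ≤? s} (s≤s⁻¹ p≤s)) ⟩
    ∏ (suc s) (λ _ → x)                      ≡⟨ ∏-const (suc s) x ⟩
    x ^ suc s                                ∎
  pointwise : ∀ p → only (prime? p) (p ^ exponent J p x) ≤ only (p ≤? s) x * only (prime? p) p
  pointwise p with prime? p
  ... | no _   = subst (1 ≤_) (sym (*-identityʳ _)) (only-≥1 (p ≤? s) x≥1)
  ... | yes pr with p ≤? s
  ...   | yes _  = ≤-trans (^exponent≤ J p x p≥1 x≥1) (m≤m*n x p {{prime⇒nonZero pr}})
    where
    p≥1 : 1 ≤ p
    p≥1 = ≤-trans (s≤s z≤n) (prime≥2 pr)
  ...   | no p≰s = begin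
    p ^ exponent J p x  ≤⟨ ^-monoʳ-≤ p {{prime⇒nonZero pr}} (exponent≤1 J p x (≤-trans (s≤s z≤n) (prime≥2 pr))
                             (<-≤-trans x<s² (*-mono-≤ (≰⇒> p≰s) (≰⇒> p≰s)))) ⟩
    p ^ 1               ≡⟨ *-identityʳ p ⟩
    p                   ≡⟨ sym (*-identityˡ p) ⟩
    1 * p               ∎

-- Polynomials as coefficient lists, constant term first

eval : List ℕ → ℕ → ℕ
eval []      x = 0
eval (a ∷ p) x = a + x * eval p x

-- Multiplication by `a + b x`, where `c` is the contribution carried over from the preceding
-- coefficient.
mulLinear : ℕ → ℕ → ℕ → List ℕ → List ℕ
mulLinear a b c []      = c ∷ []
mulLinear a b c (d ∷ p) = (c + a * d) ∷ mulLinear a b (b * d) p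

eval-mulLinear : ∀ a b c p x → eval (mulLinear a b c p) x ≡ c + (a + b * x) * eval p x
eval-mulLinear a b c []      x = cong (c +_) (trans (*-zeroʳ x) (sym (*-zeroʳ (a + b * x))))
eval-mulLinear a b c (d ∷ p) x =
  trans (cong (λ e → c + a * d + x * e) (eval-mulLinear a b (b * d) p x)) (expand a b c d x (eval p x))
  where
  expand : ∀ a b c d x e → c + a * d + x * (b * d + (a + b * x) * e) ≡ c + (a + b * x) * (d + x * e)
  expand = solve-∀

linearProduct : List (ℕ × ℕ) → ℕ → ℕ
linearProduct []             x = 1
linearProduct ((a , b) ∷ fs) x = (a + b * x) * linearProduct fs x

expand : List (ℕ × ℕ) → List ℕ
expand []             = 1 ∷ []
expand ((a , b) ∷ fs) = mulLinear a b 0 (expand fs)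

eval-expand : ∀ fs x → eval (expand fs) x ≡ linearProduct fs x
eval-expand []             x = cong suc (*-zeroʳ x)
eval-expand ((a , b) ∷ fs) x =
  trans (eval-mulLinear a b 0 (expand fs) x) (cong ((a + b * x) *_) (eval-expand fs x))

-- Coefficientwise comparison, a finite certificate for an inequality between polynomials at all
-- natural arguments.
dominated : List ℕ → List ℕ → Bool
dominated []      q       = true
dominated (_ ∷ _) []      = false
dominated (a ∷ p) (b ∷ q) = (a ≤ᵇ b) ∧ dominated p q

dominated⇒≤ : ∀ p q x → T (dominated p q) → eval p x ≤ eval q x
dominated⇒≤ []      q       x _ = z≤n
dominated⇒≤ (a ∷ p) (b ∷ q) x t with Equivalence.to T-∧ t
... | a≤b , p≤q = +-mono-≤ (≤ᵇ⇒≤ a b a≤b) (*-monoʳ-≤ x (dominated⇒≤ p q x p≤q))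

shiftedFactors : ℕ → ℕ → ℕ → List (ℕ × ℕ) → List (ℕ × ℕ)
shiftedFactors a b zero    fs = fs
shiftedFactors a b (suc n) fs = (a + n , b) ∷ shiftedFactors a b n fs

linearProduct-shifted : ∀ a b n fs x →
  linearProduct (shiftedFactors a b n fs) x ≡ rising (a + b * x) n * linearProduct fs x
linearProduct-shifted a b zero    fs x = sym (*-identityˡ _)
linearProduct-shifted a b (suc n) fs x =
  trans (cong ((a + n + b * x) *_) (linearProduct-shifted a b n fs x))
        (move a n (b * x) (rising (a + b * x) n) (linearProduct fs x))
  where
  move : ∀ a n y r l → (a + n + y) * (r * l) ≡ r * (a + y + n) * l
  move = solve-∀

!-+ : ∀ c x → (c + x) ! ≡ rising (suc x) c * x !
!-+ zero    x = sym (*-identityˡ _)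
!-+ (suc c) x = trans (cong (suc (c + x) *_) (!-+ c x)) (move c x (rising (suc x) c) (x !))
  where
  move : ∀ c x r f → suc (c + x) * (r * f) ≡ r * (suc x + c) * f
  move = solve-∀

scale : ℕ → List ℕ → List ℕ
scale c = map (c *_)

eval-scale : ∀ c p x → eval (scale c p) x ≡ c * eval p x
eval-scale c []      x = sym (*-zeroʳ c)
eval-scale c (a ∷ p) x = trans (cong (λ e → c * a + x * e) (eval-scale c p x)) (regroup c a x (eval p x))
  where
  regroup : ∀ c a x e → c * a + x * (c * e) ≡ c * (a + x * e)
  regroup = solve-∀

opaque
  block : ℕ → ℕ → ℕ
  block c m = rising (suc (c * m)) c

  block-suc : ∀ c n → rising (suc c + c * n) c ≡ block c (suc n)
  block-suc c n = cong (λ t → rising (suc t) c) (sym (*-suc c n))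

  !-block : ∀ c m → (c * suc m) ! ≡ block c m * (c * m) !
  !-block c m = trans (cong _! (*-suc c m)) (!-+ c (c * m))

-- The offsets `suc c` occur because `block c (suc n)` starts with `c * suc n + 1`, which is
-- `suc c + c * n` as a polynomial in `n`.
lowerFactors : ℕ → ℕ → ℕ → ℕ → List (ℕ × ℕ)
lowerFactors e c₁ c₂ c₃ = (e , 1) ∷
  shiftedFactors (suc c₁) c₁ c₁ (shiftedFactors (suc c₂) c₂ c₂ (shiftedFactors (suc c₃) c₃ c₃ []))

upperFactors : ℕ → ℕ → ℕ → List (ℕ × ℕ)
upperFactors e e′ c = (e , 1) ∷ (e′ , 1) ∷ shiftedFactors (suc c) c c []

lowerFactors≡ : ∀ e c₁ c₂ c₃ n → linearProduct (lowerFactors e c₁ c₂ c₃) n ≡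
  (e + n) * (block c₁ (suc n) * (block c₂ (suc n) * block c₃ (suc n)))
lowerFactors≡ e c₁ c₂ c₃ n = cong₂ _*_ (cong (e +_) (*-identityˡ n))
  (trans (linearProduct-shifted (suc c₁) c₁ c₁ _ n) (cong₂ _*_ (block-suc c₁ n)
  (trans (linearProduct-shifted (suc c₂) c₂ c₂ _ n) (cong₂ _*_ (block-suc c₂ n)
  (trans (linearProduct-shifted (suc c₃) c₃ c₃ [] n) (trans (*-identityʳ _) (block-suc c₃ n)))))))

upperFactors≡ : ∀ e e′ c n → linearProduct (upperFactors e e′ c) n ≡ (e + n) * ((e′ + n) * block c (suc n))
upperFactors≡ e e′ c n = cong₂ _*_ (cong (e +_) (*-identityˡ n)) (cong₂ _*_ (cong (e′ +_) (*-identityˡ n))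
  (trans (linearProduct-shifted (suc c) c c [] n) (trans (*-identityʳ _) (block-suc c n))))

block-inequality : ∀ b c e c₁ c₂ c₃ e₁ e₂ c₀ n →
  T (dominated (scale b (expand (lowerFactors e c₁ c₂ c₃))) (scale c (expand (upperFactors e₁ e₂ c₀)))) →
  b * ((e + n) * (block c₁ (suc n) * (block c₂ (suc n) * block c₃ (suc n)))) ≤
  c * ((e₁ + n) * ((e₂ + n) * block c₀ (suc n)))
block-inequality b c e c₁ c₂ c₃ e₁ e₂ c₀ n t = begin
  b * ((e + n) * (block c₁ (suc n) * (block c₂ (suc n) * block c₃ (suc n))))
    ≡⟨ cong (b *_) (sym (trans (eval-expand fs n) (lowerFactors≡ e c₁ c₂ c₃ n))) ⟩
  b * eval (expand fs) n         ≡⟨ sym (eval-scale b (expand fs) n) ⟩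
  eval (scale b (expand fs)) n   ≤⟨ dominated⇒≤ (scale b (expand fs)) (scale c (expand gs)) n t ⟩
  eval (scale c (expand gs)) n   ≡⟨ eval-scale c (expand gs) n ⟩
  c * eval (expand gs) n         ≡⟨ cong (c *_) (trans (eval-expand gs n) (upperFactors≡ e₁ e₂ c₀ n)) ⟩
  c * ((e₁ + n) * ((e₂ + n) * block c₀ (suc n))) ∎
  where
  open ≤-Reasoning
  fs gs : List (ℕ × ℕ)
  fs = lowerFactors e c₁ c₂ c₃
  gs = upperFactors e₁ e₂ c₀

opaque
  -- By Stirling's formula, `β / γ` is the exponential growth rate of Chebyshev's quotient.
  β γ : ℕ
  β = 30 ^ 30
  γ = 15 ^ 15 * (10 ^ 10 * 6 ^ 6)

  -- As polynomials in `n` both sides have degree 32 and leading coefficient `β * γ`, so that the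
  -- lower coefficients decide.
  growth-factors : ∀ n →
    β * ((2 + n) * (block 15 (suc n) * (block 10 (suc n) * block 6 (suc n)))) ≤
    γ * ((3 + n) * ((2 + n) * block 30 (suc n)))
  growth-factors n = block-inequality β γ 2 15 10 6 3 2 30 n tt

  γ≢0 : NonZero γ
  γ≢0 = _

  growth-start : β ^ 1 * ((15 * 1) ! * (10 * 1) ! * (6 * 1) !) ≤ 7 * 2 * γ ^ 1 * ((30 * 1) ! * 1 !)
  growth-start = ≤ᵇ⇒≤ (β ^ 1 * ((15 * 1) ! * (10 * 1) ! * (6 * 1) !)) (7 * 2 * γ ^ 1 * ((30 * 1) ! * 1 !)) tt

  -- 32 log₂ (β / γ) = 1275.97…
  β/γ : 2 ^ 1275 * γ ^ D ≤ β ^ D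
  β/γ = subst (λ d → 2 ^ 1275 * γ ^ d ≤ β ^ d) (sym D≡32) (≤ᵇ⇒≤ (2 ^ 1275 * γ ^ 32) (β ^ 32) tt)

-- Stirling's formula gives `(β / γ) ^ m` up to a constant over √m. The cruder loss `suc m` keeps
-- the induction step polynomial, and 7 is the least integer that admits `m = 1`.
Growth : ℕ → Set
Growth m = β ^ m * ((15 * m) ! * (10 * m) ! * (6 * m) !) ≤ 7 * suc m * γ ^ m * ((30 * m) ! * m !)

growth-step : ∀ m → β * (suc m * (block 15 m * (block 10 m * block 6 m))) ≤
  γ * (suc (suc m) * (suc m * block 30 m)) → Growth m → Growth (suc m)
growth-step m factors growth = *-cancelˡ-≤ (suc m) (begin
  suc m * (β ^ suc m * ((15 * suc m) ! * (10 * suc m) ! * (6 * suc m) !))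
    ≡⟨ cong (λ y → suc m * (β ^ suc m * y)) (cong₂ _*_ (cong₂ _*_ (!-block 15 m) (!-block 10 m)) (!-block 6 m)) ⟩
  suc m * (β * β ^ m * ((block 15 m * (15 * m) !) * (block 10 m * (10 * m) !) * (block 6 m * (6 * m) !)))
    ≡⟨ regroup₁ (suc m) β (β ^ m) (block 15 m) ((15 * m) !) (block 10 m) ((10 * m) !) (block 6 m) ((6 * m) !) ⟩
  (β ^ m * ((15 * m) ! * (10 * m) ! * (6 * m) !)) * (β * (suc m * (block 15 m * (block 10 m * block 6 m))))
    ≤⟨ *-mono-≤ growth factors ⟩
  (7 * suc m * γ ^ m * ((30 * m) ! * m !)) * (γ * (suc (suc m) * (suc m * block 30 m)))
    ≡⟨ regroup₂ (suc m) (γ ^ m) ((30 * m) !) (m !) (suc (suc m)) γ (block 30 m) ⟩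
  suc m * (7 * suc (suc m) * (γ * γ ^ m) * (block 30 m * (30 * m) ! * (suc m * m !)))
    ≡⟨ cong (λ y → suc m * (7 * suc (suc m) * (γ * γ ^ m) * (y * (suc m * m !)))) (sym (!-block 30 m)) ⟩
  suc m * (7 * suc (suc m) * γ ^ suc m * ((30 * suc m) ! * (suc m) !)) ∎)
  where
  open ≤-Reasoning
  regroup₁ : ∀ s b bm r a r′ a′ r″ a″ →
    s * (b * bm * ((r * a) * (r′ * a′) * (r″ * a″))) ≡ (bm * (a * a′ * a″)) * (b * (s * (r * (r′ * r″))))
  regroup₁ = solve-∀
  regroup₂ : ∀ s gm x f t g r →
    (7 * s * gm * (x * f)) * (g * (t * (s * r))) ≡ s * (7 * t * (g * gm) * (r * x * (s * f)))
  regroup₂ = solve-∀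

growth : ∀ n → Growth (suc n)
growth zero    = growth-start
growth (suc n) = growth-step (suc n) (growth-factors n) (growth n)

chebyshev : ∀ m s → 1 ≤ m → let x = 30 * m in x < suc s * suc s →
  2 ^ (1275 * m) ≤ (7 * suc m * (x ^ suc s * primesIn prime? x)) ^ D
chebyshev m s m≥1 x<s² = *-cancelʳ-≤ _ _ (γ ^ (m * D)) {{γ^≢0}} (begin
  2 ^ (1275 * m) * γ ^ (m * D)          ≡⟨ cong₂ _*_ (sym (^-*-assoc 2 1275 m))
                                            (trans (cong (γ ^_) (*-comm m D)) (sym (^-*-assoc γ D m))) ⟩
  (2 ^ 1275) ^ m * (γ ^ D) ^ m          ≡⟨ sym (^-distribʳ-* m (2 ^ 1275) (γ ^ D)) ⟩
  (2 ^ 1275 * γ ^ D) ^ m                ≤⟨ ^-monoˡ-≤ m β/γ ⟩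
  (β ^ D) ^ m                           ≡⟨ ^-swap β D m ⟩
  (β ^ m) ^ D                           ≤⟨ ^-monoˡ-≤ D bound ⟩
  (A * γ ^ m) ^ D                       ≡⟨ ^-distribʳ-* D A (γ ^ m) ⟩
  A ^ D * (γ ^ m) ^ D                   ≡⟨ cong (A ^ D *_) (^-*-assoc γ m D) ⟩
  A ^ D * γ ^ (m * D)                   ∎)
  where
  open ≤-Reasoning
  x Y Θ A : ℕ
  x = 30 * m
  Y = (15 * m) ! * (10 * m) ! * (6 * m) !
  Θ = x ^ suc s * primesIn prime? x
  A = 7 * suc m * Θ
  γ^≢0 : NonZero (γ ^ (m * D))
  γ^≢0 = m^n≢0 γ (m * D) {{γ≢0}}
  growth′ : Growth m
  growth′ = subst Growth (suc-pred m {{>-nonZero m≥1}}) (growth (pred m))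
  bound : β ^ m ≤ A * γ ^ m
  bound = *-cancelʳ-≤ _ _ Y {{m*n≢0 _ _ {{m*n≢0 _ _ {{(15 * m) !≢0}} {{(10 * m) !≢0}}}} {{(6 * m) !≢0}}}} (begin
    β ^ m * Y                              ≤⟨ growth′ ⟩
    7 * suc m * γ ^ m * (x ! * m !)        ≤⟨ *-monoʳ-≤ (7 * suc m * γ ^ m) (factorial-inequality m) ⟩
    7 * suc m * γ ^ m * (Y * ∏ (suc x) (λ p → only (prime? p) (p ^ exponent x p x)))
      ≤⟨ *-monoʳ-≤ (7 * suc m * γ ^ m) (*-monoʳ-≤ Y (primePowers≤ x x s (≤-trans m≥1 (m≤n*m m 30)) x<s²)) ⟩
    7 * suc m * γ ^ m * (Y * Θ)            ≡⟨ regroup (7 * suc m) (γ ^ m) Y Θ ⟩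
    A * γ ^ m * Y                          ∎)
    where
    regroup : ∀ a b c d → a * b * (c * d) ≡ a * d * b * c
    regroup = solve-∀

-- Sieves for the moduli 2 l, 2 l² and 6 l²

odd+odd : ∀ {a b} → ¬ 2 ∣ a → ¬ 2 ∣ b → 2 ∣ a + b
odd+odd {a} {b} ¬2∣a ¬2∣b = m%n≡0⇒n∣m (a + b) 2
  (trans (%-distribˡ-+ a b 2) (cong₂ (λ x y → (x + y) % 2) (odd%2 a ¬2∣a) (odd%2 b ¬2∣b)))
  where
  odd%2 : ∀ a → ¬ 2 ∣ a → a % 2 ≡ 1
  odd%2 a ¬2∣a with a % 2 in eq | m%n<n a 2
  ... | 0 | _ = contradiction (m%n≡0⇒n∣m a 2 eq) ¬2∣a
  ... | 1 | _ = refl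
  ... | suc (suc _) | s≤s (s≤s ())

odd-* : ∀ {a b} → ¬ 2 ∣ a → ¬ 2 ∣ b → ¬ 2 ∣ a * b
odd-* {a} {b} ¬2∣a ¬2∣b 2∣ab with euclidsLemma a b prime[2] 2∣ab
... | inj₁ 2∣a = ¬2∣a 2∣a
... | inj₂ 2∣b = ¬2∣b 2∣b

odd-prime : ∀ {p} → Prime p → p ≢ 2 → ¬ 2 ∣ p
odd-prime pr p≢2 2∣p = p≢2 (sym (prime∣prime prime[2] pr 2∣p))

prime[3] : Prime 3
prime[3] = toWitness {a? = prime? 3} tt

prime∣*⇒ : ∀ {p} c l → Prime p → Prime l → p ∣ c * (l * l) → p ∣ c ⊎ p ≡ l
prime∣*⇒ c l pr lr p∣ with euclidsLemma c (l * l) pr p∣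
... | inj₁ p∣c = inj₁ p∣c
... | inj₂ p∣l² with euclidsLemma l l pr p∣l²
...   | inj₁ p∣l = inj₂ (prime∣prime pr lr p∣l)
...   | inj₂ p∣l = inj₂ (prime∣prime pr lr p∣l)

prime∣6 : ∀ {p} → Prime p → p ∣ 6 → p ≡ 2 ⊎ p ≡ 3
prime∣6 pr p∣6 with euclidsLemma 2 3 pr p∣6
... | inj₁ p∣2 = inj₁ (prime∣prime pr prime[2] p∣2)
... | inj₂ p∣3 = inj₂ (prime∣prime pr prime[3] p∣3)

OnlyPrimes : ℕ → ℕ → Set
OnlyPrimes l k = ∀ p → Prime p → p ∣ k → p ≡ 2 ⊎ p ≡ l

onlyPrimes-2l : ∀ {l} → Prime l → OnlyPrimes l (2 * l)
onlyPrimes-2l {l} lr p pr p∣ with euclidsLemma 2 l pr p∣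
... | inj₁ p∣2 = inj₁ (prime∣prime pr prime[2] p∣2)
... | inj₂ p∣l = inj₂ (prime∣prime pr lr p∣l)

onlyPrimes-2l² : ∀ {l} → Prime l → OnlyPrimes l (2 * (l * l))
onlyPrimes-2l² {l} lr p pr p∣ with prime∣*⇒ 2 l pr lr p∣
... | inj₁ p∣2 = inj₁ (prime∣prime pr prime[2] p∣2)
... | inj₂ p≡l = inj₂ p≡l

sieve₂ : ∀ {k l w} → Prime l → OnlyPrimes l k →
  (k ^ pred l * (2 ^ pred l * (l ^ 1 * 1))) ^ D ≤ 2 ^ (w * pred l) → Sieve k w
sieve₂ {k} {l} {w} lr k-primes small =
  mkSieve k w (pred l) ((2 , pred l) ∷ (l , 1) ∷ []) {{>-nonZero (s≤s⁻¹ (≤-trans (prime≥2 lr) (≤-reflexive (sym (suc-pred l {{prime⇒nonZero lr}})))))}}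
    ((s≤s z≤n , sym (*-identityˡ (pred l))) ∷ (>-nonZero⁻¹ l {{prime⇒nonZero lr}} , sym (*-identityʳ (pred l))) ∷ [])
    (λ p pr p∣k → case k-primes p pr p∣k of λ { (inj₁ refl) → here refl ; (inj₂ refl) → there (here refl) })
    small

-- As `l ≤ 2 ^ (l − 1)`, the primes 2 and `l` of the modulus contribute at most a factor 2 per term
-- each.
coarseSieve : ∀ {k l w} → Prime l → OnlyPrimes l k → (4 * k) ^ D ≤ 2 ^ w → Sieve k w
coarseSieve {k} {l} {w} lr k-primes small = sieve₂ lr k-primes (begin
  (k ^ z * (2 ^ z * (l ^ 1 * 1))) ^ D
    ≤⟨ ^-monoˡ-≤ D (*-monoʳ-≤ (k ^ z) (*-monoʳ-≤ (2 ^ z) (≤-trans (≤-reflexive (trans (*-identityʳ (l ^ 1)) (*-identityʳ l))) l≤2^z))) ⟩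
  (k ^ z * (2 ^ z * 2 ^ z)) ^ D
    ≡⟨ cong (_^ D) (trans (cong (k ^ z *_) (sym (^-distribʳ-* z 2 2))) (trans (*-comm (k ^ z) (4 ^ z)) (sym (^-distribʳ-* z 4 k)))) ⟩
  ((4 * k) ^ z) ^ D                ≡⟨ ^-swap (4 * k) z D ⟩
  ((4 * k) ^ D) ^ z                ≤⟨ ^-monoˡ-≤ z small ⟩
  (2 ^ w) ^ z                      ≡⟨ ^-*-assoc 2 w z ⟩
  2 ^ (w * z)                      ∎)
  where
  open ≤-Reasoning
  z : ℕ
  z = pred l
  l≤2^z : l ≤ 2 ^ z
  l≤2^z = subst (_≤ 2 ^ z) (suc-pred l {{prime⇒nonZero lr}}) (n<b^n z ≤-refl)

-- The additional prime 3 contributes the square root of 3 per term, hence the exponent `e`, half of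
-- `pred l`.
sieve₃ : ∀ {l w e} → Prime l → pred l ≡ 2 * e →
  ((6 * (l * l)) ^ pred l * (2 ^ pred l * (3 ^ e * (l ^ 1 * 1)))) ^ D ≤ 2 ^ (w * pred l) →
  Sieve (6 * (l * l)) w
sieve₃ {l} {w} {e} lr z≡2e small =
  mkSieve (6 * (l * l)) w (pred l) ((2 , pred l) ∷ (3 , e) ∷ (l , 1) ∷ []) {{>-nonZero (s≤s⁻¹ (≤-trans (prime≥2 lr) (≤-reflexive (sym (suc-pred l {{prime⇒nonZero lr}})))))}}
    ((s≤s z≤n , sym (*-identityˡ (pred l))) ∷ (s≤s z≤n , z≡2e) ∷
     (>-nonZero⁻¹ l {{prime⇒nonZero lr}} , sym (*-identityʳ (pred l))) ∷ [])
    (λ p pr p∣k → case prime∣*⇒ 6 l pr lr p∣k of λ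
      { (inj₂ refl) → there (there (here refl))
      ; (inj₁ p∣6) → case prime∣6 pr p∣6 of λ { (inj₁ refl) → here refl ; (inj₂ refl) → there (here refl) } })
    small

-- The residue classes that cover the odd primes when no representation exists

module Classes (q N Y : ℕ) (2∣N : 2 ∣ N) where

  Base : ℕ → Set
  Base i = Prime i × i ≢ 2 × i ≤ N × Y < i

  base? : ∀ i → Dec (Base i)
  base? i = prime? i ×-dec ¬? (i ≟ 2) ×-dec i ≤? N ×-dec Y <? i

  QClass : ℕ → Set
  QClass i = Base i × q ∣ N ∸ i

  qClass? : ∀ i → Dec (QClass i)
  qClass? i = base? i ×-dec q ∣? N ∸ i

  OddPrime : ℕ → Set
  OddPrime a = Prime a × a ≢ 2

  oddPrime? : ∀ a → Dec (OddPrime a)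
  oddPrime? a = prime? a ×-dec ¬? (a ≟ 2)

  -- The last condition empties the class of `a = q` and, for `q = 3`, confines the class to one
  -- residue modulo 3 if 3 ∤ `N`.
  SquareClass : ℕ → ℕ → Set
  SquareClass a i = Base i × OddPrime a × a * a ∣ N ∸ i × ¬ q ∣ N ∸ i

  squareClass? : ∀ a i → Dec (SquareClass a i)
  squareClass? a i = base? i ×-dec oddPrime? a ×-dec a * a ∣? N ∸ i ×-dec ¬? (q ∣? N ∸ i)

  base-odd : ∀ {i} → Base i → ¬ 2 ∣ N ∸ i
  base-odd {i} (pr , i≢2 , i≤N , _) 2∣N∸i = odd-prime pr i≢2
    (∣m+n∣m⇒∣n (subst (2 ∣_) (sym (m∸n+n≡m i≤N)) 2∣N) 2∣N∸i)

  shift-∸ : ∀ {i} c → i ≤ N → (N + c) ∸ i ≡ (N ∸ i) + c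
  shift-∸ {i} c i≤N = trans (cong (_∸ i) (+-comm N c)) (trans (+-∸-assoc c i≤N) (+-comm c (N ∸ i)))

  -- For an odd prime `i` both `N ∸ i` and `c` are odd, so adding `c` produces an even multiple of
  -- `c`. The shift merges the conditions modulo 2 and modulo `c` into one class modulo `2 * c`.
  class-2c : ∀ {c} {P : ℕ → Set} → ¬ 2 ∣ c → (∀ i → P i → Base i × c ∣ N ∸ i) → InClass (2 * c) (N + c) P
  class-2c {c} ¬2∣c P⇒ i p with P⇒ i p
  ... | base@(pr , _ , i≤N , _) , c∣ = pr , ≤-trans i≤N (m≤m+n N c) ,
    subst (2 * c ∣_) (sym (shift-∸ c i≤N))
      (∣-coprime-* (prime∤⇒coprime prime[2] ¬2∣c)
        (odd+odd (base-odd base) ¬2∣c) (∣m∣n⇒∣m+n c∣ ∣-refl))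

  qClass-class : ¬ 2 ∣ q → InClass (2 * q) (N + q) QClass
  qClass-class ¬2∣q = class-2c ¬2∣q (λ i p → p)

  squareClass-class : ∀ {a} → OddPrime a → InClass (2 * (a * a)) (N + a * a) (SquareClass a)
  squareClass-class (pr , a≢2) = class-2c (odd-* (odd-prime pr a≢2) (odd-prime pr a≢2))
    (λ i (base , _ , a²∣ , _) → base , a²∣)

  module _ (exceptional : ∀ p → Prime p → p ≢ 2 → p < N → ¬ (SquareFree (N ∸ p) × ¬ q ∣ N ∸ p))
           {A : ℕ} (N<A² : N < A * A) where

    classify : ∀ i → Base i → QClass i ⊎ ∃[ a ] (a < A × SquareClass a i)
    classify i base@(pr , i≢2 , i≤N , _) with q ∣? N ∸ i
    ... | yes q∣ = inj₁ (base , q∣)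
    ... | no ¬q∣ with anyUpTo? (λ a → oddPrime? a ×-dec a * a ∣? N ∸ i) A
    ...   | yes (a , a<A , odd , a²∣) = inj₂ (a , a<A , base , odd , a²∣ , ¬q∣)
    ...   | no none = contradiction (squareFree , ¬q∣) (exceptional i pr i≢2 i<N)
      where
      i<N : i < N
      i<N = ≤∧≢⇒< i≤N λ { refl → odd-prime pr i≢2 2∣N }
      x>0 : 0 < N ∸ i
      x>0 = m<n⇒0<n∸m i<N
      squareFree : SquareFree (N ∸ i)
      squareFree = x>0 , λ {p} p-prime p²∣ →
        let pp∣ = subst (_∣ N ∸ i) (cong (p *_) (*-identityʳ p)) p²∣ in
        none (p , ≰⇒> (λ A≤p → <⇒≱ N<A² (≤-trans (*-mono-≤ A≤p A≤p)
                    (≤-trans (∣⇒≤ {{>-nonZero x>0}} pp∣) (m∸n≤m N i)))) ,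
              (p-prime , λ { refl → base-odd base (m*n∣⇒m∣ 2 2 pp∣) }) , pp∣)

    base≤ : primesIn base? N ≤ primesIn qClass? N * ∏ A (λ a → primesIn (squareClass? a) N)
    base≤ = begin
      primesIn base? N
        ≤⟨ ∏-mono (suc N) (λ i _ → pointwise i) ⟩
      ∏ (suc N) (λ i → only (qClass? i) i * ∏ A (λ a → only (squareClass? a i) i))
        ≡⟨ ∏-* (suc N) (λ i → only (qClass? i) i) _ ⟩
      primesIn qClass? N * ∏ (suc N) (λ i → ∏ A (λ a → only (squareClass? a i) i))
        ≡⟨ cong (primesIn qClass? N *_) (∏-swap (suc N) A (λ i a → only (squareClass? a i) i)) ⟩
      primesIn qClass? N * ∏ A (λ a → primesIn (squareClass? a) N) ∎
      where
      open ≤-Reasoning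
      q≥1 : ∀ i → 1 ≤ only (qClass? i) i
      q≥1 = only-prime≥1 qClass? λ i p → proj₁ (proj₁ p)
      a≥1 : ∀ i a → 1 ≤ only (squareClass? a i) i
      a≥1 i a = only-prime≥1 (squareClass? a) (λ i p → proj₁ (proj₁ p)) i
      term≤∏ : ∀ n (f : ℕ → ℕ) → (∀ i → 1 ≤ f i) → ∀ {j} → j < n → f j ≤ ∏ n f
      term≤∏ (suc n) f f≥1 {j} j<1+n with n ≟ j
      ... | yes refl = m≤n*m (f n) (∏ n f) {{>-nonZero (∏-≥1 n λ i _ → f≥1 i)}}
      ... | no n≢j   = ≤-trans (term≤∏ n f f≥1 (≤∧≢⇒< (s≤s⁻¹ j<1+n) (n≢j ∘ sym)))
                               (m≤m*n (∏ n f) (f n) {{>-nonZero (f≥1 n)}})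
      pointwise : ∀ i → only (base? i) i ≤ only (qClass? i) i * ∏ A (λ a → only (squareClass? a i) i)
      pointwise i = by (base? i)
        where
        rest≥1 : 1 ≤ ∏ A (λ a → only (squareClass? a i) i)
        rest≥1 = ∏-≥1 A λ a _ → a≥1 i a
        by : (d : Dec (Base i)) → only d i ≤ only (qClass? i) i * ∏ A (λ a → only (squareClass? a i) i)
        by (no _)     = *-mono-≤ (q≥1 i) rest≥1
        by (yes base) with classify i base
        ... | inj₁ qc = begin
          i                                            ≡⟨ sym (only-yes {d = qClass? i} qc) ⟩
          only (qClass? i) i                           ≤⟨ m≤m*n _ _ {{>-nonZero rest≥1}} ⟩
          only (qClass? i) i * ∏ A (λ a → only (squareClass? a i) i) ∎
        ... | inj₂ (a , a<A , sc) = begin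
          i                                            ≡⟨ sym (only-yes {d = squareClass? a i} sc) ⟩
          only (squareClass? a i) i                    ≤⟨ term≤∏ A (λ a → only (squareClass? a i) i) (a≥1 i) a<A ⟩
          ∏ A (λ a → only (squareClass? a i) i)        ≤⟨ m≤n*m _ _ {{>-nonZero (q≥1 i)}} ⟩
          only (qClass? i) i * ∏ A (λ a → only (squareClass? a i) i) ∎

-- Entry number j is ⌈32 log₂ (4 a² · a ^ (1 / (a − 1)))⌉ for a = 2 j + 1, or 0 if a is not prime.
weightTable : List ℕ
weightTable =
  0 ∷ 191 ∷ 232 ∷ 259 ∷ 0 ∷ 297 ∷ 311 ∷ 0 ∷ 334 ∷ 344 ∷ 0 ∷ 361 ∷ 0 ∷ 0 ∷ 381 ∷ 387 ∷ 0 ∷ 0 ∷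
  403 ∷ 0 ∷ 412 ∷ 416 ∷ 0 ∷ 424 ∷ 0 ∷ 0 ∷ 435 ∷ 0 ∷ 0 ∷ 444 ∷ 447 ∷ 0 ∷ 0 ∷ 456 ∷ 0 ∷ 461 ∷
  463 ∷ 0 ∷ 0 ∷ 471 ∷ 0 ∷ 475 ∷ 0 ∷ 0 ∷ 481 ∷ 0 ∷ 0 ∷ 0 ∷ 489 ∷ 0 ∷ 493 ∷ 495 ∷ 0 ∷ 498 ∷ 500 ∷
  0 ∷ 503 ∷ 0 ∷ 0 ∷ 0 ∷ 0 ∷ 0 ∷ 0 ∷ 514 ∷ 0 ∷ 516 ∷ 0 ∷ 0 ∷ 520 ∷ 522 ∷ 0 ∷ 0 ∷ 0 ∷ 0 ∷ 528 ∷
  529 ∷ 0 ∷ 0 ∷ 533 ∷ 0 ∷ 0 ∷ 536 ∷ 0 ∷ 538 ∷ 0 ∷ 0 ∷ 542 ∷ 0 ∷ 0 ∷ 545 ∷ 546 ∷ 0 ∷ 0 ∷ 0 ∷ 0 ∷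
  551 ∷ 552 ∷ 0 ∷ 554 ∷ 554 ∷ 0 ∷ 0 ∷ 0 ∷ 0 ∷ 0 ∷ 560 ∷ 0 ∷ 0 ∷ 0 ∷ 0 ∷ 0 ∷ 565 ∷ 0 ∷ 567 ∷
  567 ∷ 0 ∷ 569 ∷ 0 ∷ 0 ∷ 571 ∷ 572 ∷ 0 ∷ 0 ∷ 0 ∷ 0 ∷ 576 ∷ 0 ∷ 0 ∷ []

entry : List ℕ → ℕ → ℕ
entry []       _       = 0
entry (w ∷ ws) zero    = w
entry (w ∷ ws) (suc n) = entry ws n

opaque
  -- The factor `a % 2` removes even `a`, which would otherwise read the entry of `a + 1`.
  weight : ℕ → ℕ
  weight a = entry weightTable (a / 2) * (a % 2)

  weight-correct : ∀ {a} → a < 256 → Prime a × a ≢ 2 →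
    ((2 * (a * a)) ^ pred a * (2 ^ pred a * (a ^ 1 * 1))) ^ 32 ≤ (2 ^ weight a) ^ pred a
  weight-correct = toWitness {a? = allUpTo? (λ a → (prime? a ×-dec ¬? (a ≟ 2)) →-dec
    (((2 * (a * a)) ^ pred a * (2 ^ pred a * (a ^ 1 * 1))) ^ 32 ≤? (2 ^ weight a) ^ pred a)) 256} tt

-- The number of terms charged in successive sieve steps

m*n≤o⇒m≤o/n : ∀ m n o .{{_ : NonZero n}} → m * n ≤ o → m ≤ o / n
m*n≤o⇒m≤o/n m n o m*n≤o = subst (_≤ _) (m*n/n≡m m n) (/-monoˡ-≤ n m*n≤o)

opaque
  level levels : ℕ → ℕ → ℕ
  level k X = suc (X / suc (pred k))
  levels k X = level k X + level k (level k X) + level k (level k (level k X))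

  level-bound : ∀ k X .{{_ : NonZero k}} → k * level k X ≤ X + k
  level-bound k@(suc _) X = begin
    k * suc (X / k)    ≡⟨ trans (*-suc k (X / k)) (+-comm k _) ⟩
    k * (X / k) + k    ≤⟨ +-monoˡ-≤ k (subst (_≤ X) (*-comm (X / k) k) (m/n*n≤m X k)) ⟩
    X + k              ∎
    where open ≤-Reasoning

  suc-pred-level : ∀ k X → suc (pred (level k X)) ≡ level k X
  suc-pred-level k X = refl

  pred-level-bound : ∀ k X .{{_ : NonZero k}} → k * pred (level k X) ≤ X
  pred-level-bound k@(suc _) X = subst (_≤ X) (*-comm (X / k) k) (m/n*n≤m X k)

  level-antitone : ∀ k k′ X .{{_ : NonZero k}} → k ≤ k′ → level k′ X ≤ level k X
  level-antitone k@(suc _) k′@(suc _) X k≤k′ = s≤s (/-monoʳ-≤ X k≤k′)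

  -- Each level satisfies `k * level k X ≤ X + k`. Summed over three levels, the right sides contain
  -- the first two levels, which cancel one of the `k` copies.
  levels-bound : ∀ k X .{{_ : NonZero k}} → pred k * levels k X ≤ X + 3 * k
  levels-bound k@(suc k-1) X = +-cancelˡ-≤ (levels k X) _ _ (begin
    k * (M₁ + M₂ + M₃)                      ≡⟨ distrib k M₁ M₂ M₃ ⟩
    k * M₁ + k * M₂ + k * M₃                ≤⟨ +-mono-≤ (+-mono-≤ (level-bound k X) (level-bound k M₁)) (level-bound k M₂) ⟩
    X + k + (M₁ + k) + (M₂ + k)             ≡⟨ regroup X k M₁ M₂ ⟩
    M₁ + M₂ + (X + 3 * k)                   ≤⟨ +-monoˡ-≤ (X + 3 * k) (m≤m+n (M₁ + M₂) M₃) ⟩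
    M₁ + M₂ + M₃ + (X + 3 * k)              ∎)
    where
    open ≤-Reasoning
    M₁ M₂ M₃ : ℕ
    M₁ = level k X
    M₂ = level k M₁
    M₃ = level k M₂
    distrib : ∀ k a b c → k * (a + b + c) ≡ k * a + k * b + k * c
    distrib = solve-∀
    regroup : ∀ x k a b → x + k + (a + k) + (b + k) ≡ a + b + (x + 3 * k)
    regroup = solve-∀

  -- Three divisions by at least 6 divide by 216 up to rounding, and the excess of 216 over 128 pays
  -- for the rounding once `X` is at least 2¹⁸.
  third-level-bound : ∀ k X → 6 ≤ k → 262144 ≤ X → level k (level k (level k X)) ≤ X / 128
  third-level-bound k@(suc _) X 6≤k X≥ = m*n≤o⇒m≤o/n M₃ 128 X (*-cancelˡ-≤ 216 (begin
    216 * (M₃ * 128)                    ≡⟨ split₁ M₃ ⟩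
    128 * (36 * (6 * M₃))               ≤⟨ *-monoʳ-≤ 128 (*-monoʳ-≤ 36 (level₆ M₂)) ⟩
    128 * (36 * (M₂ + 6))               ≡⟨ cong (128 *_) (split₂ M₂) ⟩
    128 * (6 * (6 * M₂) + 216)          ≤⟨ *-monoʳ-≤ 128 (+-monoˡ-≤ 216 (*-monoʳ-≤ 6 (level₆ M₁))) ⟩
    128 * (6 * (M₁ + 6) + 216)          ≡⟨ cong (128 *_) (split₃ M₁) ⟩
    128 * (6 * M₁ + 252)                ≤⟨ *-monoʳ-≤ 128 (+-monoˡ-≤ 252 (level₆ X)) ⟩
    128 * (X + 6 + 252)                 ≡⟨ split₄ X ⟩
    128 * X + 33024                     ≤⟨ +-monoʳ-≤ (128 * X) (≤-trans (≤ᵇ⇒≤ 33024 262144 tt) (≤-trans X≥ (m≤n*m X 88))) ⟩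
    128 * X + 88 * X                    ≡⟨ split₅ X ⟩
    216 * X                             ∎))
    where
    open ≤-Reasoning
    M₁ M₂ M₃ : ℕ
    M₁ = level k X
    M₂ = level k M₁
    M₃ = level k M₂
    level₆ : ∀ X → 6 * level k X ≤ X + 6
    level₆ X = ≤-trans (*-monoʳ-≤ 6 (s≤s (/-monoʳ-≤ X 6≤k))) (level-bound 6 X)
    split₁ : ∀ m → 216 * (m * 128) ≡ 128 * (36 * (6 * m))
    split₁ = solve-∀
    split₂ : ∀ m → 36 * (m + 6) ≡ 6 * (6 * m) + 216
    split₂ = solve-∀
    split₃ : ∀ m → 6 * (m + 6) + 216 ≡ 6 * m + 252
    split₃ = solve-∀
    split₄ : ∀ x → 128 * (x + 6 + 252) ≡ 128 * x + 33024
    split₄ = solve-∀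
    split₅ : ∀ x → 128 * x + 88 * x ≡ 216 * x
    split₅ = solve-∀

  -- 131072 is `2 * (256 * 256)`: from `a = 256` on, a single step already descends below `X / 128`.
  first-level-bound : ∀ k X → 131072 ≤ k → 262144 ≤ X → level k X ≤ X / 128
  first-level-bound k@(suc _) X k≥ X≥ = m*n≤o⇒m≤o/n (level k X) 128 X (*-cancelˡ-≤ 1024 (begin
    1024 * (level k X * 128)          ≡⟨ split₁ (level k X) ⟩
    131072 * level k X                ≤⟨ *-monoʳ-≤ 131072 (s≤s (/-monoʳ-≤ X k≥)) ⟩
    131072 * level 131072 X           ≤⟨ level-bound 131072 X ⟩
    X + 131072                        ≤⟨ +-monoʳ-≤ X (≤-trans (≤ᵇ⇒≤ 131072 262144 tt) (≤-trans X≥ (m≤n*m X 1023))) ⟩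
    X + 1023 * X                      ≡⟨⟩
    1024 * X                          ∎))
    where
    open ≤-Reasoning
    split₁ : ∀ m → 1024 * (m * 128) ≡ 131072 * m
    split₁ = solve-∀

  sieve-bound : ∀ {k w R X} {P : ℕ → Set} (P? : ∀ i → Dec (P i)) → Sieve k w → InClass k R P →
    6 ≤ k → 262144 ≤ X → (∀ i → P i → X / 128 < i) → primesIn P? X ^ D ≤ 2 ^ (w * levels k X)
  sieve-bound {k@(suc _)} {X = X} P? S class 6≤k X≥ P⇒>Y =
    sieve-bound₃ P? S class P⇒>Y X (third-level-bound k X 6≤k X≥)

  sieve-bound-large : ∀ {k w R X} {P : ℕ → Set} (P? : ∀ i → Dec (P i)) → Sieve k w → InClass k R P →
    131072 ≤ k → 262144 ≤ X → (∀ i → P i → X / 128 < i) → primesIn P? X ^ D ≤ 2 ^ (w * level k X)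
  sieve-bound-large {k@(suc _)} {X = X} P? S class k≥ X≥ P⇒>Y =
    sieve-bound₁ P? S class P⇒>Y X (first-level-bound k X k≥ X≥)

-- Costs are bounded by u (X + 3 k) / 1024 with u = ⌈1024 w / (k − 1)⌉.
unitCost : ℕ × ℕ → ℕ
unitCost (k , w) = (1024 * w + (k ∸ 2)) / suc (k ∸ 2)

offsetCost : ℕ × ℕ → ℕ
offsetCost (k , w) = 3 * k * unitCost (k , w)

opaque
  cost : ℕ → ℕ × ℕ → ℕ
  cost X (k , w) = w * levels k X

  cost≡ : ∀ X k w → cost X (k , w) ≡ w * levels k X
  cost≡ X k w = refl

  cost-bound : ∀ X k w → 2 ≤ k ⊎ w ≡ 0 → 1024 * cost X (k , w) ≤ unitCost (k , w) * X + offsetCost (k , w)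
  cost-bound X k w (inj₂ refl) = z≤n
  cost-bound X (suc zero) w (inj₁ (s≤s ()))
  cost-bound X k@(suc (suc k-2)) w (inj₁ _) = begin
    1024 * (w * τ)                            ≡⟨ sym (*-assoc 1024 w τ) ⟩
    1024 * w * τ                              ≤⟨ *-monoˡ-≤ τ ceiling ⟩
    u * suc k-2 * τ                           ≡⟨ *-assoc u (suc k-2) τ ⟩
    u * (suc k-2 * τ)                         ≤⟨ *-monoʳ-≤ u (levels-bound k X) ⟩
    u * (X + 3 * k)                           ≡⟨ trans (*-distribˡ-+ u X (3 * k)) (cong (u * X +_) (*-comm u (3 * k))) ⟩
    u * X + 3 * k * u                         ∎
    where
    open ≤-Reasoning
    τ u : ℕ
    τ = levels k X
    u = unitCost (k , w)
    ceiling : 1024 * w ≤ u * suc k-2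
    ceiling = +-cancelʳ-≤ k-2 _ _ (begin
      1024 * w + k-2                                               ≡⟨ m≡m%n+[m/n]*n (1024 * w + k-2) (suc k-2) ⟩
      (1024 * w + k-2) % suc k-2 + u * suc k-2                     ≤⟨ +-monoˡ-≤ (u * suc k-2) (s≤s⁻¹ (m%n<n (1024 * w + k-2) (suc k-2))) ⟩
      k-2 + u * suc k-2                                            ≡⟨ +-comm k-2 _ ⟩
      u * suc k-2 + k-2                                            ∎)

-- Total cost of the classes of all a < 256

Entries : Set
Entries = ℕ → ℕ × ℕ

set : ℕ → ℕ × ℕ → Entries → Entries
set b x e a with a ≟ b
... | yes _ = x
... | no _  = e a

set-elim : ∀ (P : ℕ → ℕ × ℕ → Set) b x {e} → P b x → (∀ a → P a (e a)) → ∀ a → P a (set b x e a)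
set-elim P b x px pe a with a ≟ b
... | yes refl = px
... | no _     = pe a

-- The class of a = q is empty, and for q = 3 the classes of 5 and 7 are classes modulo 6 a².
plainEntries entries₃ entries₅ entries₇ : Entries
plainEntries a = 2 * (a * a) , weight a
entries₃ = set 3 (6 , 0) (set 5 (150 , 308) (set 7 (294 , 335) plainEntries))
entries₅ = set 5 (6 , 0) plainEntries
entries₇ = set 7 (6 , 0) plainEntries

opaque
  unfolding weight

  totalUnit totalOffset totalCost : (ℕ → ℕ × ℕ) → ℕ → ℕ
  totalUnit e A = ∑ A (λ a → unitCost (e a))
  totalOffset e A = ∑ A (λ a → offsetCost (e a))
  totalCost e X = ∑ 256 (λ a → cost X (e a))

  Proper : Entries → Set
  Proper e = ∀ {a} → a < 256 → 2 ≤ proj₁ (e a) ⊎ proj₂ (e a) ≡ 0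

  totalCost-bound : ∀ e X → Proper e → 1024 * totalCost e X ≤ totalUnit e 256 * X + totalOffset e 256
  totalCost-bound e X proper = begin
    1024 * ∑ 256 (λ a → cost X (e a))    ≡⟨ sym (∑-*ˡ 256 1024 (λ a → cost X (e a))) ⟩
    ∑ 256 (λ a → 1024 * cost X (e a))
      ≤⟨ ∑-mono 256 (λ a a<256 → cost-bound X (proj₁ (e a)) (proj₂ (e a)) (proper a<256)) ⟩
    ∑ 256 (λ a → unitCost (e a) * X + offsetCost (e a))
      ≡⟨ ∑-+ 256 (λ a → unitCost (e a) * X) (λ a → offsetCost (e a)) ⟩
    ∑ 256 (λ a → unitCost (e a) * X) + ∑ 256 (λ a → offsetCost (e a))
      ≡⟨ cong (_+ totalOffset e 256) (trans (∑-cong 256 λ a _ → *-comm (unitCost (e a)) X)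
           (trans (∑-*ˡ 256 X (λ a → unitCost (e a))) (*-comm X (totalUnit e 256)))) ⟩
    totalUnit e 256 * X + totalOffset e 256 ∎
    where open ≤-Reasoning

  proper? : ∀ e → Dec (Proper e)
  proper? e = allUpTo? (λ a → 2 ≤? proj₁ (e a) ⊎-dec proj₂ (e a) ≟ 0) 256

  plain-proper : Proper plainEntries
  plain-proper = toWitness {a? = proper? plainEntries} tt
  proper₃ : Proper entries₃
  proper₃ = toWitness {a? = proper? entries₃} tt
  proper₅ : Proper entries₅
  proper₅ = toWitness {a? = proper? entries₅} tt
  proper₇ : Proper entries₇
  proper₇ = toWitness {a? = proper? entries₇} tt

  -- Limits common to all kinds of `q`, in units of 1 / 1024 of the exponents, so that the final
  -- comparison is made only once.
  unitLimit offsetLimit : ℕ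
  unitLimit = 37600
  offsetLimit = 81000000

  -- The first two summands are reserved for `q ≥ 11`. Its class costs at most half of
  -- `21 * (N + 6 * s)`; times 1024 this is `512 * 21 * N` plus `21 * 6 * (512 * s)`, where
  -- `512 * s ≤ N`.
  plain-totals : 512 * 21 + 21 * 6 + totalUnit plainEntries 256 ≤ unitLimit × totalOffset plainEntries 256 ≤ offsetLimit
  plain-totals = toWitness {a? = _ ≤? _ ×-dec _ ≤? _} tt
  totals₃ : totalUnit entries₃ 256 + unitCost (6 , 141) ≤ unitLimit × totalOffset entries₃ 256 + offsetCost (6 , 141) ≤ offsetLimit
  totals₃ = toWitness {a? = _ ≤? _ ×-dec _ ≤? _} tt
  totals₅ : totalUnit entries₅ 256 + unitCost (10 , 157) ≤ unitLimit × totalOffset entries₅ 256 + offsetCost (10 , 157) ≤ offsetLimit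
  totals₅ = toWitness {a? = _ ≤? _ ×-dec _ ≤? _} tt
  totals₇ : totalUnit entries₇ 256 + unitCost (14 , 169) ≤ unitLimit × totalOffset entries₇ 256 + offsetCost (14 , 169) ≤ offsetLimit
  totals₇ = toWitness {a? = _ ≤? _ ×-dec _ ≤? _} tt

  ∏≤totalCost : ∀ e X (Q : ℕ → ℕ) → (∀ a → a < 256 → Q a ^ D ≤ 2 ^ cost X (e a)) →
                ∏ 256 Q ^ D ≤ 2 ^ totalCost e X
  ∏≤totalCost e X Q bound = begin
    ∏ 256 Q ^ D                        ≡⟨ ∏-^-distrib 256 ⟩
    ∏ 256 (λ a → Q a ^ D)              ≤⟨ ∏-mono 256 bound ⟩
    ∏ 256 (λ a → 2 ^ cost X (e a))     ≡⟨ ∏-^ 256 2 (λ a → cost X (e a)) ⟩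
    2 ^ ∑ 256 (λ a → cost X (e a))     ∎
    where
    open ≤-Reasoning
    ∏-^-distrib : ∀ n → ∏ n Q ^ D ≡ ∏ n (λ a → Q a ^ D)
    ∏-^-distrib zero    = ^-zeroˡ D
    ∏-^-distrib (suc n) = trans (^-distribʳ-* D (∏ n Q) (Q n)) (cong (_* Q n ^ D) (∏-^-distrib n))

-- Numerical certificates and elementary estimates

at-D : ∀ x w z → x ^ 32 ≤ (2 ^ w) ^ z → x ^ D ≤ 2 ^ (w * z)
at-D x w z x^32≤ = subst₂ (λ d y → x ^ d ≤ y) (sym D≡32) (^-*-assoc 2 w z) x^32≤

private opaque
  small₅ : ((6 * (5 * 5)) ^ 4 * (2 ^ 4 * (3 ^ 2 * (5 ^ 1 * 1)))) ^ 32 ≤ (2 ^ 308) ^ 4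
  small₅ = ≤ᵇ⇒≤ (((6 * (5 * 5)) ^ 4 * (2 ^ 4 * (3 ^ 2 * (5 ^ 1 * 1)))) ^ 32) ((2 ^ 308) ^ 4) tt
  small₇ : ((6 * (7 * 7)) ^ 6 * (2 ^ 6 * (3 ^ 3 * (7 ^ 1 * 1)))) ^ 32 ≤ (2 ^ 335) ^ 6
  small₇ = ≤ᵇ⇒≤ (((6 * (7 * 7)) ^ 6 * (2 ^ 6 * (3 ^ 3 * (7 ^ 1 * 1)))) ^ 32) ((2 ^ 335) ^ 6) tt
  smallQ₃ : ((2 * 3) ^ 2 * (2 ^ 2 * (3 ^ 1 * 1))) ^ 32 ≤ (2 ^ 141) ^ 2
  smallQ₃ = ≤ᵇ⇒≤ (((2 * 3) ^ 2 * (2 ^ 2 * (3 ^ 1 * 1))) ^ 32) ((2 ^ 141) ^ 2) tt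
  smallQ₅ : ((2 * 5) ^ 4 * (2 ^ 4 * (5 ^ 1 * 1))) ^ 32 ≤ (2 ^ 157) ^ 4
  smallQ₅ = ≤ᵇ⇒≤ (((2 * 5) ^ 4 * (2 ^ 4 * (5 ^ 1 * 1))) ^ 32) ((2 ^ 157) ^ 4) tt
  smallQ₇ : ((2 * 7) ^ 6 * (2 ^ 6 * (7 ^ 1 * 1))) ^ 32 ≤ (2 ^ 169) ^ 6
  smallQ₇ = ≤ᵇ⇒≤ (((2 * 7) ^ 6 * (2 ^ 6 * (7 ^ 1 * 1))) ^ 32) ((2 ^ 169) ^ 6) tt
  powerTwo₁₁ : (8 * 11) ^ 8 ≤ 2 ^ (5 * 11)
  powerTwo₁₁ = ≤ᵇ⇒≤ ((8 * 11) ^ 8) (2 ^ (5 * 11)) tt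

prime[5] : Prime 5
prime[5] = toWitness {a? = prime? 5} tt

prime[7] : Prime 7
prime[7] = toWitness {a? = prime? 7} tt

prime<11 : ∀ {q} → q < 11 → Prime q → q ≡ 2 ⊎ q ≡ 3 ⊎ q ≡ 5 ⊎ q ≡ 7
prime<11 = toWitness {a? = allUpTo? (λ q → prime? q →-dec
  (q ≟ 2 ⊎-dec q ≟ 3 ⊎-dec q ≟ 5 ⊎-dec q ≟ 7)) 11} tt

-- As `q ≥ 2`, passing from `q` to `q + 1` multiplies `8 * q` by at most 3 / 2, while the right side
-- gains the factor `2 ^ f`.
power-growth : ∀ e f b → 2 ≤ b → 3 ^ e ≤ 2 ^ e * 2 ^ f → (8 * b) ^ e ≤ 2 ^ (f * b) →
               ∀ d → (8 * (b + d)) ^ e ≤ 2 ^ (f * (b + d))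
power-growth e f b 2≤b 3^e≤ base zero    = subst (λ q → (8 * q) ^ e ≤ 2 ^ (f * q)) (sym (+-identityʳ b)) base
power-growth e f b 2≤b 3^e≤ base (suc d) = subst (λ q → (8 * q) ^ e ≤ 2 ^ (f * q)) (sym (+-suc b d))
  (*-cancelˡ-≤ (2 ^ e) {{m^n≢0 2 e}} (begin
  2 ^ e * (8 * suc q) ^ e               ≡⟨ sym (^-distribʳ-* e 2 (8 * suc q)) ⟩
  (2 * (8 * suc q)) ^ e                 ≤⟨ ^-monoˡ-≤ e double ⟩
  (3 * (8 * q)) ^ e                     ≡⟨ ^-distribʳ-* e 3 (8 * q) ⟩
  3 ^ e * (8 * q) ^ e                   ≤⟨ *-mono-≤ 3^e≤ (power-growth e f b 2≤b 3^e≤ base d) ⟩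
  2 ^ e * 2 ^ f * 2 ^ (f * q)           ≡⟨ *-assoc (2 ^ e) (2 ^ f) (2 ^ (f * q)) ⟩
  2 ^ e * (2 ^ f * 2 ^ (f * q))         ≡⟨ cong (2 ^ e *_) (trans (sym (^-distribˡ-+-* 2 f (f * q))) (cong (2 ^_) (sym (*-suc f q)))) ⟩
  2 ^ e * 2 ^ (f * suc q)               ∎))
  where
  open ≤-Reasoning
  q : ℕ
  q = b + d
  double : 2 * (8 * suc q) ≤ 3 * (8 * q)
  double = subst₂ _≤_ (left q) (right q) (+-monoʳ-≤ (16 * q) (*-monoʳ-≤ 8 (≤-trans 2≤b (m≤m+n b d))))
    where
    left : ∀ q → 16 * q + 8 * 2 ≡ 2 * (8 * suc q)
    left = solve-∀
    right : ∀ q → 16 * q + 8 * q ≡ 3 * (8 * q)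
    right = solve-∀

power-up : ∀ e g x y → D ≡ e * g → x ^ e ≤ 2 ^ y → x ^ D ≤ 2 ^ (y * g)
power-up e g x y D≡ x^e≤ = begin
  x ^ D           ≡⟨ cong (x ^_) D≡ ⟩
  x ^ (e * g)     ≡⟨ sym (^-*-assoc x e g) ⟩
  (x ^ e) ^ g     ≤⟨ ^-monoˡ-≤ g x^e≤ ⟩
  (2 ^ y) ^ g     ≡⟨ ^-*-assoc 2 y g ⟩
  2 ^ (y * g)     ∎
  where open ≤-Reasoning

coarse-weight : ∀ {q} → 11 ≤ q → (4 * (2 * q)) ^ D ≤ 2 ^ (20 * q)
coarse-weight {q} 11≤q = subst₂ (λ x w → x ^ D ≤ 2 ^ w) (*-assoc 4 2 q) (twenty q)
  (power-up 8 4 (8 * q) (5 * q) D≡32 (subst (λ q → (8 * q) ^ 8 ≤ 2 ^ (5 * q)) (m+[n∸m]≡n 11≤q)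
    (power-growth 8 5 11 (≤ᵇ⇒≤ 2 11 tt) (≤ᵇ⇒≤ 6561 8192 tt) powerTwo₁₁ (q ∸ 11))))
  where
  twenty : ∀ q → 5 * q * 4 ≡ 20 * q
  twenty = solve-∀

linear≤power : ∀ {n} → 2 ≤ n → 19 + 2 * n ≤ 6 * 2 ^ n
linear≤power {n} 2≤n = subst (λ n → 19 + 2 * n ≤ 6 * 2 ^ n) (m+[n∸m]≡n 2≤n) (by (n ∸ 2))
  where
  open ≤-Reasoning
  by : ∀ m → 19 + 2 * (2 + m) ≤ 6 * 2 ^ (2 + m)
  by zero    = ≤ᵇ⇒≤ 23 24 tt
  by (suc m) = begin
    19 + 2 * (2 + suc m)              ≡⟨ step m ⟩
    19 + 2 * (2 + m) + 2              ≤⟨ +-mono-≤ (by m) (*-mono-≤ (≤ᵇ⇒≤ 2 6 tt) (m^n>0 2 (2 + m))) ⟩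
    6 * 2 ^ (2 + m) + 6 * 2 ^ (2 + m) ≡⟨ double (2 ^ (2 + m)) ⟩
    6 * 2 ^ (2 + suc m)               ∎
    where
    step : ∀ m → 19 + 2 * (2 + suc m) ≡ 19 + 2 * (2 + m) + 2
    step = solve-∀
    double : ∀ x → 6 * x + 6 * x ≡ 6 * (2 * x)
    double = solve-∀

-- Two nonzero residues modulo 3 with sum 1 are both 2.
3∣-lemma₁ : ∀ d i → ¬ 3 ∣ d → ¬ 3 ∣ i → (d + i) % 3 ≡ 1 → 3 ∣ d + 1
3∣-lemma₁ d i 3∤d 3∤i d+i≡1 = m%n≡0⇒n∣m (d + 1) 3 (trans (%-distribˡ-+ d 1 3)
  (table (d % 3) (i % 3) (m%n<n d 3) (m%n<n i 3) (3∤d ∘ m%n≡0⇒n∣m d 3) (3∤i ∘ m%n≡0⇒n∣m i 3)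
    (trans (sym (%-distribˡ-+ d i 3)) d+i≡1)))
  where
  table : ∀ x y → x < 3 → y < 3 → x ≢ 0 → y ≢ 0 → (x + y) % 3 ≡ 1 → (x + 1) % 3 ≡ 0
  table 0 _ _ _ x≢0 _ _ = contradiction refl x≢0
  table 1 0 _ _ _ y≢0 _ = contradiction refl y≢0
  table 1 1 _ _ _ _ ()
  table 1 2 _ _ _ _ ()
  table 1 (suc (suc (suc _))) _ (s≤s (s≤s (s≤s ()))) _ _ _
  table 2 _ _ _ _ _ _ = refl
  table (suc (suc (suc _))) _ (s≤s (s≤s (s≤s ()))) _ _ _ _

-- Here both residues are 1. The summand is 5 and not 2 because it will also have to be odd.
3∣-lemma₂ : ∀ d i → ¬ 3 ∣ d → ¬ 3 ∣ i → (d + i) % 3 ≡ 2 → 3 ∣ d + 5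
3∣-lemma₂ d i 3∤d 3∤i d+i≡2 = m%n≡0⇒n∣m (d + 5) 3 (trans (%-distribˡ-+ d 5 3)
  (table (d % 3) (i % 3) (m%n<n d 3) (m%n<n i 3) (3∤d ∘ m%n≡0⇒n∣m d 3) (3∤i ∘ m%n≡0⇒n∣m i 3)
    (trans (sym (%-distribˡ-+ d i 3)) d+i≡2)))
  where
  table : ∀ x y → x < 3 → y < 3 → x ≢ 0 → y ≢ 0 → (x + y) % 3 ≡ 2 → (x + 2) % 3 ≡ 0
  table 0 _ _ _ x≢0 _ _ = contradiction refl x≢0
  table 1 _ _ _ _ _ _ = refl
  table 2 0 _ _ _ y≢0 _ = contradiction refl y≢0
  table 2 1 _ _ _ _ ()
  table 2 2 _ _ _ _ ()
  table 2 (suc (suc (suc _))) _ (s≤s (s≤s (s≤s ()))) _ _ _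
  table (suc (suc (suc _))) _ (s≤s (s≤s (s≤s ()))) _ _ _ _

-- The class of q and the squares of a < 256 together

module ClassBounds (q N n s ℓ : ℕ) (q-prime : Prime q) (2∣N : 2 ∣ N) (2≤n : 2 ≤ n)
  (2^≤s : 128 * 2 ^ n ≤ s) (512≤s : 512 ≤ s) (s²≤N : s * s ≤ N) (N<s² : N < suc s * suc s)
  (N<2^ : N < 2 ^ ℓ) (ℓ≡ : ℓ ≡ 16 + 2 * n) where

  Y : ℕ
  Y = N / 128

  open Classes q N Y 2∣N

  N≥ : 262144 ≤ N
  N≥ = ≤-trans (*-mono-≤ 512≤s 512≤s) s²≤N

  Y≥ : 2048 ≤ Y
  Y≥ = /-monoˡ-≤ 128 N≥

  empty : ∀ {P : ℕ → Set} (P? : ∀ i → Dec (P i)) → (∀ i → ¬ P i) → primesIn P? N ≡ 1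
  empty P? ¬P = ∏-one (suc N) λ i _ → only-no {d = P? i} (¬P i)

  sieved : ∀ {P : ℕ → Set} (P? : ∀ i → Dec (P i)) {k w R} → (∀ i → P i → Base i) →
    Sieve k w → 6 ≤ k → InClass k R P → primesIn P? N ^ D ≤ 2 ^ cost N (k , w)
  sieved P? {k} {w} P⇒ S 6≤k class = subst (λ c → primesIn P? N ^ D ≤ 2 ^ c) (sym (cost≡ N k w))
    (sieve-bound P? S class 6≤k N≥ (λ i p → proj₂ (proj₂ (proj₂ (P⇒ i p)))))

  Qq : ℕ
  Qq = primesIn qClass? N

  Qa : ℕ → ℕ
  Qa a = primesIn (squareClass? a) N

  one^D≤ : ∀ {x} w → x ≡ 1 → x ^ D ≤ 2 ^ w
  one^D≤ w refl = ≤-trans (≤-reflexive (^-zeroˡ D)) (m^n>0 2 w)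

  6≤2l² : ∀ {a} → Prime a → 6 ≤ 2 * (a * a)
  6≤2l² pr = ≤-trans (≤ᵇ⇒≤ 6 8 tt) (*-monoʳ-≤ 2 (*-mono-≤ (prime≥2 pr) (prime≥2 pr)))

  plain-bound : ∀ a → a < 256 → Qa a ^ D ≤ 2 ^ cost N (plainEntries a)
  plain-bound a a<256 = by (oddPrime? a)
    where
    by : Dec (OddPrime a) → Qa a ^ D ≤ 2 ^ cost N (plainEntries a)
    by (no ¬odd)          = one^D≤ (cost N (plainEntries a)) (empty (squareClass? a) λ i p → ¬odd (proj₁ (proj₂ p)))
    by (yes odd@(pr , _)) = sieved (squareClass? a) {w = weight a} (λ i → proj₁)
      (sieve₂ {w = weight a} pr (onlyPrimes-2l² pr) (at-D _ (weight a) (pred a) (weight-correct a<256 odd)))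
      (6≤2l² pr) (squareClass-class odd)

  square-empty : Qa q ≡ 1
  square-empty = empty (squareClass? q) λ i (_ , _ , q²∣ , q∤) → q∤ (m*n∣⇒m∣ q q q²∣)

  q-bound : ∀ w → ¬ 2 ∣ q → 3 ≤ q → Sieve (2 * q) w → Qq ^ D ≤ 2 ^ cost N (2 * q , w)
  q-bound w ¬2∣q 3≤q S = sieved qClass? (λ i → proj₁) S (*-monoʳ-≤ 2 3≤q) (qClass-class ¬2∣q)

  -- `W` is the joint exponent of the class of `q` and of all `a < 256`; its bound has the same form
  -- for every `q`.
  Small : Set
  Small = ∃[ W ] ((Qq * ∏ 256 Qa) ^ D ≤ 2 ^ W × 1024 * W ≤ unitLimit * N + offsetLimit)

  combine : ∀ e Wq → Proper e → Qq ^ D ≤ 2 ^ Wq → (∀ a → a < 256 → Qa a ^ D ≤ 2 ^ cost N (e a)) →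
    (Qq * ∏ 256 Qa) ^ D ≤ 2 ^ (Wq + totalCost e N) ×
    1024 * (Wq + totalCost e N) ≤ 1024 * Wq + (totalUnit e 256 * N + totalOffset e 256)
  combine e Wq proper q≤ a≤ = (begin
    (Qq * ∏ 256 Qa) ^ D               ≡⟨ ^-distribʳ-* D Qq (∏ 256 Qa) ⟩
    Qq ^ D * ∏ 256 Qa ^ D             ≤⟨ *-mono-≤ q≤ (∏≤totalCost e N Qa a≤) ⟩
    2 ^ Wq * 2 ^ totalCost e N        ≡⟨ sym (^-distribˡ-+-* 2 Wq (totalCost e N)) ⟩
    2 ^ (Wq + totalCost e N)          ∎) ,
    ≤-trans (≤-reflexive (*-distribˡ-+ 1024 Wq (totalCost e N)))
      (+-monoʳ-≤ (1024 * Wq) (totalCost-bound e N proper))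
    where open ≤-Reasoning

  small-typed : ∀ e k w → 2 ≤ k → Proper e →
    totalUnit e 256 + unitCost (k , w) ≤ unitLimit × totalOffset e 256 + offsetCost (k , w) ≤ offsetLimit →
    Qq ^ D ≤ 2 ^ cost N (k , w) → (∀ a → a < 256 → Qa a ^ D ≤ 2 ^ cost N (e a)) → Small
  small-typed e k w 2≤k proper (units , offsets) q≤ a≤ = cost N (k , w) + totalCost e N , proj₁ combined , (begin
    1024 * (cost N (k , w) + totalCost e N)   ≤⟨ proj₂ combined ⟩
    1024 * cost N (k , w) + (U * N + V)       ≤⟨ +-monoˡ-≤ (U * N + V) (cost-bound N k w (inj₁ 2≤k)) ⟩
    (u * N + v) + (U * N + V)                 ≡⟨ regroup u v U V N ⟩
    (U + u) * N + (V + v)                     ≤⟨ +-mono-≤ (*-monoˡ-≤ N units) offsets ⟩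
    unitLimit * N + offsetLimit                      ∎)
    where
    open ≤-Reasoning
    combined = combine e (cost N (k , w)) proper q≤ a≤
    u v U V : ℕ
    u = unitCost (k , w)
    v = offsetCost (k , w)
    U = totalUnit e 256
    V = totalOffset e 256
    regroup : ∀ u v U V N → (u * N + v) + (U * N + V) ≡ (U + u) * N + (V + v)
    regroup = solve-∀

  small-other : ∀ Wq → 2 * Wq ≤ 21 * (N + 6 * s) → Qq ^ D ≤ 2 ^ Wq → Small
  small-other Wq Wq≤ q≤ = Wq + totalCost plainEntries N , proj₁ combined , (begin
    1024 * (Wq + totalCost plainEntries N)           ≤⟨ proj₂ combined ⟩
    1024 * Wq + (U * N + V)                          ≤⟨ +-monoˡ-≤ (U * N + V) Wq-part ⟩
    (512 * 21 + 21 * 6) * N + (U * N + V)            ≡⟨ collect (512 * 21 + 21 * 6) U V N ⟩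
    (512 * 21 + 21 * 6 + U) * N + V                  ≤⟨ +-mono-≤ (*-monoˡ-≤ N (proj₁ plain-totals)) (proj₂ plain-totals) ⟩
    unitLimit * N + offsetLimit                      ∎)
    where
    open ≤-Reasoning
    combined = combine plainEntries Wq plain-proper q≤ plain-bound
    U V : ℕ
    U = totalUnit plainEntries 256
    V = totalOffset plainEntries 256
    collect : ∀ c U V N → c * N + (U * N + V) ≡ (c + U) * N + V
    collect = solve-∀
    expand-cost : ∀ a b c N s → a * (b * (N + c * s)) ≡ a * b * N + b * c * (a * s)
    expand-cost = solve-∀
    Wq-part : 1024 * Wq ≤ (512 * 21 + 21 * 6) * N
    Wq-part = begin
      1024 * Wq                             ≡⟨ *-assoc 512 2 Wq ⟩
      512 * (2 * Wq)                        ≤⟨ *-monoʳ-≤ 512 Wq≤ ⟩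
      512 * (21 * (N + 6 * s))              ≡⟨ expand-cost 512 21 6 N s ⟩
      512 * 21 * N + 21 * 6 * (512 * s)     ≤⟨ +-monoʳ-≤ (512 * 21 * N) (*-monoʳ-≤ (21 * 6) (≤-trans (*-monoˡ-≤ s 512≤s) s²≤N)) ⟩
      512 * 21 * N + 21 * 6 * N             ≡⟨ sym (*-distribʳ-+ N (512 * 21) (21 * 6)) ⟩
      (512 * 21 + 21 * 6) * N               ∎

  q-empty⇒small : (∀ i → ¬ QClass i) → Small
  q-empty⇒small ¬Q = small-other 0 z≤n (one^D≤ 0 (empty qClass? ¬Q))

  -- When q = 3 ∤ N, a prime p with 3 ∤ N − p is ≡ − N modulo 3, so the class is one modulo 6 a².
  class-6a² : q ≡ 3 → ∀ {a} → Prime a → a ≢ 2 → a ≢ 3 → ∀ c → a * a ≡ 1 + 3 * c → ∀ v → ¬ 2 ∣ v →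
    (∀ d i → ¬ 3 ∣ d → ¬ 3 ∣ i → d + i ≡ N → 3 ∣ d + v) →
    InClass (6 * (a * a)) (N + a * a * v) (SquareClass a)
  class-6a² refl {a} ar a≢2 a≢3 c a²≡ v ¬2∣v 3∣ i (base@(pr , _ , i≤N , Y<i) , _ , a²∣ , 3∤N∸i) =
    pr , ≤-trans i≤N (m≤m+n N _) ,
    subst₂ _∣_ (sym (*-assoc 2 3 (a * a))) (sym (shift-∸ (a * a * v) i≤N))
      (∣-coprime-* 2⊥ 2∣y (∣-coprime-* 3⊥ 3∣y a²∣y))
    where
    y : ℕ
    y = (N ∸ i) + a * a * v
    3∤i : ¬ 3 ∣ i
    3∤i 3∣i = <⇒≱ Y<i (subst (_≤ Y) (prime∣prime prime[3] pr 3∣i) (≤-trans (≤ᵇ⇒≤ 3 2048 tt) Y≥))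
    ¬2∣a : ¬ 2 ∣ a
    ¬2∣a = odd-prime ar a≢2
    3∤a : ¬ 3 ∣ a
    3∤a 3∣a = a≢3 (sym (prime∣prime prime[3] ar 3∣a))
    2∣y : 2 ∣ y
    2∣y = odd+odd (base-odd base) (odd-* (odd-* ¬2∣a ¬2∣a) ¬2∣v)
    3∣y : 3 ∣ y
    3∣y = subst (3 ∣_) (trans (regroup (N ∸ i) v c) (cong (λ x → (N ∸ i) + x * v) (sym a²≡)))
      (∣m∣n⇒∣m+n (3∣ (N ∸ i) i 3∤N∸i 3∤i (m∸n+n≡m i≤N)) (m∣m*n (c * v)))
      where
      regroup : ∀ d v c → (d + v) + 3 * (c * v) ≡ d + (1 + 3 * c) * v
      regroup = solve-∀
    a²∣y : a * a ∣ y
    a²∣y = ∣m∣n⇒∣m+n a²∣ (m∣m*n v)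
    3⊥ : Coprime 3 (a * a)
    3⊥ = coprime-sym (coprime-* (coprime-sym (prime∤⇒coprime prime[3] 3∤a)) (coprime-sym (prime∤⇒coprime prime[3] 3∤a)))
    2⊥ : Coprime 2 (3 * (a * a))
    2⊥ = prime∤⇒coprime prime[2] (odd-* (λ 2∣3 → contradiction (prime∣prime prime[2] prime[3] 2∣3) λ ()) (odd-* ¬2∣a ¬2∣a))

  -- The multiple `a * a * v` added to `N` must be odd, and `≡ v` modulo 3 by `a * a ≡ 1`. So `v` is
  -- 1 or 5 according to `N % 3`.
  class-mod-6a² : q ≡ 3 → ¬ 3 ∣ N → ∀ {a} → Prime a → a ≢ 2 → a ≢ 3 → ∀ c → a * a ≡ 1 + 3 * c →
    ∃[ R ] InClass (6 * (a * a)) R (SquareClass a)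
  class-mod-6a² q≡3 3∤N {a} ar a≢2 a≢3 c a²≡ = by (N % 3) refl (m%n<n N 3)
    where
    by : ∀ r → N % 3 ≡ r → r < 3 → ∃[ R ] InClass (6 * (a * a)) R (SquareClass a)
    by 0 eq _ = contradiction (m%n≡0⇒n∣m N 3 eq) 3∤N
    by 1 eq _ = N + a * a * 1 , class-6a² q≡3 ar a≢2 a≢3 c a²≡ 1
      (λ 2∣1 → contradiction (∣1⇒≡1 2∣1) λ ())
      (λ d i 3∤d 3∤i d+i≡N → 3∣-lemma₁ d i 3∤d 3∤i (trans (cong (_% 3) d+i≡N) eq))
    by 2 eq _ = N + a * a * 5 , class-6a² q≡3 ar a≢2 a≢3 c a²≡ 5
      (λ 2∣5 → contradiction (prime∣prime prime[2] prime[5] 2∣5) λ ())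
      (λ d i 3∤d 3∤i d+i≡N → 3∣-lemma₂ d i 3∤d 3∤i (trans (cong (_% 3) d+i≡N) eq))
    by (suc (suc (suc _))) _ (s≤s (s≤s (s≤s ())))

  P : ℕ → ℕ × ℕ → Set
  P a x = a < 256 → Qa a ^ D ≤ 2 ^ cost N x

  at-q : ∀ {b x} → b ≡ q → P b x
  at-q {x = x} refl _ = one^D≤ (cost N x) square-empty

  small-at-3 : q ≡ 3 → ¬ 3 ∣ N → Small
  small-at-3 q≡3 3∤N = small-typed entries₃ 6 141 (s≤s (s≤s z≤n)) proper₃ totals₃
    (subst (λ k → Qq ^ D ≤ 2 ^ cost N (k , 141)) (cong (2 *_) q≡3) (q-bound 141
      (subst (λ q → ¬ 2 ∣ q) (sym q≡3) (odd-prime prime[3] λ ())) (≤-reflexive (sym q≡3))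
      (subst (λ q → Sieve (2 * q) 141) (sym q≡3) (sieve₂ prime[3] (onlyPrimes-2l prime[3]) (at-D _ 141 2 smallQ₃)))))
    (set-elim P 3 (6 , 0) (at-q (sym q≡3)) (set-elim P 5 (150 , 308) (λ _ → bound₅)
      (set-elim P 7 (294 , 335) (λ _ → bound₇) plain-bound)))
    where
    bound₅ : Qa 5 ^ D ≤ 2 ^ cost N (150 , 308)
    bound₅ = sieved (squareClass? 5) (λ i → proj₁) (sieve₃ {e = 2} prime[5] refl (at-D _ 308 4 small₅))
      (≤ᵇ⇒≤ 6 150 tt) (proj₂ (class-mod-6a² q≡3 3∤N prime[5] (λ ()) (λ ()) 8 refl))
    bound₇ : Qa 7 ^ D ≤ 2 ^ cost N (294 , 335)
    bound₇ = sieved (squareClass? 7) (λ i → proj₁) (sieve₃ {e = 3} prime[7] refl (at-D _ 335 6 small₇))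
      (≤ᵇ⇒≤ 6 294 tt) (proj₂ (class-mod-6a² q≡3 3∤N prime[7] (λ ()) (λ ()) 16 refl))

  small-at-5 : q ≡ 5 → Small
  small-at-5 q≡5 = small-typed entries₅ 10 157 (s≤s (s≤s z≤n)) proper₅ totals₅
    (subst (λ k → Qq ^ D ≤ 2 ^ cost N (k , 157)) (cong (2 *_) q≡5) (q-bound 157
      (subst (λ q → ¬ 2 ∣ q) (sym q≡5) (odd-prime prime[5] λ ())) (subst (3 ≤_) (sym q≡5) (≤ᵇ⇒≤ 3 5 tt))
      (subst (λ q → Sieve (2 * q) 157) (sym q≡5) (sieve₂ prime[5] (onlyPrimes-2l prime[5]) (at-D _ 157 4 smallQ₅)))))
    (set-elim P 5 (6 , 0) (at-q (sym q≡5)) plain-bound)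

  small-at-7 : q ≡ 7 → Small
  small-at-7 q≡7 = small-typed entries₇ 14 169 (s≤s (s≤s z≤n)) proper₇ totals₇
    (subst (λ k → Qq ^ D ≤ 2 ^ cost N (k , 169)) (cong (2 *_) q≡7) (q-bound 169
      (subst (λ q → ¬ 2 ∣ q) (sym q≡7) (odd-prime prime[7] λ ())) (subst (3 ≤_) (sym q≡7) (≤ᵇ⇒≤ 3 7 tt))
      (subst (λ q → Sieve (2 * q) 169) (sym q≡7) (sieve₂ prime[7] (onlyPrimes-2l prime[7]) (at-D _ 169 6 smallQ₇)))))
    (set-elim P 7 (6 , 0) (at-q (sym q≡7)) plain-bound)

  instance
    q≢0 : NonZero q
    q≢0 = prime⇒nonZero q-prime

  q≤pred[2q] : q ≤ pred (2 * q)
  q≤pred[2q] = begin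
    q                           ≡⟨ sym (suc-pred q) ⟩
    suc (pred q)                ≤⟨ s≤s (m≤n+m (pred q) (pred q)) ⟩
    suc (pred q + pred q)       ≡⟨ cong pred (double (pred q)) ⟩
    pred (2 * suc (pred q))     ≡⟨ cong (λ q → pred (2 * q)) (suc-pred q) ⟩
    pred (2 * q)                ∎
    where
    open ≤-Reasoning
    double : ∀ p → suc (suc (p + p)) ≡ 2 * suc p
    double = solve-∀

  -- A term has weight at most `20 * q`, and the number of terms times `2 * q − 1` is at most
  -- `N + 6 * q`. From 11 on, `40 * q ≤ 21 * (2 * q − 1)`.
  small-q≤s : 11 ≤ q → q ≤ s → ¬ 2 ∣ q → Small
  small-q≤s 11≤q q≤s ¬2∣q = small-other (cost N (2 * q , 20 * q)) (begin
    2 * cost N (2 * q , 20 * q)  ≡⟨ cong (2 *_) (cost≡ N (2 * q) (20 * q)) ⟩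
    2 * (20 * q * τ)             ≡⟨ sym (*-assoc 2 (20 * q) τ) ⟩
    2 * (20 * q) * τ             ≤⟨ *-monoˡ-≤ τ coefficient ⟩
    21 * pred (2 * q) * τ        ≡⟨ *-assoc 21 (pred (2 * q)) τ ⟩
    21 * (pred (2 * q) * τ)      ≤⟨ *-monoʳ-≤ 21 (levels-bound (2 * q) N {{m*n≢0 2 q}}) ⟩
    21 * (N + 3 * (2 * q))       ≡⟨ cong (λ x → 21 * (N + x)) (sym (*-assoc 3 2 q)) ⟩
    21 * (N + 6 * q)             ≤⟨ *-monoʳ-≤ 21 (+-monoʳ-≤ N (*-monoʳ-≤ 6 q≤s)) ⟩
    21 * (N + 6 * s)             ∎)
    (q-bound (20 * q) ¬2∣q (≤-trans (≤ᵇ⇒≤ 3 11 tt) 11≤q)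
      (coarseSieve q-prime (onlyPrimes-2l q-prime) (coarse-weight 11≤q)))
    where
    open ≤-Reasoning
    τ : ℕ
    τ = levels (2 * q) N
    coefficient : 2 * (20 * q) ≤ 21 * pred (2 * q)
    coefficient = +-cancelʳ-≤ 21 _ _ (begin
      2 * (20 * q) + 21               ≤⟨ +-monoʳ-≤ (2 * (20 * q)) (≤-trans (≤ᵇ⇒≤ 21 22 tt) (*-monoʳ-≤ 2 11≤q)) ⟩
      2 * (20 * q) + 2 * q            ≡⟨ collect q ⟩
      21 * (2 * q)                    ≡⟨ cong (21 *_) (sym (suc-pred (2 * q) {{m*n≢0 2 q}})) ⟩
      21 * suc (pred (2 * q))         ≡⟨ trans (*-suc 21 (pred (2 * q))) (+-comm 21 _) ⟩
      21 * pred (2 * q) + 21          ∎)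
      where
      collect : ∀ q → 2 * (20 * q) + 2 * q ≡ 21 * (2 * q)
      collect = solve-∀

  -- Beyond √N there are at most `s + 7` terms to charge. Even `3 + ℓ` bits for each of them give
  -- only a cost of order √N log N, well inside the allowance.
  small-q>s : s < q → q < N → ¬ 2 ∣ q → Small
  small-q>s s<q q<N ¬2∣q = small-other (cost N (2 * q , (3 + ℓ) * D)) (begin
    2 * cost N (2 * q , (3 + ℓ) * D)        ≡⟨ cong (2 *_) (cost≡ N (2 * q) ((3 + ℓ) * D)) ⟩
    2 * ((3 + ℓ) * D * τ)                   ≤⟨ *-monoʳ-≤ 2 (*-mono-≤ (*-mono-≤ 3+ℓ≤ (≤-reflexive D≡32)) τ≤) ⟩
    2 * (6 * 2 ^ n * 32 * (s + 7))          ≡⟨ regroup (2 ^ n) s ⟩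
    3 * (128 * 2 ^ n) * (s + 7)             ≤⟨ *-mono-≤ (*-monoʳ-≤ 3 2^≤s) (+-monoʳ-≤ s (≤-trans (≤ᵇ⇒≤ 7 512 tt) 512≤s)) ⟩
    3 * s * (s + s)                         ≡⟨ regroup′ s ⟩
    6 * (s * s)                             ≤⟨ *-mono-≤ (≤ᵇ⇒≤ 6 21 tt) (≤-trans s²≤N (m≤m+n N (6 * s))) ⟩
    21 * (N + 6 * s)                        ∎)
    (q-bound ((3 + ℓ) * D) ¬2∣q (≤-trans (≤ᵇ⇒≤ 3 512 tt) (≤-trans 512≤s (<⇒≤ s<q)))
      (coarseSieve q-prime (onlyPrimes-2l q-prime) coarse))
    where
    open ≤-Reasoning
    τ : ℕ
    τ = levels (2 * q) N
    regroup : ∀ p s → 2 * (6 * p * 32 * (s + 7)) ≡ 3 * (128 * p) * (s + 7)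
    regroup = solve-∀
    regroup′ : ∀ s → 3 * s * (s + s) ≡ 6 * (s * s)
    regroup′ = solve-∀
    3+ℓ≤ : 3 + ℓ ≤ 6 * 2 ^ n
    3+ℓ≤ = subst (λ l → 3 + l ≤ 6 * 2 ^ n) (sym ℓ≡) (linear≤power 2≤n)
    τ≤ : τ ≤ s + 7
    τ≤ = *-cancelˡ-≤ q (begin
      q * τ                           ≤⟨ *-monoˡ-≤ τ q≤pred[2q] ⟩
      pred (2 * q) * τ                ≤⟨ levels-bound (2 * q) N {{m*n≢0 2 q}} ⟩
      N + 3 * (2 * q)                 ≤⟨ +-monoˡ-≤ _ (≤-trans (<⇒≤ N<s²) (*-monoˡ-≤ (suc s) s<q)) ⟩
      q * suc s + 3 * (2 * q)         ≡⟨ collect q s ⟩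
      q * (s + 7)                     ∎)
      where
      collect : ∀ q s → q * suc s + 3 * (2 * q) ≡ q * (s + 7)
      collect = solve-∀
    coarse : (4 * (2 * q)) ^ D ≤ 2 ^ ((3 + ℓ) * D)
    coarse = begin
      (4 * (2 * q)) ^ D          ≡⟨ cong (_^ D) (sym (*-assoc 4 2 q)) ⟩
      (2 ^ 3 * q) ^ D            ≤⟨ ^-monoˡ-≤ D (*-monoʳ-≤ (2 ^ 3) (≤-trans (<⇒≤ q<N) (<⇒≤ N<2^))) ⟩
      (2 ^ 3 * 2 ^ ℓ) ^ D        ≡⟨ cong (_^ D) (sym (^-distribˡ-+-* 2 3 ℓ)) ⟩
      (2 ^ (3 + ℓ)) ^ D          ≡⟨ ^-*-assoc 2 (3 + ℓ) D ⟩
      2 ^ ((3 + ℓ) * D)          ∎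

  q≥N⇒empty : N ≤ q → ∀ i → ¬ QClass i
  q≥N⇒empty N≤q i ((pr , i≢2 , i≤N , _) , q∣) = <⇒≱ x<N (≤-trans N≤q (∣⇒≤ {{>-nonZero x>0}} q∣))
    where
    i<N : i < N
    i<N = ≤∧≢⇒< i≤N λ { refl → odd-prime pr i≢2 2∣N }
    x>0 : 0 < N ∸ i
    x>0 = m<n⇒0<n∸m i<N
    x<N : N ∸ i < N
    x<N = ∸-monoʳ-< (≤-trans (s≤s z≤n) (prime≥2 pr)) i≤N

  small : Small
  small = by-size (q <? 11)
    where
    by-3 : q ≡ 3 → Dec (3 ∣ N) → Small
    by-3 q≡3 (no 3∤N)  = small-at-3 q≡3 3∤N
    -- If 3 divides both `N` and `N ∸ i`, then `i` is 3, which lies below `Y`.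
    by-3 q≡3 (yes 3∣N) = q-empty⇒small λ i ((pr , _ , i≤N , Y<i) , q∣) → <⇒≱ Y<i
      (subst (_≤ Y) (prime∣prime prime[3] pr (∣m+n∣m⇒∣n (subst (3 ∣_) (sym (m∸n+n≡m i≤N)) 3∣N) (subst (_∣ N ∸ i) q≡3 q∣)))
        (≤-trans (≤ᵇ⇒≤ 3 2048 tt) Y≥))
    by-value : q ≡ 2 ⊎ q ≡ 3 ⊎ q ≡ 5 ⊎ q ≡ 7 → Small
    by-value (inj₁ q≡2)               = q-empty⇒small λ i (base , q∣) → base-odd base (subst (_∣ N ∸ i) q≡2 q∣)
    by-value (inj₂ (inj₁ q≡3))        = by-3 q≡3 (3 ∣? N)
    by-value (inj₂ (inj₂ (inj₁ q≡5))) = small-at-5 q≡5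
    by-value (inj₂ (inj₂ (inj₂ q≡7))) = small-at-7 q≡7
    ≢2 : ∀ {x} → 11 ≤ x → x ≢ 2
    ≢2 (s≤s (s≤s ())) refl
    by-range : 11 ≤ q → Dec (q ≤ s) → Dec (q < N) → Small
    by-range 11≤q (yes q≤s) _         = small-q≤s 11≤q q≤s (odd-prime q-prime (≢2 11≤q))
    by-range 11≤q (no q≰s)  (yes q<N) = small-q>s (≰⇒> q≰s) q<N (odd-prime q-prime (≢2 11≤q))
    by-range 11≤q (no _)    (no q≮N)  = q-empty⇒small (q≥N⇒empty (≮⇒≥ q≮N))
    by-size : Dec (q < 11) → Small
    by-size (yes q<11) = by-value (prime<11 q<11 q-prime)
    by-size (no q≮11)  = by-range (≮⇒≥ q≮11) (q ≤? s) (q <? N)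

-- Prime squares a² with a ≥ 256, in dyadic blocks

∏-pairs : ∀ h f → ∏ (2 * h) f ≡ ∏ h (λ i → f (2 * i) * f (suc (2 * i)))
∏-pairs zero    f = refl
∏-pairs (suc h) f = trans (cong (λ k → ∏ k f) (*-suc 2 h))
  (trans (*-assoc (∏ (2 * h) f) (f (2 * h)) (f (suc (2 * h))))
         (cong (_* (f (2 * h) * f (suc (2 * h)))) (∏-pairs h f)))

∏-^D≤ : ∀ h f B → (∀ i → i < h → f i ^ D ≤ 2 ^ B) → ∏ h f ^ D ≤ 2 ^ (h * B)
∏-^D≤ zero    f B f≤ = ≤-reflexive (^-zeroˡ D)
∏-^D≤ (suc h) f B f≤ = begin
  (∏ h f * f h) ^ D       ≡⟨ ^-distribʳ-* D (∏ h f) (f h) ⟩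
  ∏ h f ^ D * f h ^ D     ≤⟨ *-mono-≤ (∏-^D≤ h f B (λ i i<h → f≤ i (m<n⇒m<1+n i<h))) (f≤ h ≤-refl) ⟩
  2 ^ (h * B) * 2 ^ B     ≡⟨ sym (^-distribˡ-+-* 2 (h * B) B) ⟩
  2 ^ (h * B + B)         ≡⟨ cong (2 ^_) (+-comm (h * B) B) ⟩
  2 ^ (suc h * B)         ∎
  where open ≤-Reasoning

module Dyadic (Q : ℕ → ℕ) (B : ℕ → ℕ) (k : ℕ) (Q-even : ∀ i → Q (2 * i) ≡ 1)
  (Q≤ : ∀ m a → 2 ^ (suc k + m) ≤ a → a < 2 ^ suc (suc k + m) → Q a ^ D ≤ 2 ^ B m) where

  -- Even arguments contribute 1, so pairing neighbours leaves half the length of the block as the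
  -- number of factors.
  dyadic-block : ∀ m → ∏ (2 ^ (suc k + m)) (λ i → Q (2 ^ (suc k + m) + i)) ^ D ≤ 2 ^ (2 ^ (k + m) * B m)
  dyadic-block m = begin
    ∏ (2 * h) (λ i → Q (2 * h + i)) ^ D
      ≡⟨ cong (_^ D) (trans (∏-pairs h (λ i → Q (2 * h + i))) (∏-cong h even-part)) ⟩
    ∏ h (λ i → Q (2 * h + suc (2 * i))) ^ D
      ≤⟨ ∏-^D≤ h _ (B m) (λ i i<h → Q≤ m (2 * h + suc (2 * i)) (m≤m+n (2 * h) (suc (2 * i))) (upper i i<h)) ⟩
    2 ^ (h * B m) ∎
    where
    open ≤-Reasoning
    h : ℕ
    h = 2 ^ (k + m)
    even-part : ∀ i → i < h → Q (2 * h + 2 * i) * Q (2 * h + suc (2 * i)) ≡ Q (2 * h + suc (2 * i))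
    even-part i _ = trans (cong (_* Q (2 * h + suc (2 * i)))
      (trans (cong Q (sym (*-distribˡ-+ 2 h i))) (Q-even (h + i)))) (*-identityˡ _)
    upper : ∀ i → i < h → 2 * h + suc (2 * i) < 2 * (2 * h)
    upper i i<h = begin-strict
      2 * h + suc (2 * i)     <⟨ +-monoʳ-< (2 * h) (subst (suc (2 * i) <_) (sym (*-suc 2 i)) ≤-refl) ⟩
      2 * h + 2 * suc i       ≤⟨ +-monoʳ-≤ (2 * h) (*-monoʳ-≤ 2 i<h) ⟩
      2 * h + 2 * h           ≡⟨ cong (2 * h +_) (sym (+-identityʳ (2 * h))) ⟩
      2 * (2 * h)             ∎

  dyadic : ∀ n → ∏ (2 ^ (suc k + n)) Q ^ D ≤ ∏ (2 ^ suc k) Q ^ D * 2 ^ ∑ n (λ m → 2 ^ (k + m) * B m)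
  dyadic zero    = ≤-reflexive (trans (cong (λ j → ∏ (2 ^ suc j) Q ^ D) (+-identityʳ k)) (sym (*-identityʳ _)))
  dyadic (suc n) = begin
    ∏ (2 ^ (suc k + suc n)) Q ^ D         ≡⟨ cong (λ l → ∏ l Q ^ D) (trans (cong (λ j → 2 ^ suc j) (+-suc k n)) (cong (j +_) (+-identityʳ j))) ⟩
    ∏ (j + j) Q ^ D                       ≡⟨ cong (_^ D) (∏-split j j Q) ⟩
    (∏ j Q * ∏ j (λ i → Q (j + i))) ^ D   ≡⟨ ^-distribʳ-* D (∏ j Q) _ ⟩
    ∏ j Q ^ D * ∏ j (λ i → Q (j + i)) ^ D ≤⟨ *-mono-≤ (dyadic n) (dyadic-block n) ⟩
    P * 2 ^ S * 2 ^ (2 ^ (k + n) * B n)   ≡⟨ *-assoc P (2 ^ S) _ ⟩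
    P * (2 ^ S * 2 ^ (2 ^ (k + n) * B n)) ≡⟨ cong (P *_) (sym (^-distribˡ-+-* 2 S (2 ^ (k + n) * B n))) ⟩
    P * 2 ^ (S + 2 ^ (k + n) * B n)       ∎
    where
    open ≤-Reasoning
    j P S : ℕ
    j = 2 ^ (suc k + n)
    P = ∏ (2 ^ suc k) Q ^ D
    S = ∑ n (λ m → 2 ^ (k + m) * B m)

-- ∑ (2 j + 5) / 2 ^ (j + 2) telescopes as the differences of (2 j + 7) / 2 ^ (j + 1).
tail-sum : ∀ (a l N : ℕ) (F : ℕ → ℕ) → (∀ m → 2 * (a * l) * (2 ^ m * 2 ^ m) * F m ≤ N) → ∀ n →
  a * ∑ n (λ m → l * 2 ^ m * ((21 + 2 * m) * suc (F m))) ≤ 23 * N + a * (l * 2 ^ n * (17 + 2 * n))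
tail-sum a l N F F≤ n = *-cancelˡ-≤ (2 ^ n) {{m^n≢0 2 n}} (begin
  2 ^ n * (a * E n)                          ≡⟨ pre (2 ^ n) a (E n) ⟩
  a * 2 ^ n * E n                            ≤⟨ m≤m+n (a * 2 ^ n * E n) ((23 + 2 * n) * N) ⟩
  a * 2 ^ n * E n + (23 + 2 * n) * N         ≤⟨ invariant n ⟩
  23 * (2 ^ n * N) + a * l * (2 ^ n * 2 ^ n) * (17 + 2 * n)  ≡⟨ post a l N (2 ^ n) n ⟩
  2 ^ n * (23 * N + a * (l * 2 ^ n * (17 + 2 * n)))          ∎)
  where
  open ≤-Reasoning
  E : ℕ → ℕ
  E n = ∑ n (λ m → l * 2 ^ m * ((21 + 2 * m) * suc (F m)))
  pre : ∀ c a e → c * (a * e) ≡ a * c * e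
  pre = solve-∀
  post : ∀ a l N c n → 23 * (c * N) + a * l * (c * c) * (17 + 2 * n) ≡ c * (23 * N + a * (l * c * (17 + 2 * n)))
  post = solve-∀
  split : ∀ a l N c e n f →
    a * (2 * c) * (e + l * c * ((21 + 2 * n) * suc f)) + (23 + 2 * suc n) * N ≡
    2 * (a * c * e) + (21 + 2 * n) * (2 * (a * l) * (c * c) * f) + (2 * (a * l * (c * c) * (21 + 2 * n)) + (23 + 2 * suc n) * N)
  split = solve-∀
  merge : ∀ a l N c e n →
    2 * (a * c * e) + (21 + 2 * n) * N + (2 * (a * l * (c * c) * (21 + 2 * n)) + (23 + 2 * suc n) * N) ≡
    2 * (a * c * e + (23 + 2 * n) * N) + 2 * (a * l * (c * c) * (21 + 2 * n))
  merge = solve-∀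
  final : ∀ a l N c n →
    2 * (23 * (c * N) + a * l * (c * c) * (17 + 2 * n)) + 2 * (a * l * (c * c) * (21 + 2 * n)) ≡
    23 * (2 * c * N) + a * l * (2 * c * (2 * c)) * (17 + 2 * suc n)
  final = solve-∀
  invariant : ∀ n → a * 2 ^ n * E n + (23 + 2 * n) * N ≤ 23 * (2 ^ n * N) + a * l * (2 ^ n * 2 ^ n) * (17 + 2 * n)
  invariant zero    = ≤-trans (≤-reflexive (start′ a N)) (m≤m+n (23 * (1 * N)) (a * l * (1 * 1) * 17))
    where
    start′ : ∀ a N → a * 1 * 0 + 23 * N ≡ 23 * (1 * N)
    start′ = solve-∀
  invariant (suc n) = begin
    a * (2 * c) * E (suc n) + (23 + 2 * suc n) * N    ≡⟨ split a l N c (E n) n (F n) ⟩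
    2 * (a * c * E n) + (21 + 2 * n) * (2 * (a * l) * (c * c) * F n) + rest
      ≤⟨ +-monoˡ-≤ rest (+-monoʳ-≤ (2 * (a * c * E n)) (*-monoʳ-≤ (21 + 2 * n) (F≤ n))) ⟩
    2 * (a * c * E n) + (21 + 2 * n) * N + rest       ≡⟨ merge a l N c (E n) n ⟩
    2 * (a * c * E n + (23 + 2 * n) * N) + 2 * (a * l * (c * c) * (21 + 2 * n))
      ≤⟨ +-monoˡ-≤ (2 * (a * l * (c * c) * (21 + 2 * n))) (*-monoʳ-≤ 2 (invariant n)) ⟩
    2 * (23 * (c * N) + a * l * (c * c) * (17 + 2 * n)) + 2 * (a * l * (c * c) * (21 + 2 * n))
      ≡⟨ final a l N c n ⟩
    23 * (2 * c * N) + a * l * (2 * c * (2 * c)) * (17 + 2 * suc n) ∎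
    where
    c rest : ℕ
    c = 2 ^ n
    rest = 2 * (a * l * (c * c) * (21 + 2 * n)) + (23 + 2 * suc n) * N

-- The margin left by the weights, which needs s ≥ 512

-- Equality holds at `n = 2`, where `33 + 4 * n` is 41.
linear≤power′ : ∀ n → 2 ≤ n → 4 * (33 + 4 * n) ≤ 41 * 2 ^ n
linear≤power′ n 2≤n = subst (λ n → 4 * (33 + 4 * n) ≤ 41 * 2 ^ n) {x = 2 + (n ∸ 2)} {y = n} (m+[n∸m]≡n 2≤n) (by (n ∸ 2))
  where
  open ≤-Reasoning
  by : ∀ m → 4 * (33 + 4 * (2 + m)) ≤ 41 * 2 ^ (2 + m)
  by zero    = ≤-refl
  by (suc m) = begin
    4 * (33 + 4 * (2 + suc m))          ≡⟨ step m ⟩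
    4 * (33 + 4 * (2 + m)) + 16         ≤⟨ +-mono-≤ (by m) (*-mono-≤ (≤ᵇ⇒≤ 16 41 tt) (m^n>0 2 (2 + m))) ⟩
    41 * 2 ^ (2 + m) + 41 * 2 ^ (2 + m) ≡⟨ double (2 ^ (2 + m)) ⟩
    41 * 2 ^ (2 + suc m)                ∎
    where
    step : ∀ m → 4 * (33 + 4 * (2 + suc m)) ≡ 4 * (33 + 4 * (2 + m)) + 16
    step = solve-∀
    double : ∀ x → 41 * x + 41 * x ≡ 41 * (2 * x)
    double = solve-∀

-- Numerals are kept abstract, since products of large numerals with neutral terms unfold in unary.
module MarginArithmetic
  (K a b c t e f g y z w r p o τ h i R j k l : ℕ)
  (K*a≡ : K * a ≡ e * f) (K*b≡ : K * b ≡ y * z) (K≡ : K ≡ w * r) (τ≡ : R + (e * g + y + w * p) ≡ τ)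
  (τ*h≡ : τ * h ≡ K * t) (f≡ : f ≡ z * 4) (linear : e * j ≤ k * f)
  (constant : K * c + w * o + τ * i ≤ l * (f * f)) (slack : e * j + k + l < R) (1≤f : 1 ≤ f)
  (m N s u v c₂ X Y W E : ℕ) (X+su≡ : X + s * u ≡ v * suc s)
  (4v≤ : 4 * v ≤ j * c₂) (zc₂≤s : z * c₂ ≤ s) (f≤s : f ≤ s) (s²≤N : s * s ≤ N)
  (N≤ : N ≤ h * m + i) (Y≤ : z * Y ≤ N) (E≤ : f * E ≤ g * N + f * (s * u)) (W≤ : r * W ≤ p * N + o)
  (total : t * m ≤ a * (X + E) + (b * Y + c) + W) where

  open ≤-Reasoning

  distrib : ∀ k a b x y → k * (a * x + b * y) ≡ k * a * x + k * b * y
  distrib = solve-∀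
  distrib₁ : ∀ k a b x → k * (a * x + b) ≡ k * a * x + k * b
  distrib₁ = solve-∀

  E-part : K * a * E ≤ e * g * N + K * a * (s * u)
  E-part = begin
    K * a * E                           ≡⟨ cong (_* E) K*a≡ ⟩
    e * f * E                           ≡⟨ *-assoc e f E ⟩
    e * (f * E)                         ≤⟨ *-monoʳ-≤ e E≤ ⟩
    e * (g * N + f * (s * u))           ≡⟨ distrib e g f N (s * u) ⟩
    e * g * N + e * f * (s * u)         ≡⟨ cong (λ k → e * g * N + k * (s * u)) (sym K*a≡) ⟩
    e * g * N + K * a * (s * u)         ∎

  Y-part : K * b * Y ≤ y * N
  Y-part = begin
    K * b * Y     ≡⟨ cong (_* Y) K*b≡ ⟩
    y * z * Y     ≡⟨ *-assoc y z Y ⟩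
    y * (z * Y)   ≤⟨ *-monoʳ-≤ y Y≤ ⟩
    y * N         ∎

  W-part : K * W ≤ w * p * N + w * o
  W-part = begin
    K * W               ≡⟨ cong (_* W) K≡ ⟩
    w * r * W           ≡⟨ *-assoc w r W ⟩
    w * (r * W)         ≤⟨ *-monoʳ-≤ w W≤ ⟩
    w * (p * N + o)     ≡⟨ distrib₁ w p o N ⟩
    w * p * N + w * o   ∎

  large-terms : K * (t * m) ≤ e * f * (v * suc s) + (e * g + y + w * p) * N + (K * c + w * o)
  large-terms = begin
    K * (t * m)
      ≤⟨ *-monoʳ-≤ K total ⟩
    K * (a * (X + E) + (b * Y + c) + W)
      ≡⟨ split K a b c X E Y W ⟩
    K * a * X + K * a * E + K * b * Y + K * c + K * W
      ≤⟨ +-mono-≤ (+-monoˡ-≤ (K * c) (+-mono-≤ (+-monoʳ-≤ (K * a * X) E-part) Y-part)) W-part ⟩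
    K * a * X + (e * g * N + K * a * (s * u)) + y * N + K * c + (w * p * N + w * o)
      ≡⟨ merge (K * a) (e * g) y (w * p) (K * c) (w * o) X (s * u) N ⟩
    K * a * (X + s * u) + (e * g + y + w * p) * N + (K * c + w * o)
      ≡⟨ cong₂ (λ k x → k * x + (e * g + y + w * p) * N + (K * c + w * o)) K*a≡ X+su≡ ⟩
    e * f * (v * suc s) + (e * g + y + w * p) * N + (K * c + w * o) ∎
    where
    split : ∀ k a b c X E Y W → k * (a * (X + E) + (b * Y + c) + W) ≡ k * a * X + k * a * E + k * b * Y + k * c + k * W
    split = solve-∀
    merge : ∀ k a b c d e X y N → k * X + (a * N + k * y) + b * N + d + (c * N + e) ≡ k * (X + y) + (a + b + c) * N + (d + e)
    merge = solve-∀

  reduced : R * N ≤ e * (f * (v * suc s)) + (K * c + w * o + τ * i)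
  reduced = +-cancelʳ-≤ ((e * g + y + w * p) * N) _ _ (begin
    R * N + (e * g + y + w * p) * N          ≡⟨ sym (*-distribʳ-+ N R (e * g + y + w * p)) ⟩
    (R + (e * g + y + w * p)) * N            ≡⟨ cong (_* N) τ≡ ⟩
    τ * N                                    ≤⟨ *-monoʳ-≤ τ N≤ ⟩
    τ * (h * m + i)                          ≡⟨ distrib₁ τ h i m ⟩
    τ * h * m + τ * i                        ≡⟨ cong (_+ τ * i) (trans (cong (_* m) τ*h≡) (*-assoc K t m)) ⟩
    K * (t * m) + τ * i                      ≤⟨ +-monoˡ-≤ (τ * i) large-terms ⟩
    e * f * (v * suc s) + (e * g + y + w * p) * N + (K * c + w * o) + τ * i
      ≡⟨ merge e f (v * suc s) ((e * g + y + w * p) * N) (K * c + w * o) (τ * i) ⟩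
    e * (f * (v * suc s)) + (K * c + w * o + τ * i) + (e * g + y + w * p) * N ∎)
    where
    merge : ∀ a b x y c d → a * b * x + y + c + d ≡ a * (b * x) + (c + d) + y
    merge = solve-∀

  -- These are the terms of order √N log N. The logarithmic `v` is exchanged for `c₂`, a fixed
  -- fraction of √N, which makes them a small multiple of `s * suc s`.
  slope : f * (v * suc s) ≤ j * (s * suc s)
  slope = begin
    f * (v * suc s)          ≡⟨ cong (_* (v * suc s)) f≡ ⟩
    z * 4 * (v * suc s)      ≡⟨ regroup z v (suc s) ⟩
    z * (4 * v) * suc s      ≤⟨ *-monoˡ-≤ (suc s) (*-monoʳ-≤ z 4v≤) ⟩
    z * (j * c₂) * suc s     ≡⟨ regroup′ z j c₂ (suc s) ⟩
    j * (z * c₂ * suc s)     ≤⟨ *-monoʳ-≤ j (*-monoˡ-≤ (suc s) zc₂≤s) ⟩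
    j * (s * suc s)          ∎
    where
    regroup : ∀ a v x → a * 4 * (v * x) ≡ a * (4 * v) * x
    regroup = solve-∀
    regroup′ : ∀ a b c x → a * (b * c) * x ≡ b * (a * c * x)
    regroup′ = solve-∀

  upper : R * (s * s) ≤ (e * j + k + l) * (s * s)
  upper = begin
    R * (s * s)                                                 ≤⟨ *-monoʳ-≤ R s²≤N ⟩
    R * N                                                       ≤⟨ reduced ⟩
    e * (f * (v * suc s)) + (K * c + w * o + τ * i)             ≤⟨ +-mono-≤ (*-monoʳ-≤ e slope) constant-term ⟩
    e * (j * (s * suc s)) + l * (s * s)                         ≡⟨ cong (_+ l * (s * s)) (expand-square e j s) ⟩
    e * j * (s * s) + e * j * s + l * (s * s)                   ≤⟨ +-monoˡ-≤ (l * (s * s)) (+-monoʳ-≤ (e * j * (s * s)) linear-term) ⟩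
    e * j * (s * s) + k * (s * s) + l * (s * s)                 ≡⟨ collect (e * j) k l (s * s) ⟩
    (e * j + k + l) * (s * s)                                   ∎
    where
    expand-square : ∀ a b s → a * (b * (s * suc s)) ≡ a * b * (s * s) + a * b * s
    expand-square = solve-∀
    collect : ∀ a b c x → a * x + b * x + c * x ≡ (a + b + c) * x
    collect = solve-∀
    linear-term : e * j * s ≤ k * (s * s)
    linear-term = begin
      e * j * s        ≤⟨ *-monoˡ-≤ s linear ⟩
      k * f * s        ≡⟨ *-assoc k f s ⟩
      k * (f * s)      ≤⟨ *-monoʳ-≤ k (*-monoˡ-≤ s f≤s) ⟩
      k * (s * s)      ∎
    constant-term : K * c + w * o + τ * i ≤ l * (s * s)
    constant-term = ≤-trans constant (*-monoʳ-≤ l (*-mono-≤ f≤s f≤s))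

  absurd : ⊥
  absurd = <⇒≱ (*-monoˡ-< (s * s) {{>-nonZero (*-mono-≤ s≥1 s≥1)}} slack) upper
    where
    s≥1 : 1 ≤ s
    s≥1 = ≤-trans 1≤f f≤s

margin : ∀ m N s n ℓ Y W E → ℓ ≡ 16 + 2 * n → 2 ≤ n → 128 * 2 ^ n ≤ s → 512 ≤ s → s * s ≤ N →
  N ≤ 30 * m + 29 → 128 * Y ≤ N → 512 * E ≤ 23 * N + 512 * (s * (17 + 2 * n)) →
  1024 * W ≤ unitLimit * N + offsetLimit →
  ¬ 1275 * m ≤ 32 * (ℓ + ℓ * suc s + 1 + E) + (96 * Y + 1088) + W
margin m N s n ℓ Y W E ℓ≡ 2≤n 2^≤s 512≤s s²≤N N≤ Y≤ E≤ W≤ total = MarginArithmetic.absurd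
  -- 30720 is the common denominator 30 · 1024 of the costs per unit of `N`. Over it the lower bound
  -- 1275 / 30 becomes 1305600, the costs take 1920 · 23 + 23040 + 30 · 37600, and 110400 is left.
  -- Against this stand 1920 · 41 for the √N log N terms, 154 for replacing `suc s` by `s`, and 9542
  -- for the constants.
  30720 32 96 1088 1275 1920 512 23 23040 128 30 1024 unitLimit offsetLimit 1305600 30 29 110400 41 154 9542
  refl refl refl τ≡ refl refl (≤ᵇ⇒≤ (1920 * 41) (154 * 512) tt) constant
  (≤ᵇ⇒≤ (suc (1920 * 41 + 154 + 9542)) 110400 tt) (s≤s z≤n)
  m N s (17 + 2 * n) (33 + 4 * n) (2 ^ n) (ℓ + ℓ * suc s + 1) Y W E X+su≡
  (linear≤power′ n 2≤n) 2^≤s 512≤s s²≤N N≤ Y≤ E≤ W≤ total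
  where
  opaque
    unfolding unitLimit
    τ≡ : 110400 + (1920 * 23 + 23040 + 30 * unitLimit) ≡ 1305600
    τ≡ = refl
    constant : 30720 * 1088 + 30 * offsetLimit + 1305600 * 29 ≤ 9542 * (512 * 512)
    constant = ≤ᵇ⇒≤ (30720 * 1088 + 30 * offsetLimit + 1305600 * 29) (9542 * (512 * 512)) tt
  X+su≡ : ℓ + ℓ * suc s + 1 + s * (17 + 2 * n) ≡ (33 + 4 * n) * suc s
  X+su≡ = trans (cong (λ ℓ → ℓ + ℓ * suc s + 1 + s * (17 + 2 * n)) ℓ≡) (combine n s)
    where
    combine : ∀ n s → 16 + 2 * n + (16 + 2 * n) * suc s + 1 + s * (17 + 2 * n) ≡ (33 + 4 * n) * suc s
    combine = solve-∀

-- The odd primes up to N / 128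

10!≤ : 10 ! ≤ 2 ^ 34
10!≤ = ≤ᵇ⇒≤ (10 !) (2 ^ 34) tt

-- Two steps' worth of exponents, 64 + 96 on about half of `X`, give `80 * X + 160`. The spare
-- `16 * X` covers 160 from `X = 10` on.
halving : ∀ X → 10 ≤ X → 64 * suc (X / 2) + (96 * suc (X / 2) + 1088) ≤ 96 * X + 1088
halving X 10≤X = begin
  64 * M + (96 * M + 1088)     ≡⟨ regroup M ⟩
  80 * (M * 2) + 1088          ≤⟨ +-monoˡ-≤ 1088 (*-monoʳ-≤ 80 (+-monoʳ-≤ 2 (m/n*n≤m X 2))) ⟩
  80 * (2 + X) + 1088          ≡⟨ regroup′ X ⟩
  16 * 10 + 80 * X + 1088      ≤⟨ +-monoˡ-≤ 1088 (+-monoˡ-≤ (80 * X) (*-monoʳ-≤ 16 10≤X)) ⟩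
  16 * X + 80 * X + 1088       ≡⟨ cong (_+ 1088) (sym (*-distribʳ-+ X 16 80)) ⟩
  96 * X + 1088                ∎
  where
  open ≤-Reasoning
  M : ℕ
  M = suc (X / 2)
  regroup : ∀ m → 64 * m + (96 * m + 1088) ≡ 80 * (m * 2) + 1088
  regroup = solve-∀
  regroup′ : ∀ x → 80 * (2 + x) + 1088 ≡ 16 * 10 + 80 * x + 1088
  regroup′ = solve-∀

sieve-2 : Sieve 2 64
sieve-2 = mkSieve 2 64 1 ((2 , 1) ∷ []) ((s≤s z≤n , refl) ∷ [])
  (λ p pr p∣2 → here (prime∣prime pr prime[2] p∣2))
  (at-D ((2 ^ 1 * (2 ^ 1 * 1))) 64 1 (≤ᵇ⇒≤ (4 ^ 32) ((2 ^ 64) ^ 1) tt))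

-- The sieve modulo 2, iterated down to `X < 10`. Its 3 bits per unit are weaker than the classical
-- 2, but it is only applied up to `N / 128`.
primorial-bound : ∀ {R} {P : ℕ → Set} (P? : ∀ i → Dec (P i)) → InClass 2 R P →
  ∀ X → primesIn P? X ^ D ≤ 2 ^ (96 * X + 1088)
primorial-bound P? class = <-rec _ λ X rec → by X rec (10 ≤? X)
  where
  open ≤-Reasoning
  by : ∀ X → (∀ {Z} → Z < X → primesIn P? Z ^ D ≤ 2 ^ (96 * Z + 1088)) → Dec (10 ≤ X) →
       primesIn P? X ^ D ≤ 2 ^ (96 * X + 1088)
  by X rec (yes 10≤X) = begin
    primesIn P? X ^ D                          ≤⟨ sieve-step P? sieve-2 class X ⟩
    2 ^ (64 * M) * primesIn P? M ^ D           ≤⟨ *-monoʳ-≤ (2 ^ (64 * M)) (rec M<X) ⟩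
    2 ^ (64 * M) * 2 ^ (96 * M + 1088)         ≡⟨ sym (^-distribˡ-+-* 2 (64 * M) (96 * M + 1088)) ⟩
    2 ^ (64 * M + (96 * M + 1088))             ≤⟨ ^-monoʳ-≤ 2 (halving X 10≤X) ⟩
    2 ^ (96 * X + 1088)                        ∎
    where
    M : ℕ
    M = suc (X / 2)
    M<X : M < X
    M<X = *-cancelʳ-< 2 M X (begin-strict
      M * 2          ≤⟨ +-monoʳ-≤ 2 (m/n*n≤m X 2) ⟩
      2 + X          <⟨ +-monoˡ-< X (≤-trans (≤ᵇ⇒≤ 3 10 tt) 10≤X) ⟩
      X + X          ≡⟨ trans (cong (X +_) (sym (+-identityʳ X))) (*-comm 2 X) ⟩
      X * 2          ∎)
  by X rec (no 10≰X) = begin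
    primesIn P? X ^ D                          ≤⟨ ^-monoˡ-≤ D (≤-trans (∏-mono (suc X) (λ i _ → pointwise i))
                                                   (≤-trans (≤-reflexive (sym (!≡∏ (suc X)))) small)) ⟩
    (2 ^ 34) ^ D                               ≡⟨ cong ((2 ^ 34) ^_) D≡32 ⟩
    (2 ^ 34) ^ 32                              ≡⟨ ^-*-assoc 2 34 32 ⟩
    2 ^ 1088                                   ≤⟨ ^-monoʳ-≤ 2 (m≤n+m 1088 (96 * X)) ⟩
    2 ^ (96 * X + 1088)                        ∎
    where
    pointwise : ∀ i → only (P? i) i ≤ suc i
    pointwise i with P? i
    ... | yes _ = n≤1+n i
    ... | no _  = s≤s z≤n
    small : (suc X) ! ≤ 2 ^ 34
    small = ≤-trans (∣⇒≤ {{10 !≢0}} (m≤n⇒m!∣n! (≰⇒> 10≰X))) 10!≤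

-- The contradiction for N at least 2¹⁸

square-coarse : ∀ a e → a < 2 ^ e → (4 * (2 * (a * a))) ^ D ≤ 2 ^ ((3 + (e + e)) * D)
square-coarse a e a< = begin
  (4 * (2 * (a * a))) ^ D       ≡⟨ cong (_^ D) (sym (*-assoc 4 2 (a * a))) ⟩
  (8 * (a * a)) ^ D             ≤⟨ ^-monoˡ-≤ D (*-monoʳ-≤ 8 (*-mono-≤ (<⇒≤ a<) (<⇒≤ a<))) ⟩
  (8 * (2 ^ e * 2 ^ e)) ^ D     ≡⟨ cong (λ x → (8 * x) ^ D) (sym (^-distribˡ-+-* 2 e e)) ⟩
  (8 * 2 ^ (e + e)) ^ D         ≡⟨ cong (_^ D) (sym (^-distribˡ-+-* 2 3 (e + e))) ⟩
  (2 ^ (3 + (e + e))) ^ D       ≡⟨ ^-*-assoc 2 (3 + (e + e)) D ⟩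
  2 ^ ((3 + (e + e)) * D)       ∎
  where open ≤-Reasoning

square-mono : ∀ {s A} → s < A → suc s * suc s ≤ A * A
square-mono s<A = *-mono-≤ s<A s<A

-- The exponent 7 is kept as a variable k to prevent 2 ^ (7 + n) from unfolding.
module Large (q N n s ℓ k : ℕ) (k≡7 : k ≡ 7) (q-prime : Prime q) (2∣N : 2 ∣ N) (2≤n : 2 ≤ n)
  (2^≤s : 2 ^ (k + n) ≤ s) (s<2^ : s < 2 ^ (suc k + n)) (s²≤N : s * s ≤ N) (N<s² : N < suc s * suc s)
  (ℓ≡ : ℓ ≡ 16 + 2 * n)
  (exceptional : ∀ p → Prime p → p ≢ 2 → p < N → ¬ (SquareFree (N ∸ p) × ¬ q ∣ N ∸ p)) where

  open ≤-Reasoning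

  2^k+ : ∀ m → 2 ^ (k + m) ≡ 128 * 2 ^ m
  2^k+ m = trans (^-distribˡ-+-* 2 k m) (cong (λ k → 2 ^ k * 2 ^ m) k≡7)

  2^1+k+ : ∀ m → 2 ^ (suc k + m) ≡ 256 * 2 ^ m
  2^1+k+ m = trans (^-distribˡ-+-* 2 (suc k) m) (cong (λ k → 2 ^ suc k * 2 ^ m) k≡7)

  128*2^n≤s : 128 * 2 ^ n ≤ s
  128*2^n≤s = subst (_≤ s) (2^k+ n) 2^≤s

  512≤s : 512 ≤ s
  512≤s = ≤-trans (*-monoʳ-≤ 128 (^-monoʳ-≤ 2 2≤n)) 128*2^n≤s

  A : ℕ
  A = 2 ^ (suc k + n)

  N<A² : N < A * A
  N<A² = <-≤-trans N<s² (square-mono s<2^)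

  N<2^ℓ : N < 2 ^ ℓ
  N<2^ℓ = subst (N <_) (trans (sym (^-distribˡ-+-* 2 (suc k + n) (suc k + n)))
    (cong (2 ^_) (trans (cong (λ k → (suc k + n) + (suc k + n)) k≡7) (trans (double n) (sym ℓ≡))))) N<A²
    where
    double : ∀ n → (8 + n) + (8 + n) ≡ 16 + 2 * n
    double = solve-∀

  open ClassBounds q N n s ℓ q-prime 2∣N 2≤n 128*2^n≤s 512≤s s²≤N N<s² N<2^ℓ ℓ≡
  open Classes q N Y 2∣N
  -- The lower limit 0 excludes no prime, so here the base consists of all odd primes up to `N`.
  module All-odd = Classes q N 0 2∣N

  tailModulus F B : ℕ → ℕ
  -- The modulus at the lower end of block `m` bounds the number of terms for every `a` in the
  -- block. The weight `21 + 2 * m` comes from `a < 2 ^ (9 + m)` at the upper end, as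
  -- `8 * (a * a) < 2 ^ (21 + 2 * m)`.
  tailModulus m = 2 * (2 ^ (suc k + m) * 2 ^ (suc k + m))
  F m = pred (level (tailModulus m) N)
  B m = (21 + 2 * m) * D * level (tailModulus m) N

  E : ℕ
  E = ∑ n (λ m → 128 * 2 ^ m * ((21 + 2 * m) * suc (F m)))

  tailModulus≢0 : ∀ m → NonZero (tailModulus m)
  tailModulus≢0 m = m*n≢0 2 _ {{_}} {{m*n≢0 _ _ {{m^n≢0 2 (suc k + m)}} {{m^n≢0 2 (suc k + m)}}}}

  Qa-even : ∀ i → Qa (2 * i) ≡ 1
  Qa-even i = empty (squareClass? (2 * i)) λ _ (_ , (pr , 2i≢2) , _) → odd-prime pr 2i≢2 (m∣m*n i)

  Qa-tail : ∀ m a → 2 ^ (suc k + m) ≤ a → a < 2 ^ suc (suc k + m) → Qa a ^ D ≤ 2 ^ B m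
  Qa-tail m a ≤a a< = by (oddPrime? a)
    where
    by : Dec (OddPrime a) → Qa a ^ D ≤ 2 ^ B m
    by (no ¬odd)         = one^D≤ (B m) (empty (squareClass? a) λ _ p → ¬odd (proj₁ (proj₂ p)))
    by (yes odd@(pr , _)) = begin
      Qa a ^ D
        ≤⟨ sieve-bound-large {w = (21 + 2 * m) * D} (squareClass? a) (coarseSieve {w = (21 + 2 * m) * D} pr (onlyPrimes-2l² pr) coarse) (squareClass-class odd)
             large N≥ (λ i p → proj₂ (proj₂ (proj₂ (proj₁ p)))) ⟩
      2 ^ ((21 + 2 * m) * D * level (2 * (a * a)) N)
        ≤⟨ ^-monoʳ-≤ 2 (*-monoʳ-≤ ((21 + 2 * m) * D)
             (level-antitone (tailModulus m) (2 * (a * a)) N {{tailModulus≢0 m}} (*-monoʳ-≤ 2 (*-mono-≤ ≤a ≤a)))) ⟩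
      2 ^ B m ∎
      where
      256≤a : 256 ≤ a
      256≤a = ≤-trans (m≤m*n 256 (2 ^ m) {{m^n≢0 2 m}}) (≤-trans (≤-reflexive (sym (2^1+k+ m))) ≤a)
      large : 131072 ≤ 2 * (a * a)
      large = ≤-trans (≤ᵇ⇒≤ 131072 (2 * (256 * 256)) tt) (*-monoʳ-≤ 2 (*-mono-≤ 256≤a 256≤a))
      twenty-one : ∀ m → 3 + ((9 + m) + (9 + m)) ≡ 21 + 2 * m
      twenty-one = solve-∀
      coarse : (4 * (2 * (a * a))) ^ D ≤ 2 ^ ((21 + 2 * m) * D)
      coarse = subst (λ e → (4 * (2 * (a * a))) ^ D ≤ 2 ^ (e * D))
        (trans (cong (λ k → 3 + (suc (suc k + m) + suc (suc k + m))) k≡7) (twenty-one m))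
        (square-coarse a (suc (suc k + m)) a<)

  tail-exponent : ∑ n (λ m → 2 ^ (k + m) * B m) ≡ D * E
  tail-exponent = trans (∑-cong n λ m _ → term m) (∑-*ˡ n D _)
    where
    term : ∀ m → 2 ^ (k + m) * B m ≡ D * (128 * 2 ^ m * ((21 + 2 * m) * suc (F m)))
    term m = trans (cong₂ (λ p l → p * ((21 + 2 * m) * D * l)) (2^k+ m)
                     (sym (suc-pred-level (tailModulus m) N)))
                   (regroup (128 * 2 ^ m) (21 + 2 * m) D (suc (F m)))
      where
      regroup : ∀ p x d l → p * (x * d * l) ≡ d * (p * (x * l))
      regroup = solve-∀

  squares-bound : ∏ A Qa ^ D ≤ ∏ 256 Qa ^ D * 2 ^ (D * E)
  squares-bound = subst₂ (λ k e → ∏ A Qa ^ D ≤ ∏ k Qa ^ D * 2 ^ e) 2^8≡ tail-exponent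
    (Dyadic.dyadic Qa B k Qa-even Qa-tail n)
    where
    2^8≡ : 2 ^ suc k ≡ 256
    2^8≡ = cong (λ k → 2 ^ suc k) k≡7

  E≤ : 512 * E ≤ 23 * N + 512 * (s * (17 + 2 * n))
  E≤ = ≤-trans (tail-sum 512 128 N F F≤ n)
    (+-monoʳ-≤ (23 * N) (*-monoʳ-≤ 512 (*-monoˡ-≤ (17 + 2 * n) 128*2^n≤s)))
    where
    F≤ : ∀ m → 2 * (512 * 128) * (2 ^ m * 2 ^ m) * F m ≤ N
    F≤ m = subst (λ k → k * F m ≤ N) modulus≡ (pred-level-bound (tailModulus m) N {{tailModulus≢0 m}})
      where
      256² : 256 * 256 ≡ 512 * 128
      256² = refl
      regroup : ∀ a c → 2 * (a * c * (a * c)) ≡ 2 * (a * a) * (c * c)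
      regroup = solve-∀
      modulus≡ : tailModulus m ≡ 2 * (512 * 128) * (2 ^ m * 2 ^ m)
      modulus≡ = trans (cong (λ x → 2 * (x * x)) (2^1+k+ m))
        (trans (regroup 256 (2 ^ m)) (cong (λ x → 2 * x * (2 ^ m * 2 ^ m)) 256²))

  oddPrimes≤Y : primesIn All-odd.base? Y ^ D ≤ 2 ^ (96 * Y + 1088)
  oddPrimes≤Y = primorial-bound All-odd.base? (All-odd.class-2c {c = 1} (λ 2∣1 → contradiction (∣1⇒≡1 2∣1) λ ()) λ i p → p , 1∣ _) Y

  primes-split : primesIn prime? N ≤ 2 * primesIn All-odd.base? Y * primesIn base? N
  primes-split = begin
    primesIn prime? N                                 ≤⟨ ∏-mono (suc N) (λ i i≤N → pointwise i (s≤s⁻¹ i≤N)) ⟩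
    ∏ (suc N) (λ i → two i * low i * only (base? i) i)  ≡⟨ ∏-* (suc N) (λ i → two i * low i) _ ⟩
    ∏ (suc N) (λ i → two i * low i) * primesIn base? N  ≡⟨ cong (_* primesIn base? N) (∏-* (suc N) two low) ⟩
    ∏ (suc N) two * ∏ (suc N) low * primesIn base? N
      ≤⟨ *-monoˡ-≤ (primesIn base? N) (*-mono-≤ (≤-reflexive (∏-only-≟ (suc N) 2 (λ _ → 2) 2<1+N)) low≤) ⟩
    2 * primesIn All-odd.base? Y * primesIn base? N   ∎
    where
    two low : ℕ → ℕ
    two i = only (i ≟ 2) 2
    low i = only (All-odd.base? i ×-dec i ≤? Y) i
    2<1+N : 2 < suc N
    2<1+N = s≤s (≤-trans (≤ᵇ⇒≤ 2 262144 tt) N≥)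
    low≥1 : ∀ i → 1 ≤ low i
    low≥1 = only-prime≥1 (λ i → All-odd.base? i ×-dec i ≤? Y) (λ i p → proj₁ (proj₁ p))
    base≥1 : ∀ i → 1 ≤ only (base? i) i
    base≥1 = only-prime≥1 base? (λ i → proj₁)
    low≤ : ∏ (suc N) low ≤ primesIn All-odd.base? Y
    low≤ = ≤-trans
      (∏-≤ (suc N) (suc Y) low low≥1 (λ i Y<i _ → only-no {d = All-odd.base? i ×-dec i ≤? Y} λ (_ , i≤Y) → <⇒≱ Y<i i≤Y))
      (∏-mono (suc Y) λ i _ → drop i (All-odd.base? i) (i ≤? Y))
      where
      drop : ∀ i (d : Dec (All-odd.Base i)) (d′ : Dec (i ≤ Y)) → only (d ×-dec d′) i ≤ only d i
      drop i (yes p) (yes _) = ≤-refl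
      drop i (yes p) (no _)  = ≤-trans (s≤s z≤n) (prime≥2 (proj₁ p))
      drop i (no _)  _       = ≤-refl
    pointwise : ∀ i → i ≤ N → only (prime? i) i ≤ two i * low i * only (base? i) i
    pointwise i i≤N = by (prime? i) (i ≟ 2) (i ≤? Y)
      where
      two≥1 : 1 ≤ two i
      two≥1 = only-≥1 (i ≟ 2) (s≤s z≤n)
      by : (d : Dec (Prime i)) → Dec (i ≡ 2) → Dec (i ≤ Y) → only d i ≤ two i * low i * only (base? i) i
      by (no _)   _         _         = *-mono-≤ (*-mono-≤ two≥1 (low≥1 i)) (base≥1 i)
      by (yes _)  (yes i≡2) _         = begin
        i                                        ≡⟨ i≡2 ⟩
        2                                        ≡⟨ sym (only-yes {d = i ≟ 2} i≡2) ⟩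
        two i                                    ≡⟨ sym (trans (*-identityʳ (two i * 1)) (*-identityʳ (two i))) ⟩
        two i * 1 * 1                            ≤⟨ *-mono-≤ (*-monoʳ-≤ (two i) (low≥1 i)) (base≥1 i) ⟩
        two i * low i * only (base? i) i         ∎
      by (yes pr) (no i≢2)  (yes i≤Y) = begin
        i                                        ≡⟨ sym (only-yes {d = All-odd.base? i ×-dec i ≤? Y}
                                                      ((pr , i≢2 , i≤N , ≤-trans (s≤s z≤n) (prime≥2 pr)) , i≤Y)) ⟩
        low i                                    ≡⟨ sym (trans (*-identityʳ (1 * low i)) (*-identityˡ (low i))) ⟩
        1 * low i * 1                            ≤⟨ *-mono-≤ (*-monoˡ-≤ (low i) two≥1) (base≥1 i) ⟩
        two i * low i * only (base? i) i         ∎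
      by (yes pr) (no i≢2)  (no i≰Y)  = begin
        i                                        ≡⟨ sym (only-yes {d = base? i} (pr , i≢2 , i≤N , ≰⇒> i≰Y)) ⟩
        only (base? i) i                         ≡⟨ sym (*-identityˡ _) ⟩
        1 * only (base? i) i                     ≤⟨ *-monoˡ-≤ (only (base? i) i) (*-mono-≤ two≥1 (low≥1 i)) ⟩
        two i * low i * only (base? i) i         ∎

  m x W : ℕ
  m = N / 30
  x = 30 * m
  W = proj₁ small

  x≤N : x ≤ N
  x≤N = subst (_≤ N) (*-comm m 30) (m/n*n≤m N 30)

  N≤30m+29 : N ≤ 30 * m + 29
  N≤30m+29 = begin
    N                    ≡⟨ m≡m%n+[m/n]*n N 30 ⟩
    N % 30 + m * 30      ≤⟨ +-mono-≤ (s≤s⁻¹ (m%n<n N 30)) (≤-reflexive (*-comm m 30)) ⟩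
    29 + 30 * m          ≡⟨ +-comm 29 (30 * m) ⟩
    30 * m + 29          ∎

  1≤m : 1 ≤ m
  1≤m = /-monoˡ-≤ 30 (≤-trans (≤ᵇ⇒≤ 30 262144 tt) N≥)

  7m+7≤N : 7 * suc m ≤ N
  7m+7≤N = begin
    7 * suc m            ≡⟨ *-suc 7 m ⟩
    7 + 7 * m            ≤⟨ +-monoˡ-≤ (7 * m) (*-monoʳ-≤ 7 1≤m) ⟩
    7 * m + 7 * m        ≡⟨ sym (*-distribʳ-+ m 7 7) ⟩
    14 * m               ≤⟨ *-monoˡ-≤ m (≤ᵇ⇒≤ 14 30 tt) ⟩
    x                    ≤⟨ x≤N ⟩
    N                    ∎

  primes≤ : (primesIn prime? x) ^ D ≤ 2 ^ (D * 1 + (96 * Y + 1088) + (W + D * E))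
  primes≤ = begin
    primesIn prime? x ^ D
      ≤⟨ ^-monoˡ-≤ D (∏-≤ (suc x) (suc N) (λ i → only (prime? i) i) (only-prime≥1 prime? (λ _ pr → pr))
           (λ i N<i i≤x → contradiction (≤-trans (s≤s⁻¹ i≤x) x≤N) (<⇒≱ N<i))) ⟩
    primesIn prime? N ^ D
      ≤⟨ ^-monoˡ-≤ D (≤-trans primes-split (*-monoʳ-≤ (2 * PY) (base≤ exceptional {A} N<A²))) ⟩
    (2 * PY * (Qq * ∏ A Qa)) ^ D
      ≡⟨ trans (^-distribʳ-* D (2 * PY) (Qq * ∏ A Qa)) (cong₂ _*_ (^-distribʳ-* D 2 PY) (^-distribʳ-* D Qq (∏ A Qa))) ⟩
    2 ^ D * PY ^ D * (Qq ^ D * ∏ A Qa ^ D)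
      ≤⟨ *-mono-≤ (*-monoʳ-≤ (2 ^ D) oddPrimes≤Y) (*-monoʳ-≤ (Qq ^ D) squares-bound) ⟩
    2 ^ D * 2 ^ (96 * Y + 1088) * (Qq ^ D * (∏ 256 Qa ^ D * 2 ^ (D * E)))
      ≡⟨ cong (2 ^ D * 2 ^ (96 * Y + 1088) *_) (trans (sym (*-assoc (Qq ^ D) (∏ 256 Qa ^ D) (2 ^ (D * E))))
           (cong (_* 2 ^ (D * E)) (sym (^-distribʳ-* D Qq (∏ 256 Qa))))) ⟩
    2 ^ D * 2 ^ (96 * Y + 1088) * ((Qq * ∏ 256 Qa) ^ D * 2 ^ (D * E))
      ≤⟨ *-monoʳ-≤ (2 ^ D * 2 ^ (96 * Y + 1088)) (*-monoˡ-≤ (2 ^ (D * E)) (proj₁ (proj₂ small))) ⟩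
    2 ^ D * 2 ^ (96 * Y + 1088) * (2 ^ W * 2 ^ (D * E))
      ≡⟨ cong₂ _*_ (sym (^-distribˡ-+-* 2 D (96 * Y + 1088))) (sym (^-distribˡ-+-* 2 W (D * E))) ⟩
    2 ^ (D + (96 * Y + 1088)) * 2 ^ (W + D * E)
      ≡⟨ sym (^-distribˡ-+-* 2 (D + (96 * Y + 1088)) (W + D * E)) ⟩
    2 ^ (D + (96 * Y + 1088) + (W + D * E))
      ≡⟨ cong (λ d → 2 ^ (d + (96 * Y + 1088) + (W + D * E))) (sym (*-identityʳ D)) ⟩
    2 ^ (D * 1 + (96 * Y + 1088) + (W + D * E)) ∎
    where
    PY : ℕ
    PY = primesIn All-odd.base? Y

  -- In bits, `ℓ` pays for `7 * suc m`, `ℓ * suc s` for the prime powers in Chebyshev's bound, 1 for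
  -- the prime 2, and `E` for the squares of `a ≥ 256`. The other two summands, for the primes up to
  -- `Y` and for `small`, are already in units of 1 / 32.
  exponents : 1275 * m ≤ 32 * (ℓ + ℓ * suc s + 1 + E) + (96 * Y + 1088) + W
  exponents = ≮⇒≥ λ lt → <⇒≱ (^-monoʳ-< 2 (s≤s (s≤s z≤n)) lt) (begin
    2 ^ (1275 * m)
      ≤⟨ chebyshev m s 1≤m (≤-<-trans x≤N N<s²) ⟩
    (7 * suc m * (x ^ suc s * primesIn prime? x)) ^ D
      ≤⟨ ^-monoˡ-≤ D (*-mono-≤ (≤-trans 7m+7≤N (<⇒≤ N<2^ℓ)) (*-monoˡ-≤ (primesIn prime? x)
           (≤-trans (^-monoˡ-≤ (suc s) (≤-trans x≤N (<⇒≤ N<2^ℓ))) (≤-reflexive (^-*-assoc 2 ℓ (suc s)))))) ⟩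
    (2 ^ ℓ * (2 ^ (ℓ * suc s) * primesIn prime? x)) ^ D
      ≡⟨ cong (_^ D) (sym (*-assoc (2 ^ ℓ) (2 ^ (ℓ * suc s)) (primesIn prime? x))) ⟩
    (2 ^ ℓ * 2 ^ (ℓ * suc s) * primesIn prime? x) ^ D
      ≡⟨ ^-distribʳ-* D (2 ^ ℓ * 2 ^ (ℓ * suc s)) (primesIn prime? x) ⟩
    (2 ^ ℓ * 2 ^ (ℓ * suc s)) ^ D * primesIn prime? x ^ D
      ≡⟨ cong (_* primesIn prime? x ^ D) (trans (cong (_^ D) (sym (^-distribˡ-+-* 2 ℓ (ℓ * suc s)))) (^-*-assoc 2 (ℓ + ℓ * suc s) D)) ⟩
    2 ^ ((ℓ + ℓ * suc s) * D) * primesIn prime? x ^ D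
      ≤⟨ *-monoʳ-≤ (2 ^ ((ℓ + ℓ * suc s) * D)) primes≤ ⟩
    2 ^ ((ℓ + ℓ * suc s) * D) * 2 ^ (D * 1 + (96 * Y + 1088) + (W + D * E))
      ≡⟨ sym (^-distribˡ-+-* 2 ((ℓ + ℓ * suc s) * D) (D * 1 + (96 * Y + 1088) + (W + D * E))) ⟩
    2 ^ ((ℓ + ℓ * suc s) * D + (D * 1 + (96 * Y + 1088) + (W + D * E)))
      ≡⟨ cong (2 ^_) (trans (regroup (ℓ + ℓ * suc s) D (96 * Y + 1088) W E)
           (cong (λ d → d * (ℓ + ℓ * suc s + 1 + E) + (96 * Y + 1088) + W) D≡32)) ⟩
    2 ^ (32 * (ℓ + ℓ * suc s + 1 + E) + (96 * Y + 1088) + W) ∎)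
    where
    regroup : ∀ l d y w e → l * d + (d * 1 + y + (w + d * e)) ≡ d * (l + 1 + e) + y + w
    regroup = solve-∀

  absurd : ⊥
  absurd = margin m N s n ℓ Y W E ℓ≡ 2≤n 128*2^n≤s 512≤s s²≤N N≤30m+29
    (subst (_≤ N) (*-comm Y 128) (m/n*n≤m N 128)) E≤ (proj₂ (proj₂ small)) exponents

-- Even N < 2¹⁸ by computation

oddPrimes : List ℕ
oddPrimes =
  3 ∷ 5 ∷ 7 ∷ 11 ∷ 13 ∷ 17 ∷ 19 ∷ 23 ∷ 29 ∷ 31 ∷ 37 ∷ 41 ∷ 43 ∷ 47 ∷ 53 ∷ 59 ∷ 61 ∷ 67 ∷ 71 ∷
  73 ∷ 79 ∷ 83 ∷ 89 ∷ 97 ∷ 101 ∷ 103 ∷ 107 ∷ 109 ∷ 113 ∷ 127 ∷ 131 ∷ 137 ∷ 139 ∷ 149 ∷ 151 ∷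
  157 ∷ 163 ∷ 167 ∷ 173 ∷ 179 ∷ 181 ∷ 191 ∷ 193 ∷ 197 ∷ 199 ∷ 211 ∷ 223 ∷ 227 ∷ 229 ∷ 233 ∷
  239 ∷ 241 ∷ 251 ∷ 257 ∷ 263 ∷ 269 ∷ 271 ∷ 277 ∷ 281 ∷ 283 ∷ 293 ∷ 307 ∷ 311 ∷ 313 ∷ 317 ∷
  331 ∷ 337 ∷ 347 ∷ 349 ∷ 353 ∷ 359 ∷ 367 ∷ 373 ∷ 379 ∷ 383 ∷ 389 ∷ 397 ∷ 401 ∷ 409 ∷ 419 ∷
  421 ∷ 431 ∷ 433 ∷ 439 ∷ 443 ∷ 449 ∷ 457 ∷ 461 ∷ 463 ∷ 467 ∷ 479 ∷ 487 ∷ 491 ∷ 499 ∷ 503 ∷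
  509 ∷ []

-- One is subtracted so that every divisor tested has the form `suc k` and is visibly nonzero.
predSquares : List ℕ
predSquares = map (λ p → pred (p * p)) oddPrimes

isPositive : ℕ → Bool
isPositive zero    = false
isPositive (suc _) = true

avoids : List ℕ → ℕ → Bool
avoids []       x = true
avoids (k ∷ ks) x = isPositive (x % suc k) ∧ avoids ks x

avoids⇒∤ : ∀ ks x → T (avoids ks x) → ∀ {k} → k ∈ ks → ¬ suc k ∣ x
avoids⇒∤ (k ∷ ks) x t (here refl) 1+k∣x =
  subst (T ∘ isPositive) (n∣m⇒m%n≡0 x (suc k) 1+k∣x) (proj₁ (Equivalence.to T-∧ t))
avoids⇒∤ (k ∷ ks) x t (there k∈) = avoids⇒∤ ks x (proj₂ (Equivalence.to (T-∧ {isPositive (x % suc k)}) t)) k∈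

smallPrimes : List ℕ
smallPrimes = 2 ∷ 3 ∷ 5 ∷ 7 ∷ 11 ∷ 13 ∷ 17 ∷ 19 ∷ []

opaque
  -- As 23 · 23 = 529 exceeds 512, every composite number in the range has a prime factor among
  -- `smallPrimes`.
  trialDivision : ∀ {p} → p < 512 →
    p < 2 ⊎ p ≡ 2 ⊎ Any (λ d → d ∣ p × d ≢ p × 2 ≤ d) smallPrimes ⊎ p ∈ oddPrimes
  trialDivision = toWitness {a? = allUpTo? (λ p → p <? 2 ⊎-dec p ≟ 2 ⊎-dec
    any? (λ d → d ∣? p ×-dec ¬? (d ≟ p) ×-dec 2 ≤? d) smallPrimes ⊎-dec p ∈? oddPrimes) 512} tt

oddPrimes-complete : ∀ {p} → p < 512 → Prime p → p ≡ 2 ⊎ p ∈ oddPrimes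
oddPrimes-complete {p} p<512 pr with trialDivision p<512
... | inj₁ p<2               = contradiction (prime≥2 pr) (<⇒≱ p<2)
... | inj₂ (inj₁ p≡2)        = inj₁ p≡2
... | inj₂ (inj₂ (inj₁ any)) = ⊥-elim (no-divisor any)
  where
  no-divisor : ∀ {ds} → Any (λ d → d ∣ p × d ≢ p × 2 ≤ d) ds → ⊥
  no-divisor (there any)                 = no-divisor any
  no-divisor (here (d∣p , d≢p , 2≤d)) with prime⇒irreducible pr d∣p
  ... | inj₂ d≡p  = d≢p d≡p
  ... | inj₁ refl = contradiction 2≤d λ { (s≤s ()) }
... | inj₂ (inj₂ (inj₂ p∈))  = inj₂ p∈

-- The prime 2 is exempt, since only odd numbers are tested.
Complete : List ℕ → ℕ → Set
Complete ks L = ∀ {p} → Prime p → p * p < L → p ≡ 2 ⊎ pred (p * p) ∈ ks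

predSquares-complete : Complete predSquares (512 * 512)
predSquares-complete {p} pr p²< with oddPrimes-complete (≰⇒> λ 512≤p → <⇒≱ p²< (*-mono-≤ 512≤p 512≤p)) pr
... | inj₁ p≡2 = inj₁ p≡2
... | inj₂ p∈  = inj₂ (∈-map⁺ (λ p → pred (p * p)) p∈)

avoids⇒squareFree : ∀ {ks L} → Complete ks L → ∀ c → 1 + 2 * c < L → T (avoids ks (1 + 2 * c)) → SquareFree (1 + 2 * c)
avoids⇒squareFree {ks} {L} complete c x< t =
  s≤s z≤n , λ {p} pr p²∣x → impossible p pr (subst (_∣ 1 + 2 * c) (cong (p *_) (*-identityʳ p)) p²∣x)
  where
  impossible : ∀ p → Prime p → ¬ p * p ∣ 1 + 2 * c
  impossible p pr pp∣x with complete pr (≤-<-trans (∣⇒≤ pp∣x) x<)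
  ... | inj₁ refl = contradiction (∣1⇒≡1 (∣m+n∣m⇒∣n (subst (2 ∣_) (+-comm 1 (2 * c)) (m*n∣⇒m∣ 2 2 pp∣x)) (m∣m*n c))) λ ()
  ... | inj₂ k∈   = avoids⇒∤ ks (1 + 2 * c) t k∈
    (subst (_∣ 1 + 2 * c) (sym (suc-pred (p * p) {{m*n≢0 p p {{prime⇒nonZero pr}} {{prime⇒nonZero pr}}}})) pp∣x)

-- (i , e) stands for the primes 3 + 2 i and 3 + 2 (i + 2 ^ e). As they differ by a power of 2, no
-- prime divides both of the odd numbers obtained by subtracting them from N.
primePairs : List (ℕ × ℕ)
primePairs = (0 , 0) ∷ (13 , 2) ∷ (5 , 1) ∷ (2 , 1) ∷ (19 , 4) ∷ (25 , 2) ∷ (14 , 3) ∷ (1 , 0) ∷ []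

primePairs-prime : All (λ (i , e) → Prime (3 + 2 * i) × Prime (3 + 2 * (i + 2 ^ e))) primePairs
primePairs-prime = toWitness {a? = All.all? (λ (i , e) → prime? (3 + 2 * i) ×-dec prime? (3 + 2 * (i + 2 ^ e))) primePairs} tt

-- The default `false` rejects primes too large to be subtracted from the number under test.
bit : List Bool → ℕ → Bool
bit []       _       = false
bit (b ∷ bs) zero    = b
bit (b ∷ bs) (suc i) = bit bs i

anyPair : List (ℕ × ℕ) → List Bool → Bool
anyPair []             bs = false
anyPair ((i , e) ∷ ps) bs = (bit bs i ∧ bit bs (i + 2 ^ e)) ∨ anyPair ps bs

-- Entry i of history ks k tells whether 2 (k − i) − 1 avoids the squares.
history : List ℕ → ℕ → List Bool
history ks zero    = []
history ks (suc k) = avoids ks (1 + 2 * k) ∷ history ks k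

-- The history is passed on so that each odd number is tested only once.
search searchFrom : List ℕ → ℕ → ℕ → List Bool → Bool
search ks zero    k bs = true
search ks (suc n) k bs = searchFrom ks n k (avoids ks (1 + 2 * k) ∷ bs)
searchFrom ks n k bs = anyPair primePairs bs ∧ search ks n (1 + k) bs

search-sound : ∀ ks n k → T (search ks n k (history ks k)) → ∀ j → j < n →
               T (anyPair primePairs (history ks (suc (k + j))))
search-sound ks (suc n) k t zero    _ = subst (λ k → T (anyPair primePairs (history ks (suc k)))) (sym (+-identityʳ k))
  (proj₁ (Equivalence.to T-∧ t))
search-sound ks (suc n) k t (suc j) j<n = subst (λ k → T (anyPair primePairs (history ks (suc k)))) (sym (+-suc k j))
  (search-sound ks n (suc k) (proj₂ (Equivalence.to (T-∧ {anyPair primePairs (history ks (suc k))}) t)) j (s≤s⁻¹ j<n))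

opaque
  -- This covers `4 + 2 * k` for `k` from 1 to 131071.
  search-result : search predSquares 131071 1 (history predSquares 1) ≡ true
  search-result = refl

-- Subtracting the prime `3 + 2 * i` from `4 + 2 * k` leaves `1 + 2 * (k − i)`, so the index of the
-- prime is the position in the history.
bit-history : ∀ ks k i → T (bit (history ks (suc k)) i) → ∃[ c ] (k ≡ c + i × T (avoids ks (1 + 2 * c)))
bit-history ks k       zero    t = k , sym (+-identityʳ k) , t
bit-history ks zero    (suc i) ()
bit-history ks (suc k) (suc i) t with bit-history ks k i t
... | c , k≡ , t′ = c , trans (cong suc k≡) (sym (+-suc c i)) , t′

Represented : ℕ → ℕ → Set
Represented q N = ∃[ p ] ∃[ η ] (Prime p × SquareFree η × ¬ q ∣ η × N ≡ p + η)

pair-represented : ∀ {q ks h} → Complete ks (2 * h) → Prime q → ∀ k i e → k < h → Prime (3 + 2 * i) → Prime (3 + 2 * (i + 2 ^ e)) →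
  T (bit (history ks (suc k)) i) → T (bit (history ks (suc k)) (i + 2 ^ e)) →
  Represented q (4 + 2 * k)
pair-represented {q} {ks} {h} complete qr k i e k< pr pr′ t t′ with bit-history ks k i t | bit-history ks k (i + 2 ^ e) t′
... | c , k≡ , a | c′ , k≡′ , a′ = by (q ∣? 1 + 2 * c) (q ∣? 1 + 2 * c′)
  where
  bound : ∀ c i → k ≡ c + i → 1 + 2 * c < 2 * h
  bound c i k≡ = begin-strict
    1 + 2 * c              ≤⟨ s≤s (*-monoʳ-≤ 2 (subst (c ≤_) (sym k≡) (m≤m+n c i))) ⟩
    1 + 2 * k              <⟨ subst (1 + 2 * k <_) (sym (*-suc 2 k)) ≤-refl ⟩
    2 * suc k              ≤⟨ *-monoʳ-≤ 2 k< ⟩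
    2 * h                  ∎
    where open ≤-Reasoning
  sum : ∀ c i → k ≡ c + i → 4 + 2 * k ≡ 3 + 2 * i + (1 + 2 * c)
  sum c i refl = regroup c i
    where
    regroup : ∀ c i → 4 + 2 * (c + i) ≡ 3 + 2 * i + (1 + 2 * c)
    regroup = solve-∀
  c≡ : c ≡ c′ + 2 ^ e
  c≡ = +-cancelʳ-≡ i c (c′ + 2 ^ e) (trans (sym k≡) (trans k≡′ (regroup c′ i (2 ^ e))))
    where
    regroup : ∀ c i d → c + (i + d) ≡ c + d + i
    regroup = solve-∀
  ¬both : q ∣ 1 + 2 * c → q ∣ 1 + 2 * c′ → ⊥
  ¬both q∣ q∣′ with prime∣prime qr prime[2] (prime∣^ 2 (suc e) qr
    (∣m+n∣m⇒∣n (subst (q ∣_) (trans (cong (λ c → 1 + 2 * c) c≡) (regroup c′ (2 ^ e))) q∣) q∣′))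
    where
    regroup : ∀ c d → 1 + 2 * (c + d) ≡ 1 + 2 * c + 2 * d
    regroup = solve-∀
  ... | refl = contradiction (∣1⇒≡1 (∣m+n∣m⇒∣n (subst (2 ∣_) (+-comm 1 (2 * c)) q∣) (m∣m*n c))) λ ()
  by : Dec (q ∣ 1 + 2 * c) → Dec (q ∣ 1 + 2 * c′) → Represented q (4 + 2 * k)
  by (no q∤)  _        = 3 + 2 * i , 1 + 2 * c , pr , avoids⇒squareFree complete c (bound c i k≡) a , q∤ , sum c i k≡
  by (yes q∣) (no q∤)  = 3 + 2 * (i + 2 ^ e) , 1 + 2 * c′ , pr′ ,
    avoids⇒squareFree complete c′ (bound c′ (i + 2 ^ e) k≡′) a′ , q∤ , sum c′ (i + 2 ^ e) k≡′
  by (yes q∣) (yes q∣′) = ⊥-elim (¬both q∣ q∣′)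

anyPair-represented : ∀ {q ks h} → Complete ks (2 * h) → Prime q → ∀ k → k < h → ∀ ps →
  All (λ (i , e) → Prime (3 + 2 * i) × Prime (3 + 2 * (i + 2 ^ e))) ps →
  T (anyPair ps (history ks (suc k))) → Represented q (4 + 2 * k)
anyPair-represented {ks = ks} complete qr k k< ((i , e) ∷ ps) ((pr , pr′) ∷ prs) t
  with Equivalence.to (T-∨ {bit (history ks (suc k)) i ∧ bit (history ks (suc k)) (i + 2 ^ e)}) t
... | inj₁ both = pair-represented complete qr k i e k< pr pr′ (proj₁ (Equivalence.to T-∧ both))
  (proj₂ (Equivalence.to (T-∧ {bit (history ks (suc k)) i}) both))
... | inj₂ rest = anyPair-represented complete qr k k< ps prs rest

search-represented : ∀ {q ks h n} → Complete ks (2 * h) → search ks n 1 (history ks 1) ≡ true →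
  Prime q → ∀ j → j < n → suc j < h → Represented q (4 + 2 * suc j)
search-represented {ks = ks} {n = n} complete found qr j j<n j<h = anyPair-represented complete qr (suc j) j<h primePairs primePairs-prime
  (search-sound ks n 1 (subst T (sym found) tt) j j<n)

opaque
  represented-suc : ∀ {q} → Prime q → ∀ j → j < 131071 → Represented q (4 + 2 * suc j)
  represented-suc qr j j< = search-represented {ks = predSquares} {h = 131072} {n = 131071}
    predSquares-complete search-result qr j j< (s≤s j<)

represented-small : ∀ {q} → Prime q → ∀ k → k < 131072 → Represented q (4 + 2 * k)
-- For 4 only the prime 3 can be subtracted, so no pair exists; but 4 = 3 + 1, and no prime divides
-- 1.
represented-small {q} qr zero    _ = 3 , 1 , prime[3] , (s≤s z≤n , λ {p} pr p²∣1 → not-unit pr (prime∣^ 1 1 pr (∣-trans (m∣m*n (p ^ 1)) p²∣1))) ,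
  not-unit qr , refl
  where
  not-unit : ∀ {p} → Prime p → ¬ p ∣ 1
  not-unit pr p∣1 = contradiction (subst (2 ≤_) (∣1⇒≡1 p∣1) (prime≥2 pr)) λ { (s≤s ()) }
represented-small qr (suc j) k< = represented-suc qr j (s≤s⁻¹ k<)

-- Choice of the parameters, and the final assembly

squareFree? : ∀ x → Dec (SquareFree x)
squareFree? zero      = no λ ()
squareFree? x@(suc _) with anyUpTo? (λ p → prime? p ×-dec p ^ 2 ∣? x) (suc x)
... | yes (p , _ , pr , p²∣x) = no λ (_ , free) → free pr p²∣x
... | no none = yes (s≤s z≤n , λ {p} pr p²∣x → none (p ,
  s≤s (≤-trans (m≤m*n p (p ^ 1) {{m^n≢0 p 1 {{prime⇒nonZero pr}}}}) (∣⇒≤ p²∣x)) , pr , p²∣x))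

√-exists : ∀ N → ∃[ s ] (s * s ≤ N × N < suc s * suc s)
√-exists zero    = 0 , z≤n , s≤s z≤n
√-exists (suc N) with √-exists N
... | s , s²≤N , N<s² with suc N <? suc s * suc s
...   | yes 1+N<s² = s , m≤n⇒m≤1+n s²≤N , 1+N<s²
...   | no 1+N≮s²  = suc s , ≮⇒≥ 1+N≮s² , ≤-<-trans N<s² (*-mono-< {suc s} {suc (suc s)} {suc s} {suc (suc s)} ≤-refl ≤-refl)

log₂-exists : ∀ s → 1 ≤ s → ∃[ t ] (2 ^ t ≤ s × s < 2 ^ suc t)
log₂-exists (suc zero)        _ = 0 , s≤s z≤n , s≤s (s≤s z≤n)
log₂-exists (suc s@(suc _)) _ with log₂-exists s (s≤s z≤n)
... | t , 2^t≤s , s<2^ with suc s <? 2 ^ suc t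
...   | yes 1+s<2^ = t , m≤n⇒m≤1+n 2^t≤s , 1+s<2^
...   | no 1+s≮2^  = suc t , ≮⇒≥ 1+s≮2^ , ≤-<-trans s<2^ (^-monoʳ-< 2 (s≤s (s≤s z≤n)) {suc t} {suc (suc t)} ≤-refl)

represented-large : ∀ {q} → Prime q → ∀ N → 2 ∣ N → 262144 ≤ N → Represented q N
represented-large {q} qr N 2∣N N≥ = by (anyUpTo? good? N)
  where
  Good : ℕ → Set
  Good p = Prime p × SquareFree (N ∸ p) × ¬ q ∣ N ∸ p
  good? : ∀ p → Dec (Good p)
  good? p = prime? p ×-dec squareFree? (N ∸ p) ×-dec ¬? (q ∣? N ∸ p)
  √N : ∃[ s ] (s * s ≤ N × N < suc s * suc s)
  √N = √-exists N
  s : ℕ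
  s = proj₁ √N
  512≤s : 512 ≤ s
  512≤s = ≮⇒≥ λ s<512 → <⇒≱ (proj₂ (proj₂ √N)) (≤-trans (*-mono-≤ s<512 s<512) (≤-trans (≤ᵇ⇒≤ (512 * 512) 262144 tt) N≥))
  log₂s : ∃[ t ] (2 ^ t ≤ s × s < 2 ^ suc t)
  log₂s = log₂-exists s (≤-trans (s≤s z≤n) 512≤s)
  t : ℕ
  t = proj₁ log₂s
  9≤t : 9 ≤ t
  9≤t = ≮⇒≥ λ t<9 → <⇒≱ (proj₂ (proj₂ log₂s)) (≤-trans (^-monoʳ-≤ 2 t<9) 512≤s)
  7+n≡t : 7 + (t ∸ 7) ≡ t
  7+n≡t = m+[n∸m]≡n (≤-trans (≤ᵇ⇒≤ 7 9 tt) 9≤t)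
  by : Dec (∃[ p ] (p < N × Good p)) → Represented q N
  by (yes (p , p<N , pr , free , q∤)) = p , N ∸ p , pr , free , q∤ , sym (m+[n∸m]≡n (<⇒≤ p<N))
  by (no none) = ⊥-elim (Large.absurd q N (t ∸ 7) s (16 + 2 * (t ∸ 7)) 7 refl qr 2∣N
    (∸-monoˡ-≤ 7 9≤t)
    (subst (λ t → 2 ^ t ≤ s) (sym 7+n≡t) (proj₁ (proj₂ log₂s)))
    (subst (λ t → s < 2 ^ suc t) (sym 7+n≡t) (proj₂ (proj₂ log₂s)))
    (proj₁ (proj₂ √N)) (proj₂ (proj₂ √N)) refl
    (λ p pr _ p<N good → none (p , p<N , pr , good)))

represented : ∀ {q} → Prime q → ∀ k → Represented q (4 + 2 * k)
represented {q} qr k = by (k <? 131072)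
  where
  by : Dec (k < 131072) → Represented q (4 + 2 * k)
  by (yes k<) = represented-small qr k k<
  by (no k≮)  = represented-large qr (4 + 2 * k) (∣m∣n⇒∣m+n (divides 2 refl) (m∣m*n k))
    (≤-trans (≤ᵇ⇒≤ 262144 (2 * 131072) tt) (≤-trans (*-monoʳ-≤ 2 (≮⇒≥ k≮)) (m≤n+m (2 * k) 4)))

corollary6 : ∀ (q : ℕ) → Prime q → 2 ≤ q → q < 10 ^ 5 →
    ∀ (n : ℕ) → n > 4 →
    ∃[ p₁ ] ∃[ p₂ ] ∃[ η ]
    (Prime p₁ × Prime p₂ × SquareFree η × Coprime η q × n ≡ p₁ + p₂ + η)
corollary6 q qr _ _ n n>4 = by (n % 2) refl (m%n<n n 2) (n / 2) (m≡m%n+[m/n]*n n 2)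
  where
  Sum : ℕ → Set
  Sum n = ∃[ p₁ ] ∃[ p₂ ] ∃[ η ] (Prime p₁ × Prime p₂ × SquareFree η × Coprime η q × n ≡ p₁ + p₂ + η)
  add-prime : ∀ {p₁ k} → Prime p₁ → n ≡ p₁ + (4 + 2 * k) → Represented q (4 + 2 * k) → Sum n
  add-prime {p₁} pr₁ n≡ (p₂ , η , pr₂ , free , q∤η , N≡) =
    p₁ , p₂ , η , pr₁ , pr₂ , free , coprime-sym (prime∤⇒coprime qr q∤η) ,
    trans n≡ (trans (cong (p₁ +_) N≡) (sym (+-assoc p₁ p₂ η)))
  even : ∀ k → 2 + (4 + 2 * k) ≡ suc (suc (suc k)) * 2
  even = solve-∀
  odd : ∀ k → 3 + (4 + 2 * k) ≡ 1 + suc (suc (suc k)) * 2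
  odd = solve-∀
  by : ∀ r → n % 2 ≡ r → r < 2 → ∀ h → n ≡ n % 2 + h * 2 → Sum n
  by 0 r≡ _ h n≡ = go h (trans n≡ (cong (_+ h * 2) r≡))
    where
    go : ∀ h → n ≡ h * 2 → Sum n
    go 0 refl = contradiction n>4 λ ()
    go 1 refl = contradiction n>4 λ { (s≤s (s≤s ())) }
    go 2 refl = contradiction n>4 λ { (s≤s (s≤s (s≤s (s≤s ())))) }
    go (suc (suc (suc k))) n≡ = add-prime {k = k} prime[2] (trans n≡ (sym (even k))) (represented qr k)
  by 1 r≡ _ h n≡ = go h (trans n≡ (cong (_+ h * 2) r≡))
    where
    go : ∀ h → n ≡ 1 + h * 2 → Sum n
    go 0 refl = contradiction n>4 λ { (s≤s ()) }
    go 1 refl = contradiction n>4 λ { (s≤s (s≤s (s≤s ()))) }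
    -- Subtracting 3 from 5 would leave 2, below the range of `represented`, so 5 = 2 + 2 + 1 is
    -- treated directly.
    go 2 n≡5 = 2 , 2 , 1 , prime[2] , prime[2] , (s≤s z≤n , λ {p} pr p²∣1 →
      contradiction (subst (2 ≤_) (m*n≡1⇒m≡1 p (p ^ 1) (∣1⇒≡1 p²∣1)) (prime≥2 pr)) λ { (s≤s ()) }) ,
      (λ (d∣1 , _) → ∣1⇒≡1 d∣1) , n≡5
    go (suc (suc (suc k))) n≡ = add-prime {k = k} prime[3] (trans n≡ (sym (odd k))) (represented qr k)
  by (suc (suc _)) _ (s≤s (s≤s ()))
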